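{- There is an absolute constant $c>0$ such that the following holds. Let $t\ge1$, and let $d$ be a positive multiple of $4$ with $d\ge\max\{8,c\log(t+1)\}$. From a 3SAT instance on $n$ variables one can construct, in time $n^{O(d)}$, a system $\mathcal{Q}$ of quadratic equations over $\mathbb{F}_2$ with zero constant term, in the variables $\{y_S:S\in\mathcal{U}_{n,d}\}$, such that: (YES) if the 3SAT instance is satisfiable, then $\mathcal{Q}$ has a satisfying assignment $y$ with $y_{\{0\}}=1$; (NO) if the 3SAT instance is unsatisfiable and assignments $\tau^{(1)},\dots,\tau^{(t)}$ to the variables satisfy all equations of $\mathcal{Q}$ in superposition, then their aggregate assignment $\tau:=\sum_{i=1}^t\tau^{(i)}$ vanishes on every coordinate $y_S$, $S\in\mathcal{U}_{n,d}$. Moreover, $\mathcal{Q}$ is obtained from a system $\mathcal{B}$ of constant-free polynomial equations of degree at most $d$ over $\mathbb{F}_2$ in variables $x_0,\dots,x_n$, namely a system with the following properties: (i) if the formula is satisfiable, $\mathcal{B}$ has a satisfying assignment $a\in\mathbb{F}_2^{n+1}$ with $a_0=1$; (ii) if the formula is unsatisfiable and $\sigma$ is a monomial assignment of degree $d$ satisfying all equations of $\mathcal{B}$, then $\beta_\sigma=\{\mathbf 0\}$ or $|\beta_\sigma|\ge2^{d-3}$. Specifically, $\mathcal{Q}$ consists of the equations obtained by replacing each nonconstant monomial $x^S$ in each equation of $\mathcal{B}$ by the variable $y_S$, together with the constraints $y_Sy_T=y_{S\cup T}$ for all $S,T\in\mathcal{U}_{n,d}$ with $|S\cup T|\le d$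.
   Context: 3SAT is the problem of deciding satisfiability of a 3-CNF formula. $\mathcal{U}_{n,d}:=\{S\subseteq\{0,1,\dots,n\}:1\le|S|\le d\}$. For $S\subseteq\{0,\dots,n\}$, $x^S:=\prod_{i\in S}x_i$, $x^\emptyset=1$; polynomials in the $x$-variables are multilinear, i.e. reduced modulo $x_i^2=x_i$. "Constant-free" means zero constant term. A monomial assignment of degree $d$ is a map $\sigma:\{x^S:S\in\mathcal{U}_{n,d}\}\to\mathbb{F}_2$, extended by $\sigma(1)=1$ and linearity to multilinear polynomials of degree at most $d$; it satisfies an equation $p=0$ if $\sigma(p)=0$. For each such $\sigma$ there is a set $\beta\subseteq\mathbb{F}_2^{n+1}$ with $\sigma(q)=\sum_{a\in\beta}q(a)$ for all multilinear $q$ of degree at most $d$; $\beta_\sigma$ is a fixed such set of minimum cardinality. Superposition: for a polynomial $g(y)=\sum_{U,V}c_{U,V}y_Uy_V+\sum_Wd_Wy_W$ of degree at most $2$ with no constant term over $\mathbb{F}_2$, assignments $\tau^{(1)},\dots,\tau^{(t)}\in\mathbb{F}_2^{\mathcal{U}_{n,d}}$ satisfy $g(y)=0$ in superposition if $\sum_{i=1}^tg(\tau^{(i)})=0$ in $\mathbb{F}_2$; their aggregate assignment is the coordinatewise sum $\sum_i\tau^{(i)}$. An equation $y_Sy_T=y_{S\cup T}$ is regarded as $y_Sy_T+y_{S\cup T}=0$. -}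

module Defs where

open import Algebra.Bundles using (CommutativeRing)
open import Data.Bool using (Bool; true; false; not; _∧_; _xor_; if_then_else_)
open import Data.Bool.Properties using (xor-∧-commutativeRing)
open import Data.Fin using (Fin; zero; suc; toℕ)
open import Data.Fin.Subset using (Subset; ∣_∣; ⁅_⁆; _∪_)
open import Data.Fin.Subset.Properties using (∣⁅x⁆∣≡1; ∣p∣≤∣p∪q∣)
open import Data.List as List using (List; []; _∷_; [_]; length)
open import Data.List.Membership.Propositional using (_∈_)
open import Data.List.Relation.Unary.All using (All)
open import Data.List.Relation.Unary.Unique.Propositional using (Unique)
open import Data.Nat using (ℕ; zero; suc; _+_; _^_; _≤_)
open import Data.Nat.Properties using (≤-trans; ≤-reflexive)
open import Data.Product using (Σ; Σ-syntax; ∃-syntax; _×_; _,_)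
open import Data.Sum using (_⊎_)
open import Data.Vec as Vec using (Vec; []; _∷_; lookup; _[_]≔_; replicate; zipWith)
import Data.Vec.Relation.Unary.Any as VecAny
open import Function using (_∘_; _⇔_)
open import Relation.Binary.PropositionalEquality using (_≡_; refl; sym)

import Algebra.Properties.CommutativeMonoid.Sum

------------------------------------------------------------------------
-- 𝔽₂, with 0 = false, 1 = true, addition _xor_ and multiplication _∧_

𝔽₂ : Set
𝔽₂ = Bool

pattern 𝟘 = false
pattern 𝟙 = true

open Algebra.Properties.CommutativeMonoid.Sum
  (CommutativeRing.+-commutativeMonoid xor-∧-commutativeRing) public
  using (sum)

sumOver : {A : Set} → List A → (A → 𝔽₂) → 𝔽₂
sumOver xs f = List.foldr _xor_ 𝟘 (List.map f xs)

------------------------------------------------------------------------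
-- 3SAT

data Literal (n : ℕ) : Set where
  pos neg : Fin n → Literal n

-- Literals of a clause may repeat, so clauses with fewer than three distinct
-- literals are included.
Clause : ℕ → Set
Clause n = Vec (Literal n) 3

-- A formula is a finite set of clauses.  Without the absence of repetitions
-- its length would not be bounded in terms of n, and no algorithm could read
-- it in time n^O(d).
record Formula (n : ℕ) : Set where
  constructor mkFormula
  field
    clauses : List (Clause n)
    unique  : Unique clauses

open Formula public

literalValue : ∀ {n} → Vec Bool n → Literal n → Bool
literalValue a (pos i) = lookup a i
literalValue a (neg i) = not (lookup a i)

_⊨_ : ∀ {n} → Vec Bool n → Formula n → Set
a ⊨ φ = All (VecAny.Any (λ l → literalValue a l ≡ true)) (clauses φ)

Satisfiable : ∀ {n} → Formula n → Set
Satisfiable {n} φ = ∃[ a ] a ⊨ φ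

------------------------------------------------------------------------
-- Multilinear polynomials of degree at most d in x₀,…,xₙ

-- The proofs are irrelevant, so an index is determined by its underlying set.
record 𝒰 (n d : ℕ) : Set where
  constructor mk𝒰
  field
    set       : Subset (suc n)
    .nonempty : 1 ≤ ∣ set ∣
    .bounded  : ∣ set ∣ ≤ d

open 𝒰 public using (set)

｛0｝ : ∀ {n d} → .(1 ≤ d) → 𝒰 n d
｛0｝ {n} 1≤d = mk𝒰 ⁅ zero ⁆
  (≤-reflexive (sym (∣⁅x⁆∣≡1 {suc n} zero)))
  (≤-trans (≤-reflexive (∣⁅x⁆∣≡1 {suc n} zero)) 1≤d)

union : ∀ {n d} (S T : 𝒰 n d) → .(∣ set S ∪ set T ∣ ≤ d) → 𝒰 n d
union (mk𝒰 S 1≤S _) (mk𝒰 T _ _) h =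
  mk𝒰 (S ∪ T) (≤-trans 1≤S (∣p∣≤∣p∪q∣ S T)) h

-- constant + Σ x^S over the list; coefficients are in 𝔽₂, so a monomial listed
-- k times has coefficient k mod 2.
record Poly (n d : ℕ) : Set where
  constructor mkPoly
  field
    constant  : 𝔽₂
    monomials : List (𝒰 n d)

open Poly public

ConstantFree : ∀ {n d} → Poly n d → Set
ConstantFree p = constant p ≡ 𝟘

Point : ℕ → Set
Point n = Vec 𝔽₂ (suc n)

_^^_ : ∀ {n} → Point n → Subset (suc n) → 𝔽₂
a ^^ S = Vec.foldr′ _∧_ 𝟙 (zipWith (λ aᵢ i∈S → if i∈S then aᵢ else 𝟙) a S)

evalPoly : ∀ {n d} → Poly n d → Point n → 𝔽₂
evalPoly p a = constant p xor sumOver (monomials p) (λ S → a ^^ set S)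

_SolvesPoly_ : ∀ {n d} → Point n → List (Poly n d) → Set
a SolvesPoly B = All (λ p → evalPoly p a ≡ 𝟘) B

------------------------------------------------------------------------
-- Assignments indexed by 𝒰 n d.  They serve both as monomial assignments
-- (x^S ↦ σ S) and as assignments to the variables y_S.

Assignment : ℕ → ℕ → Set
Assignment n d = 𝒰 n d → 𝔽₂

-- Linear extension with σ(1) = 1.
extend : ∀ {n d} → Assignment n d → Poly n d → 𝔽₂
extend σ p = constant p xor sumOver (monomials p) σ

_SatisfiesMonomially_ : ∀ {n d} → Assignment n d → List (Poly n d) → Set
σ SatisfiesMonomially B = All (λ p → extend σ p ≡ 𝟘) B

record PointSet (n : ℕ) : Set where
  constructor mkPointSet
  field
    points : List (Point n)
    unique : Unique points

open PointSet public using (points)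

card : ∀ {n} → PointSet n → ℕ
card β = length (points β)

origin : ∀ {n} → Point n
origin = replicate _ 𝟘

_Represents_ : ∀ {n d} → PointSet n → Assignment n d → Set
_Represents_ {n} {d} β σ =
  (q : Poly n d) → extend σ q ≡ sumOver (points β) (evalPoly q)

-- β is an admissible choice of β_σ.
_IsMinimalFor_ : ∀ {n d} → PointSet n → Assignment n d → Set
β IsMinimalFor σ =
  β Represents σ × (∀ γ → γ Represents σ → card β ≤ card γ)

------------------------------------------------------------------------
-- Quadratic equations g(y) = 0 without constant term

-- g(y) = Σ y_U y_V + Σ y_W over the two lists.
record QuadPoly (n d : ℕ) : Set where
  constructor mkQuad
  field
    quadratic : List (𝒰 n d × 𝒰 n d)
    linear    : List (𝒰 n d)

open QuadPoly public

evalQuad : ∀ {n d} → QuadPoly n d → Assignment n d → 𝔽₂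
evalQuad g y =
  sumOver (quadratic g) (λ (U , V) → y U ∧ y V) xor sumOver (linear g) y

_Solves_ : ∀ {n d} → Assignment n d → List (QuadPoly n d) → Set
y Solves Q = All (λ g → evalQuad g y ≡ 𝟘) Q

_SolveInSuperposition_ : ∀ {n d t} →
  (Fin t → Assignment n d) → List (QuadPoly n d) → Set
τ SolveInSuperposition Q = All (λ g → sum (λ i → evalQuad g (τ i)) ≡ 𝟘) Q

aggregate : ∀ {n d t} → (Fin t → Assignment n d) → Assignment n d
aggregate τ S = sum (λ i → τ i S)

-- Replaces x^S by y_S; used only on constant-free polynomials.
linearize : ∀ {n d} → Poly n d → QuadPoly n d
linearize p = mkQuad [] (monomials p)

-- y_S y_T + y_{S∪T}
productConstraint : ∀ {n d} (S T : 𝒰 n d) → .(∣ set S ∪ set T ∣ ≤ d) →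
                    QuadPoly n d
productConstraint S T h = mkQuad [ (S , T) ] [ union S T h ]

-- Equality of systems as sets of equations: the order in which Q lists them
-- is left open.
_IsQuadratizationOf_ : ∀ {n d} → List (QuadPoly n d) → List (Poly n d) → Set
_IsQuadratizationOf_ {n} {d} Q B = ∀ g → g ∈ Q ⇔
  ( (∃[ p ] p ∈ B × g ≡ linearize p)
  ⊎ (Σ[ S ∈ 𝒰 n d ] Σ[ T ∈ 𝒰 n d ] Σ[ h ∈ ∣ set S ∪ set T ∣ ≤ d ]
       g ≡ productConstraint S T h))

------------------------------------------------------------------------
-- Computation: Jones's language WHILE over binary trees.
--
-- Every evaluation of an operator, assignment and test costs one unit.  Under
-- this measure, with trees shared in memory, WHILE and Turing machines simulate
-- each other with polynomial slowdown, so it defines the same class n^O(d).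

infixr 5 _∙_

data Tree : Set where
  nil : Tree
  _∙_ : Tree → Tree → Tree

size : Tree → ℕ
size nil     = 1
size (a ∙ b) = suc (size a + size b)

head tail : Tree → Tree
head nil     = nil
head (a ∙ b) = a
tail nil     = nil
tail (a ∙ b) = b

data Expr (k : ℕ) : Set where
  var   : Fin k → Expr k
  nil   : Expr k
  cons  : Expr k → Expr k → Expr k
  hd tl : Expr k → Expr k

infix  6 _:=_
infixr 5 _⨾_

data Command (k : ℕ) : Set where
  _:=_   : Fin k → Expr k → Command k
  _⨾_    : Command k → Command k → Command k
  ifnil_then_else_ : Expr k → Command k → Command k → Command k
  while_loop_      : Expr k → Command k → Command k

Store : ℕ → Set
Store k = Vec Tree k

⟦_⟧ : ∀ {k} → Expr k → Store k → Tree
⟦ var x ⟧    s = lookup s x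
⟦ nil ⟧      s = nil
⟦ cons e f ⟧ s = ⟦ e ⟧ s ∙ ⟦ f ⟧ s
⟦ hd e ⟧     s = head (⟦ e ⟧ s)
⟦ tl e ⟧     s = tail (⟦ e ⟧ s)

cost : ∀ {k} → Expr k → ℕ
cost (var x)    = 1
cost nil        = 1
cost (cons e f) = suc (cost e + cost f)
cost (hd e)     = suc (cost e)
cost (tl e)     = suc (cost e)

-- ⟨ c , s ⟩⇓⟨ s′ , m ⟩ : run from store s, c halts in store s′ at cost m.
data ⟨_,_⟩⇓⟨_,_⟩ {k : ℕ} : Command k → Store k → Store k → ℕ → Set where
  assign : ∀ {x e s} →
    ⟨ x := e , s ⟩⇓⟨ s [ x ]≔ ⟦ e ⟧ s , suc (cost e) ⟩
  seq : ∀ {c c′ s s′ s″ m m′} →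
    ⟨ c , s ⟩⇓⟨ s′ , m ⟩ → ⟨ c′ , s′ ⟩⇓⟨ s″ , m′ ⟩ →
    ⟨ c ⨾ c′ , s ⟩⇓⟨ s″ , m + m′ ⟩
  if-nil : ∀ {e c c′ s s′ m} →
    ⟦ e ⟧ s ≡ nil → ⟨ c , s ⟩⇓⟨ s′ , m ⟩ →
    ⟨ ifnil e then c else c′ , s ⟩⇓⟨ s′ , suc (cost e + m) ⟩
  if-cons : ∀ {e c c′ s s′ m a b} →
    ⟦ e ⟧ s ≡ a ∙ b → ⟨ c′ , s ⟩⇓⟨ s′ , m ⟩ →
    ⟨ ifnil e then c else c′ , s ⟩⇓⟨ s′ , suc (cost e + m) ⟩
  while-nil : ∀ {e c s} →
    ⟦ e ⟧ s ≡ nil →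
    ⟨ while e loop c , s ⟩⇓⟨ s , suc (cost e) ⟩
  while-cons : ∀ {e c s s′ s″ m m′ a b} →
    ⟦ e ⟧ s ≡ a ∙ b → ⟨ c , s ⟩⇓⟨ s′ , m ⟩ →
    ⟨ while e loop c , s′ ⟩⇓⟨ s″ , m′ ⟩ →
    ⟨ while e loop c , s ⟩⇓⟨ s″ , suc (cost e + (m + m′)) ⟩

-- Variable zero holds the input and finally the output.
record Program : Set where
  constructor program
  field
    {extraVariables} : ℕ
    body             : Command (suc extraVariables)

-- Writing out the answer is charged by its size: a shared tree can be
-- exponentially larger than the number of steps that built it.
_Maps_To_InTime_ : Program → Tree → Tree → ℕ → Set
program {k} c Maps v To w InTime bound =
  ∃[ s ] ∃[ m ]
    ⟨ c , v ∷ replicate k nil ⟩⇓⟨ s , m ⟩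
    × lookup s zero ≡ w
    × m + size w ≤ bound

encodeℕ : ℕ → Tree
encodeℕ zero    = nil
encodeℕ (suc n) = nil ∙ encodeℕ n

encodeBool : Bool → Tree
encodeBool false = nil
encodeBool true  = nil ∙ nil

encodeList : {A : Set} → (A → Tree) → List A → Tree
encodeList enc []       = nil
encodeList enc (x ∷ xs) = enc x ∙ encodeList enc xs

encodeVec : {A : Set} {m : ℕ} → (A → Tree) → Vec A m → Tree
encodeVec enc v = encodeList enc (Vec.toList v)

encodeLiteral : ∀ {n} → Literal n → Tree
encodeLiteral (pos i) = encodeBool true  ∙ encodeℕ (toℕ i)
encodeLiteral (neg i) = encodeBool false ∙ encodeℕ (toℕ i)

encodeInstance : (t d n : ℕ) → Formula n → Tree
encodeInstance t d n φ =
  encodeℕ t ∙ encodeℕ d ∙ encodeℕ n ∙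
  encodeList (encodeVec encodeLiteral) (clauses φ)

encode𝒰 : ∀ {n d} → 𝒰 n d → Tree
encode𝒰 S = encodeVec encodeBool (set S)

encodeQuad : ∀ {n d} → QuadPoly n d → Tree
encodeQuad g =
  encodeList (λ (U , V) → encode𝒰 U ∙ encode𝒰 V) (quadratic g)
  ∙ encodeList encode𝒰 (linear g)

encodeSystem : ∀ {n d} → List (QuadPoly n d) → Tree
encodeSystem = encodeList encodeQuad

------------------------------------------------------------------------

-- d ≥ c · log₂ m, exponentiated.  A positive integer c loses nothing: enlarging
-- c only strengthens the inequality, and the base of the logarithm rescales c.
_≥_·log₂_ : ℕ → ℕ → ℕ → Set
d ≥ c ·log₂ m = m ^ c ≤ 2 ^ d

{-# OPTIONS --safe #-}
module Submission where

-- The system B consists of x^T + x₀x^T for nonempty T with |T| < d, and of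
-- x₀ x^S [C is falsified] for clauses C and |S| ≤ d − 4.
--
-- Distance: if β represents σ, the points of β that have x₀ = 1 and falsify a
-- given clause are orthogonal to all polynomials of degree at most d − 4, and so
-- are those with x₀ = 0 and xᵢ = 1.  A nonempty set with this property has at
-- least 2^(d−3) elements, and every point except the origin lies in one.
--
-- Superposition: let d = 4k and F = Σ τ⁽ⁱ⁾ as a functional on polynomials.  The
-- product constraints write F(uv) as an inner product in 𝔽₂^t, so polynomials with
-- F(u_a v_b) = δ_ab for 2^k indices give 2^k ≤ t, which c = 4 excludes.  Let S be
-- a monomial of least degree with F(x^S) = 1.  If |S| ≥ 2k, group 2k elements of S
-- into pairs; the 2^k ways to distribute the pairs over u and v are biorthogonal by
-- minimality of S.  If |S| < 2k, split x₀F by coordinates: whenever no coordinate has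
-- both cofactors nonzero, F is evaluation at a point in low degree, and this point
-- falsifies a clause.  Hence k levels of splitting succeed, and the indicators of
-- the 2^k leaves are biorthogonal.

open import Defs
open import Algebra.Bundles using (CommutativeMonoid; CommutativeRing)
import Algebra.Properties.CommutativeMonoid.Sum
import Algebra.Properties.CommutativeSemigroup
import Algebra.Properties.Semiring.Sum
open import Data.Bool using (Bool; true; false; not; _∧_; _∨_; _xor_; if_then_else_; T)
open import Data.Bool.Properties
  using (xor-∧-commutativeRing; xor-same; xor-comm; xor-assoc; xor-identityʳ; ∧-comm; ∧-assoc;
         ∧-idem; ∧-zeroʳ; ∧-identityʳ; ∧-distribʳ-xor; not-injective; not-involutive)
  renaming (_≟_ to _≟ᵇ_)
open import Data.Empty using (⊥-elim)
open import Data.Fin using (Fin; zero; suc; toℕ; join; splitAt; combine; finToFun; funToFin)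
open import Data.Fin.Properties
  using (any?; toℕ<n; combine-injective; splitAt-join; injective⇒≤; finToFun-funToFin;
         funToFin-finToFin; 2↔Bool)
open import Data.Fin.Subset using (Subset; ∣_∣; ⁅_⁆; _∪_; ⊥)
open import Data.Fin.Subset.Properties
  using (∪-assoc; ∪-comm; ∪-idem; ∪-identityˡ; ∪-identityʳ; anySubset?; ∣⊥∣≡0; ∣p∣≤∣p∪q∣;
         ∣q∣≤∣p∪q∣; ∣⁅x⁆∣≡1)
open import Data.List as List using (List; []; _∷_; [_]; _++_; length; map; foldl; filter)
open import Data.List.Membership.Propositional using (_∈_; find)
open import Data.List.Membership.Propositional.Properties
  using (∈-lookup; ∈-filter⁺; ∈-++⁺ˡ; ∈-++⁺ʳ; ∈-++⁻; ∈-map⁺; ∈-map⁻)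
open import Data.List.Properties using
      (++-assoc; length-replicate; length-++; length-map; length-filter; map-++)
open import Data.List.Relation.Unary.All as All using (All; []; _∷_)
open import Data.List.Relation.Unary.All.Properties using (++⁺; map⁺; ¬All⇒Any¬)
open import Data.List.Relation.Unary.AllPairs using ([]; _∷_)
open import Data.List.Relation.Unary.Any using (here; there)
open import Data.List.Relation.Unary.Unique.Propositional using (Unique)
open import Data.List.Relation.Unary.Unique.Propositional.Properties using (filter⁺)
open import Data.Nat
  using (ℕ; zero; suc; _+_; _*_; _∸_; _^_; _⊔_; _≤_; _<_; z≤n; s≤s; s≤s⁻¹; _≤ᵇ_; _≤?_; NonZero; >-nonZero)
open import Data.Nat.Divisibility using (_∣_; divides)
open import Data.Nat.Induction using (<-rec)
import Data.Nat.ListAction as ListAction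
open import Data.Nat.ListAction.Properties using (sum-++)
open import Data.Nat.Properties hiding (_≟_)
open import Data.Nat.Solver using (module +-*-Solver)
open import Data.Product using (Σ; Σ-syntax; ∃-syntax; _×_; _,_; proj₁; proj₂)
open import Data.Sum using (_⊎_; inj₁; inj₂)
open import Data.Unit using (⊤; tt)
open import Data.Vec as Vec using (Vec; []; _∷_; lookup; tabulate; toList; foldr′; zipWith)
open import Data.Vec.Properties using (length-toList; lookup∘tabulate)
import Data.Vec.Relation.Unary.Any as VecAny
open import Function using (_∘_; Inverse; mk⇔)
open import Relation.Binary.PropositionalEquality
  using (_≡_; _≢_; _≗_; refl; sym; trans; cong; cong₂; subst; module ≡-Reasoning)
open import Relation.Nullary using (¬_; Dec; yes; no; contradiction; recompute)
open import Relation.Nullary.Decidable using (_×-dec_)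
open +-*-Solver using (solve; con; _:+_; _:*_) renaming (_:=_ to _⊜_)

-- The empty set is not a variable and no equation has a constant term, so the system says nothing
-- about F(1). The variable x₀ stands in for 1: the homogeneity equations allow multiplication by x₀
-- below degree d, and x₀F does have a meaningful value at the empty monomial, namely F(x₀).
--
-- The degree budget explains d = 4k. The inner-product formula for F(uv) is available only up to
-- degree 4k. In the low-degree case u and v each carry x₀ and the k factors of a leaf indicator,
-- and v carries in addition a monomial of degree at most k; the total 3k + 2 is at most 4k because
-- k ≥ 2. The threshold 2k serves both cases. Each split lowers the degree of the nonzero monomial
-- by one, so a start at 2k leaves degree k after k splits; and 2k elements are exactly what k
-- disjoint pairs need.

private
  module 𝔽₂-ring = CommutativeRing xor-∧-commutativeRing
  module 𝔽₂-sum = Algebra.Properties.CommutativeMonoid.Sum 𝔽₂-ring.+-commutativeMonoid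
  module 𝔽₂-product = Algebra.Properties.Semiring.Sum 𝔽₂-ring.semiring
  module 𝔽₂-xor = Algebra.Properties.CommutativeSemigroup
    (CommutativeMonoid.commutativeSemigroup 𝔽₂-ring.+-commutativeMonoid)
  module 𝔽₂-and = Algebra.Properties.CommutativeSemigroup
    (CommutativeMonoid.commutativeSemigroup 𝔽₂-ring.*-commutativeMonoid)

-- Evaluating structured programs in WHILE

-- Programs use two variables: the first holds an environment, a list of values
-- addressed by position, the second a stack onto which results are pushed.

environment stack : Expr 2
environment = var zero
stack       = var (suc zero)

weaken : Expr 1 → Expr 2
weaken (var zero) = environment
weaken nil        = nil
weaken (cons e f) = cons (weaken e) (weaken f)
weaken (hd e)     = hd (weaken e)
weaken (tl e)     = tl (weaken e)

value : Expr 1 → Tree → Tree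
value e ρ = ⟦ e ⟧ (ρ ∷ [])

weaken-value : ∀ e ρ s → ⟦ weaken e ⟧ (ρ ∷ s ∷ []) ≡ value e ρ
weaken-value (var zero) ρ s = refl
weaken-value nil        ρ s = refl
weaken-value (cons e f) ρ s = cong₂ _∙_ (weaken-value e ρ s) (weaken-value f ρ s)
weaken-value (hd e)     ρ s = cong head (weaken-value e ρ s)
weaken-value (tl e)     ρ s = cong tail (weaken-value e ρ s)

weaken-cost : ∀ e → cost (weaken e) ≡ cost e
weaken-cost (var zero) = refl
weaken-cost nil        = refl
weaken-cost (cons e f) = cong suc (cong₂ _+_ (weaken-cost e) (weaken-cost f))
weaken-cost (hd e)     = cong suc (weaken-cost e)
weaken-cost (tl e)     = cong suc (weaken-cost e)

return : Expr 1 → Command 2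
return e = suc zero := cons (weaken e) stack

letin : Command 2 → Command 2 → Command 2
letin c c′ =
  c ⨾ zero := cons (hd stack) environment ⨾ suc zero := tl stack ⨾ c′ ⨾ zero := tl environment

branch : Expr 1 → Command 2 → Command 2 → Command 2
branch e c c′ = ifnil weaken e then c else c′

-- During the loop the stack holds the accumulator, then the unread list, then the caller's stack.
-- The body runs with element and accumulator moved to the environment and the shortened list on top
-- of the stack, so the value that it pushes lands where the accumulator was.
foldLoop : Command 2 → Command 2
foldLoop c =
  while hd (tl stack) loop
    ( zero := cons (hd (hd (tl stack))) (cons (hd stack) environment)
    ⨾ suc zero := cons (tl (hd (tl stack))) (tl (tl stack))
    ⨾ c
    ⨾ zero := tl (tl environment))

-- The body sees the current element at position 0 and the accumulator at
-- position 1.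
fold : Expr 1 → Expr 1 → Command 2 → Command 2
fold l a c =
  suc zero := cons (weaken a) (cons (weaken l) stack) ⨾ foldLoop c ⨾
  suc zero := cons (hd stack) (tl (tl stack))

-- Costs are recorded only as exponents of X. The overhead of a construct is a constant factor of at
-- most 256, which one more factor X absorbs; a loop over a list of length at most X^j adds j as
-- well. Bounding a running time thus amounts to counting nested constructs.
module Run (X : ℕ) (256≤X : 256 ≤ X) where

  1≤X : 1 ≤ X
  1≤X = ≤-trans (s≤s z≤n) 256≤X

  power-mono : ∀ {j k} → j ≤ k → X ^ j ≤ X ^ k
  power-mono = ^-monoʳ-≤ X {{>-nonZero 1≤X}}

  power-absorb : ∀ {a k} → a ≤ 256 → a * X ^ k ≤ X ^ suc k
  power-absorb {k = k} a≤ = *-monoˡ-≤ (X ^ k) (≤-trans a≤ 256≤X)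

  constant≤power : ∀ {a k} → a ≤ 256 → 1 ≤ k → a ≤ X ^ k
  constant≤power {k = suc k} a≤ _ =
    ≤-trans (≤-trans a≤ 256≤X)
      (≤-trans (≤-reflexive (sym (*-identityʳ X))) (power-mono {1} {suc k} (s≤s z≤n)))

  1≤power : ∀ k → 1 ≤ X ^ k
  1≤power k = power-mono {0} {k} z≤n

  -- The environment is restored and exactly one value is pushed, with v and k fixed before the
  -- stack s is chosen. This uniformity lets commands nest above partial results of other commands.
  record _⊢_⇓_within_ (ρ : Tree) (c : Command 2) (v : Tree) (k : ℕ) : Set where
    constructor runs
    field
      run : ∀ s → ∃[ m ] ⟨ c , ρ ∷ s ∷ [] ⟩⇓⟨ ρ ∷ (v ∙ s) ∷ [] , m ⟩ × m ≤ X ^ k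

  open _⊢_⇓_within_ public

  relax : ∀ {ρ c v j k} → j ≤ k → ρ ⊢ c ⇓ v within j → ρ ⊢ c ⇓ v within k
  relax j≤k r = runs λ s → let m , d , m≤ = run r s in m , d , ≤-trans m≤ (power-mono j≤k)

  -- For a concrete expression the condition `small` computes to the unit type, so its proof is
  -- inferred at every use.
  run-return : ∀ {ρ} e {small : T (cost e + 3 ≤ᵇ 256)} → ρ ⊢ return e ⇓ value e ρ within 1
  run-return {ρ} e {small} = runs λ s →
    _ , subst (λ v → ⟨ return e , _ ⟩⇓⟨ ρ ∷ (v ∙ s) ∷ [] , _ ⟩) (weaken-value e ρ s) assign ,
    constant≤power {k = 1}
      (≤-trans (≤-reflexive bound) (≤ᵇ⇒≤ _ _ small)) (s≤s z≤n)
    where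
    bound : suc (suc (cost (weaken e) + 1)) ≡ cost e + 3
    bound = trans (cong (λ a → 2 + (a + 1)) (weaken-cost e))
          (solve 1 (λ a → con 2 :+ (a :+ con 1) ⊜ a :+ con 3) refl (cost e))

  run-let : ∀ {ρ c c′ u v j k} → ρ ⊢ c ⇓ u within j → (u ∙ ρ) ⊢ c′ ⇓ v within k →
            ρ ⊢ letin c c′ ⇓ v within suc (j ⊔ k)
  run-let {j = j} {k} r r′ = runs λ s →
    let m , d , m≤ = run r s ; m′ , d′ , m′≤ = run r′ _ in
    _ , seq d (seq assign (seq assign (seq d′ assign))) , bound m≤ m′≤
    where
    bound : ∀ {m m′} → m ≤ X ^ j → m′ ≤ X ^ k → m + (5 + (3 + (m′ + 3))) ≤ X ^ suc (j ⊔ k)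
    bound {m} {m′} m≤ m′≤ = begin
      m + (5 + (3 + (m′ + 3))) ≡⟨ solve 2
            (λ a b → a :+ (con 5 :+ (con 3 :+ (b :+ con 3))) ⊜ a :+ b :+ con 11 :* con 1) refl m m′ ⟩
      m + m′ + 11 * 1
        ≤⟨ +-mono-≤ (+-mono-≤ (≤-trans m≤ (power-mono (m≤m⊔n j k))) (≤-trans m′≤ (power-mono (m≤n⊔m j k))))
                    (*-monoʳ-≤ 11 (1≤power (j ⊔ k))) ⟩
      X ^ (j ⊔ k) + X ^ (j ⊔ k) + 11 * X ^ (j ⊔ k) ≡⟨ solve 1 (λ a → a :+ a :+ con 11 :* a ⊜ con 13 :* a) refl
            (X ^ (j ⊔ k)) ⟩
      13 * X ^ (j ⊔ k) ≤⟨ power-absorb {k = j ⊔ k} (≤ᵇ⇒≤ 13 256 _) ⟩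
      X ^ suc (j ⊔ k) ∎
      where open ≤-Reasoning

  branch-bound : ∀ e {m k} → T (cost e + 1 ≤ᵇ 255) → m ≤ X ^ k →
                 suc (cost (weaken e) + m) ≤ X ^ suc k
  branch-bound e {m} {k} small m≤ = begin
    suc (cost (weaken e) + m) ≡⟨ cong (λ a → suc (a + m)) (weaken-cost e) ⟩
    suc (cost e + m)          ≡⟨ solve 2 (λ a b → con 1 :+ (a :+ b) ⊜ (a :+ con 1) :* con 1 :+ b) refl
          (cost e) m ⟩
    (cost e + 1) * 1 + m      ≤⟨ +-mono-≤ (*-mono-≤ {cost e + 1} {255} {1} {X ^ k} (≤ᵇ⇒≤ _ _ small)
          (1≤power k)) m≤ ⟩
    255 * X ^ k + X ^ k       ≡⟨ solve 1 (λ a → con 255 :* a :+ a ⊜ con 256 :* a) refl (X ^ k) ⟩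
    256 * X ^ k               ≤⟨ power-absorb {k = k} ≤-refl ⟩
    X ^ suc k ∎
    where open ≤-Reasoning

  run-branch-nil : ∀ {ρ} e {c c′ v k} {small : T (cost e + 1 ≤ᵇ 255)} → value e ρ ≡ nil →
                   ρ ⊢ c ⇓ v within k → ρ ⊢ branch e c c′ ⇓ v within suc k
  run-branch-nil {ρ} e {k = k} {small = small} eq r = runs λ s → let m , d , m≤ = run r s in
    _ , if-nil (trans (weaken-value e ρ s) eq) d , branch-bound e {k = k} small m≤

  run-branch-cons : ∀ {ρ} e {c c′ v k a b} {small : T (cost e + 1 ≤ᵇ 255)} → value e ρ ≡ a ∙ b →
                    ρ ⊢ c′ ⇓ v within k → ρ ⊢ branch e c c′ ⇓ v within suc k
  run-branch-cons {ρ} e {k = k} {small = small} eq r = runs λ s → let m , d , m≤ = run r s in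
    _ , if-cons (trans (weaken-value e ρ s) eq) d , branch-bound e {k = k} small m≤

  module _ {A : Set} (enc : A → Tree) (I : List A → Tree → Set) {ρ c k}
    (step : ∀ {x xs a} → I (x ∷ xs) a →
            ∃[ a′ ] (enc x ∙ a ∙ ρ) ⊢ c ⇓ a′ within k × I xs a′) where

    run-foldLoop : ∀ xs a → I xs a → ∃[ a′ ] I [] a′ × (∀ s → ∃[ m ]
      ⟨ foldLoop c , ρ ∷ (a ∙ encodeList enc xs ∙ s) ∷ [] ⟩⇓⟨ ρ ∷ (a′ ∙ nil ∙ s) ∷ [] , m ⟩
      × m ≤ 4 + length xs * (29 + X ^ k))
    run-foldLoop [] a i = a , i , λ s → _ , while-nil refl , ≤-refl
    run-foldLoop (x ∷ xs) a i =
      let a′ , r , i′  = step i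
          a″ , i″ , r′ = run-foldLoop xs a′ i′
      in a″ , i″ , λ s →
        let m  , d  , m≤  = run r (encodeList enc xs ∙ s)
            m′ , d′ , m′≤ = r′ s
        in _ , while-cons refl (seq assign (seq assign (seq d assign))) d′ , bound m≤ m′≤
        where
        open ≤-Reasoning
        bound : ∀ {m m′} → m ≤ X ^ k → m′ ≤ 4 + length xs * (29 + X ^ k) →
              suc (3 + (10 + (9 + (m + 4)) + m′)) ≤ 4 + (29 + X ^ k + length xs * (29 + X ^ k))
        bound {m} {m′} m≤ m′≤ = begin
          suc (3 + (10 + (9 + (m + 4)) + m′))
            ≡⟨ solve 2 (λ a b → con 4 :+
                  (con 10 :+ (con 9 :+ (a :+ con 4)) :+ b) ⊜ con 27 :+ a :+ b) refl m m′ ⟩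
          27 + m + m′ ≤⟨ +-mono-≤ (+-mono-≤ (≤ᵇ⇒≤ 27 29 _) m≤) m′≤ ⟩
          29 + X ^ k + (4 + length xs * (29 + X ^ k))
            ≡⟨ solve 2 (λ a b → a :+ (con 4 :+ b) ⊜ con 4 :+ (a :+ b)) refl (29 + X ^ k)
                  (length xs * (29 + X ^ k)) ⟩
          4 + (29 + X ^ k + length xs * (29 + X ^ k)) ∎

    run-fold-invariant : ∀ {l a j} {small : T (cost a + cost l + 17 ≤ᵇ 200)} xs →
      value l ρ ≡ encodeList enc xs → I xs (value a ρ) → length xs ≤ X ^ j →
      ∃[ a′ ] ρ ⊢ fold l a c ⇓ a′ within suc (j + k) × I [] a′
    run-fold-invariant {l} {a} {j} {small} xs eq i len≤ =
      let a′ , i′ , r = run-foldLoop xs (value a ρ) i in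
      a′ , runs (λ s →
        let m , d , m≤ = r s in
        _ , seq assign (seq (subst (λ u → ⟨ foldLoop c , ρ ∷ u ∷ [] ⟩⇓⟨ ρ ∷ (a′ ∙ nil ∙ s) ∷ [] , m ⟩)
                                   (sym (cong₂ (λ u v → u ∙ v ∙ s) (weaken-value a ρ s)
                                         (trans (weaken-value l ρ s) eq))) d)
                            assign) , bound m≤) , i′
        where
        open ≤-Reasoning
        bound : ∀ {m} → m ≤ 4 + length xs * (29 + X ^ k) →
              suc (suc (cost (weaken a) + suc (cost (weaken l) + 1))) + (m + 7) ≤ X ^ suc (j + k)
        bound {m} m≤ = begin
          suc (suc (cost (weaken a) + suc (cost (weaken l) + 1))) + (m + 7)
            ≡⟨ cong₂ (λ u v → suc (suc (u + suc (v + 1))) + (m + 7)) (weaken-cost a) (weaken-cost l) ⟩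
          suc (suc (cost a + suc (cost l + 1))) + (m + 7)
            ≡⟨ solve 3 (λ a b m → con 2 :+ (a :+ (con 1 :+ (b :+ con 1))) :+
                  (m :+ con 7) ⊜ a :+ b :+ con 11 :+ m) refl (cost a) (cost l) m ⟩
          cost a + cost l + 11 + m
            ≤⟨ +-mono-≤ (≤-trans (+-monoʳ-≤ (cost a + cost l) (≤ᵇ⇒≤ 11 17 _)) (≤ᵇ⇒≤ _ _ small)) m≤ ⟩
          200 + (4 + length xs * (29 + X ^ k))
            ≡⟨ solve 1 (λ u → con 200 :+ (con 4 :+ u) ⊜ con 204 :* con 1 :+ u) refl (length xs * (29 + X ^ k)) ⟩
          204 * 1 + length xs * (29 + X ^ k)
            ≤⟨ +-mono-≤ (*-monoʳ-≤ 204 (1≤power (j + k)))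
                 (*-mono-≤ len≤ (≤-trans (+-monoˡ-≤ (X ^ k) (*-monoʳ-≤ 29 (1≤power k)))
                                         (≤-reflexive (+-comm (29 * X ^ k) (X ^ k))))) ⟩
          204 * X ^ (j + k) + X ^ j * (30 * X ^ k)
            ≡⟨ cong (204 * X ^ (j + k) +_)
                  (trans (solve 2 (λ u v → u :* (con 30 :* v) ⊜ con 30 :* (u :* v)) refl (X ^ j) (X ^ k))
                                                  (cong (30 *_) (sym (^-distribˡ-+-* X j k)))) ⟩
          204 * X ^ (j + k) + 30 * X ^ (j + k)
            ≡⟨ solve 1 (λ u → con 204 :* u :+ con 30 :* u ⊜ con 234 :* u) refl (X ^ (j + k)) ⟩
          234 * X ^ (j + k) ≤⟨ power-absorb {k = j + k} (≤ᵇ⇒≤ 234 256 _) ⟩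
          X ^ suc (j + k) ∎

-- The system and the program that computes it

-- A left fold that prepends has the shape of the program's `fold`. The lists specified here
-- therefore agree with the computed trees exactly, order included, and no reversal has to be
-- accounted for.
gather : {A B : Set} → (A → List B) → List A → List B → List B
gather f xs ys = foldl (λ zs x → f x ++ zs) ys xs

gather-++ : {A B : Set} (f : A → List B) (xs : List A) (ys zs : List B) →
            gather f xs (ys ++ zs) ≡ gather f xs ys ++ zs
gather-++ f []       ys zs = refl
gather-++ f (x ∷ xs) ys zs =
  trans (cong (gather f xs) (sym (++-assoc (f x) ys zs))) (gather-++ f xs (f x ++ ys) zs)

-- An item (b , S , T) satisfies ∣ S ∪ T ∣ + b ≡ d.
Item : ℕ → Set
Item m = ℕ × Subset m × Subset m

-- The remaining budget b prunes the enumeration: putting the new coordinate into S, T or both costs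
-- one unit. Listing all pairs of subsets and testing their sizes afterwards would take exponential
-- time. Because b is kept in unary, later degree conditions are tests on its leading constructors.
grow : ∀ {m} → Item m → List (Item (suc m))
grow (zero  , S , T) = [ zero , false ∷ S , false ∷ T ]
grow (suc b , S , T) =
  (suc b , false ∷ S , false ∷ T) ∷ (b , true ∷ S , false ∷ T) ∷
  (b , false ∷ S , true ∷ T) ∷ (b , true ∷ S , true ∷ T) ∷ []

items : ℕ → ∀ m → List (Item m)
items d zero    = [ d , [] , [] ]
items d (suc m) = gather grow (items d m) []

occupied : ∀ {m} → Subset m → Bool
occupied S = foldl (λ a x → x ∨ a) false (toList S)

Equation : ℕ → Set
Equation m = List (Subset m × Subset m) × List (Subset m)

linearEquation : ∀ {m} → List (Subset m) → Equation m
linearEquation ms = [] , ms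

multiplyTerm : ∀ {n} → Literal n → Subset (suc n) → List (Subset (suc n))
multiplyTerm (pos i) S = S ∷ (⁅ suc i ⁆ ∪ S) ∷ []
multiplyTerm (neg i) S = (⁅ suc i ⁆ ∪ S) ∷ []

-- Multiplies a polynomial by the indicator that the literal is false.
multiply : ∀ {n} → List (Subset (suc n)) → Literal n → List (Subset (suc n))
multiply ms l = gather (multiplyTerm l) ms []

-- The monomials of x₀ x^S times the indicator that all literals are false.
clausePoly : ∀ {n} → Clause n → Subset (suc n) → List (Subset (suc n))
clausePoly C S = foldl multiply [ ⁅ zero ⁆ ∪ S ] (toList C)

module _ {n : ℕ} (clauses : List (Clause n)) where

  -- A budget of at least 4 forces |S| ≤ d - 4, which leaves room for x₀ and three literals. The
  -- same S recurs with different T; the repetitions are harmless because systems are compared as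
  -- sets of equations.
  clausePolys : Item (suc n) → List (List (Subset (suc n)))
  clausePolys (suc (suc (suc (suc b))) , S , T) = gather (λ C → [ clausePoly C S ]) clauses []
  clausePolys _                                 = []

  homogeneityPolys : Item (suc n) → List (List (Subset (suc n)))
  homogeneityPolys (suc b , S , T) = if occupied S then [ S ∷ (⁅ zero ⁆ ∪ S) ∷ [] ] else []
  homogeneityPolys (zero  , S , T) = []

  productEquations : Item (suc n) → List (Equation (suc n))
  productEquations (b , S , T) = if occupied S then if occupied T then [ [ S , T ] , [ S ∪ T ] ] else [] else []

  itemPolys : Item (suc n) → List (List (Subset (suc n)))
  itemPolys it = homogeneityPolys it ++ clausePolys it

  itemEquations : Item (suc n) → List (Equation (suc n))
  itemEquations it = productEquations it ++ map linearEquation (itemPolys it)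

  equations : ℕ → List (Equation (suc n))
  equations d = gather itemEquations (items d (suc n)) []

encodeSubset : ∀ {m} → Subset m → Tree
encodeSubset = encodeVec encodeBool

-- The union travels with the pair: `growItem` extends it bit by bit, so that `productCode` can
-- output the product constraint without computing a union.
encodeItem : ∀ {m} → Item m → Tree
encodeItem (b , S , T) = encodeℕ b ∙ encodeSubset S ∙ encodeSubset T ∙ encodeSubset (S ∪ T)

encodePoly : ∀ {m} → List (Subset m) → Tree
encodePoly = encodeList encodeSubset

encodeEquation : ∀ {m} → Equation m → Tree
encodeEquation (qs , ms) =
  encodeList (λ (S , T) → encodeSubset S ∙ encodeSubset T) qs ∙ encodePoly ms

encodeℕ-list : ∀ n → encodeℕ n ≡ encodeList (λ _ → nil) (List.replicate n tt)
encodeℕ-list zero    = refl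
encodeℕ-list (suc n) = cong (nil ∙_) (encodeℕ-list n)

drop at : ℕ → Expr 1
drop zero    = var zero
drop (suc i) = tl (drop i)
at i = hd (drop i)

one : Expr 1
one = cons nil nil

growItem growAll enumerate : Command 2
growItem =
  branch (hd (at 0))
    (return (cons (item (hd (at 0)) nil nil nil) (at 1)))
    (return (cons (item (hd (at 0)) nil nil nil)
            (cons (item (tl (hd (at 0))) one nil one)
            (cons (item (tl (hd (at 0))) nil one one)
            (cons (item (tl (hd (at 0))) one one one) (at 1))))))
  where
  item : Expr 1 → Expr 1 → Expr 1 → Expr 1 → Expr 1
  item b s t u =
    cons b (cons (cons s (hd (tl (at 0))))
           (cons (cons t (hd (tl (tl (at 0))))) (cons u (tl (tl (tl (at 0)))))))
growAll = fold (at 1) nil growItem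
enumerate = fold (cons nil (at 2)) (cons (cons (at 1) (cons nil (cons nil nil))) nil) growAll

oneHotCode orCode unionCode multiplyTermCode multiplyCode : Command 2
oneHotCode = fold (tl (at 0)) (cons nil (cons one nil)) (return (cons nil (at 1)))
orCode =
  branch (hd (hd (at 1)))
    (return (cons (tl (hd (at 1))) (cons (at 0) (tl (at 1)))))
    (return (cons (tl (hd (at 1))) (cons one (tl (at 1)))))
unionCode =
  letin (fold (at 0) (cons (at 2) nil) orCode)
        (fold (tl (at 0)) nil (return (cons (at 0) (at 1))))
multiplyTermCode =
  letin unionCode
    (branch (hd (at 4))
      (return (cons (at 0) (at 2)))
      (return (cons (at 1) (cons (at 0) (at 2)))))
multiplyCode = letin oneHotCode (fold (at 2) nil multiplyTermCode)

occupiedCode : Expr 1 → Command 2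
occupiedCode e = fold e nil (branch (at 0) (return (at 1)) (return one))

clauseCode clausesCode homogeneityCode productCode itemCode systemCode mainCode : Command 2
clauseCode =
  letin (fold (at 0) (cons (cons one (tl (hd (tl (at 2))))) nil) multiplyCode)
        (return (cons (cons nil (at 0)) (at 2)))
clausesCode =
  branch (tl (tl (tl (hd (at 0)))))
    (return (at 1))
    (fold (drop 6) (at 1) clauseCode)
homogeneityCode =
  branch (at 0)
    (return (at 1))
    (branch (hd (at 2))
      (return (at 1))
      (return (cons (cons nil (cons (hd (tl (at 2))) (cons (cons one (tl (hd (tl (at 2))))) nil))) (at 1))))
productCode =
  branch (at 1)
    (return (at 0))
    (letin (occupiedCode (hd (tl (tl (at 3)))))
      (branch (at 0)
        (return (at 1))
        (return (cons (cons (cons (cons (hd (tl (at 4))) (hd (tl (tl (at 4))))) nil)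
                            (cons (tl (tl (tl (at 4)))) nil)) (at 1)))))
itemCode =
  letin clausesCode (letin (occupiedCode (hd (tl (at 1)))) (letin homogeneityCode productCode))
systemCode = letin enumerate (fold (at 0) nil itemCode)
mainCode = systemCode ⨾ zero := hd stack

-- Variable i of the formula is coordinate i + 1 of a point, since x₀ occupies coordinate 0; hence
-- the initial leading zero. The list ends at its single 1, and `orList` reads missing entries as 0.
oneHot : ℕ → List Bool
oneHot i = foldl (λ w _ → false ∷ w) (false ∷ true ∷ []) (List.replicate i tt)

-- The accumulator pairs the unread part of the first vector with the output so far. That output
-- comes out reversed, which the second fold of `unionCode` undoes.
orStep : List Bool × List Bool → Bool → List Bool × List Bool
orStep ([]     , r) x = [] , x ∷ r
orStep (w ∷ ws , r) x = ws , (w ∨ x) ∷ r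

oneHot-suc : ∀ i → oneHot (suc i) ≡ false ∷ oneHot i
oneHot-suc i = shift (List.replicate i tt) (false ∷ true ∷ [])
  where
  shift : ∀ us (w : List Bool) → foldl (λ w _ → false ∷ w) (false ∷ w) us ≡ false ∷ foldl
        (λ w _ → false ∷ w) w us
  shift []       w = refl
  shift (_ ∷ us) w = shift us (false ∷ w)

rev : List Bool → List Bool → List Bool
rev = foldl (λ a x → x ∷ a)

orList : List Bool → List Bool → List Bool
orList ws       []       = []
orList []       (x ∷ xs) = x ∷ orList [] xs
orList (w ∷ ws) (x ∷ xs) = (w ∨ x) ∷ orList ws xs

rev-foldl-orStep : ∀ xs ws r → rev [] (proj₂ (foldl orStep (ws , r) xs)) ≡ rev (orList ws xs) r
rev-foldl-orStep []       ws       r = refl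
rev-foldl-orStep (x ∷ xs) []       r = rev-foldl-orStep xs [] (x ∷ r)
rev-foldl-orStep (x ∷ xs) (w ∷ ws) r = rev-foldl-orStep xs ws ((w ∨ x) ∷ r)

orList-[] : ∀ xs → orList [] xs ≡ xs
orList-[] []       = refl
orList-[] (x ∷ xs) = cong (x ∷_) (orList-[] xs)

orList-oneHot : ∀ {n} (i : Fin n) (S : Subset (suc n)) →
                orList (oneHot (toℕ i)) (toList S) ≡ toList (⁅ suc i ⁆ ∪ S)
orList-oneHot {suc n} zero (x ∷ y ∷ S) =
  cong (λ ys → x ∷ true ∷ ys) (trans (orList-[] (toList S)) (cong toList (sym (∪-identityˡ S))))
orList-oneHot {suc n} (suc i) (x ∷ S) rewrite oneHot-suc (toℕ i) =
  cong (x ∷_) (orList-oneHot i S)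

length-foldl-orStep : ∀ xs ws r → length (proj₂ (foldl orStep (ws , r) xs)) ≡ length xs + length r
length-foldl-orStep []       ws       r = refl
length-foldl-orStep (x ∷ xs) []       r = trans (length-foldl-orStep xs [] (x ∷ r))
      (+-suc (length xs) (length r))
length-foldl-orStep (x ∷ xs) (w ∷ ws) r = trans (length-foldl-orStep xs ws ((w ∨ x) ∷ r))
      (+-suc (length xs) (length r))

index : ∀ {n} → Literal n → Fin n
index (pos i) = i
index (neg i) = i

length-gather : {A B : Set} (f : A → List B) {k : ℕ} → (∀ x → length (f x) ≤ k) →
                ∀ xs ys → length (gather f xs ys) ≤ length xs * k + length ys
length-gather f         f≤ []       ys = ≤-refl
length-gather f {k = k} f≤ (x ∷ xs) ys = begin
  length (gather f xs (f x ++ ys))              ≤⟨ length-gather f f≤ xs (f x ++ ys) ⟩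
  length xs * k + length (f x ++ ys)            ≡⟨ cong (length xs * k +_) (length-++ (f x)) ⟩
  length xs * k + (length (f x) + length ys)    ≤⟨ +-monoʳ-≤ (length xs * k) (+-monoˡ-≤ (length ys) (f≤ x)) ⟩
  length xs * k + (k + length ys)               ≡⟨ sym (+-assoc (length xs * k) k (length ys)) ⟩
  length xs * k + k + length ys                 ≡⟨ cong (_+ length ys) (+-comm (length xs * k) k) ⟩
  k + length xs * k + length ys                 ∎
  where open ≤-Reasoning

length-multiply : ∀ {n} ms (l : Literal n) → length (multiply ms l) ≤ length ms * 2
length-multiply ms l =
  ≤-trans (length-gather (multiplyTerm l) (terms≤2 l) ms []) (≤-reflexive (+-identityʳ _))
  where
  terms≤2 : ∀ {n} (l : Literal n) S → length (multiplyTerm l S) ≤ 2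
  terms≤2 (pos i) S = ≤-refl
  terms≤2 (neg i) S = s≤s z≤n

m≤m*2^ : ∀ m k → m ≤ m * 2 ^ k
m≤m*2^ m k = m≤m*n m (2 ^ k) {{m^n≢0 2 k}}

-- Correctness and running time of the program

module Correctness (X : ℕ) (256≤X : 256 ≤ X) where
  open Run X 256≤X

  module _ {A B : Set} (encA : A → Tree) (encB : B → Tree) (go : B → A → B) where

    -- The cost of the body may depend on the size of the accumulator. The invariant J, relating it
    -- to the unread input, supplies the size bound under which the body meets its time bound.
    run-foldl : (J : List A → B → Set) → ∀ {ρ l a c j k} {small : T (cost a + cost l + 17 ≤ᵇ 200)} →
      (∀ {x xs b} → J (x ∷ xs) b → J xs (go b x)) →
      (∀ {x xs b} → J (x ∷ xs) b → (encA x ∙ encB b ∙ ρ) ⊢ c ⇓ encB (go b x) within k) →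
      ∀ xs b → value l ρ ≡ encodeList encA xs → value a ρ ≡ encB b → J xs b → length xs ≤ X ^ j →
      ρ ⊢ fold l a c ⇓ encB (foldl go b xs) within suc (j + k)
    run-foldl J {ρ} {l} {a} {c} {j} {k} {small} J-step body xs b eql eqa J₀ len
      = result (run-fold-invariant encA I {ρ} {c} {k} step {l} {a} {j} {small} xs eql (b , eqa , J₀ , refl) len)
      where
      I : List A → Tree → Set
      I ys v = ∃[ b′ ] v ≡ encB b′ × J ys b′ × foldl go b′ ys ≡ foldl go b xs
      step : ∀ {x ys v} → I (x ∷ ys) v → ∃[ v′ ] (encA x ∙ v ∙ ρ) ⊢ c ⇓ v′ within k × I ys v′
      step {x} (b′ , refl , J′ , b′≡) = encB (go b′ x) , body J′ , go b′ x , refl , J-step J′ , b′≡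
      result : ∃[ v ] ρ ⊢ fold l a c ⇓ v within suc (j + k) × I [] v → ρ ⊢ fold l a c ⇓ encB
            (foldl go b xs) within suc (j + k)
      result (_ , r , b′ , refl , _ , refl) = r

    run-foldl-simple : ∀ {ρ l a c j k} {small : T (cost a + cost l + 17 ≤ᵇ 200)} →
      (∀ x b → (encA x ∙ encB b ∙ ρ) ⊢ c ⇓ encB (go b x) within k) →
      ∀ xs b → value l ρ ≡ encodeList encA xs → value a ρ ≡ encB b → length xs ≤ X ^ j →
      ρ ⊢ fold l a c ⇓ encB (foldl go b xs) within suc (j + k)
    run-foldl-simple {ρ} {l} {a} {c} {j} {k} {small} body xs b eql eqa len =
      run-foldl (λ _ _ → ⊤) {ρ} {l} {a} {c} {j} {k} {small} _ (λ {x} {xs} {b} _ → body x b) xs b eql eqa tt len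

  run-cast : ∀ {ρ c u v k} → u ≡ v → ρ ⊢ c ⇓ u within k → ρ ⊢ c ⇓ v within k
  run-cast refl r = r

  module _ {n : ℕ} (n<X : suc n ≤ X) where

    private
      length-bits : ∀ {m} (S : Subset m) → m ≤ suc n → length (toList S) ≤ X ^ 1
      length-bits S m≤ rewrite length-toList S = ≤-trans m≤ (≤-trans n<X (≤-reflexive (sym (*-identityʳ X))))

    run-occupied : ∀ {ρ e} {small : T (cost (nil {1}) + cost e + 17 ≤ᵇ 200)} (S : Subset (suc n)) →
          value e ρ ≡ encodeSubset S →
                   ρ ⊢ occupiedCode e ⇓ encodeBool (occupied S) within 4
    run-occupied {ρ} {small = small} S eq =
      run-foldl-simple encodeBool encodeBool (λ a x → x ∨ a) {ρ} {j = 1} {k = 2} {small = small}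
        (λ { true  a → run-branch-cons (at 0) {k = 1} refl (run-return one)
           ; false a → run-branch-nil (at 0) {k = 1} refl (run-return (at 1)) })
        (toList S) false eq refl (length-bits S ≤-refl)

    run-oneHot : ∀ {ρ s} (i : Fin n) → ((s ∙ encodeℕ (toℕ i)) ∙ ρ) ⊢ oneHotCode ⇓ encodeList encodeBool
          (oneHot (toℕ i)) within 3
    run-oneHot i =
      run-foldl-simple (λ _ → nil) (encodeList encodeBool) (λ w _ → false ∷ w) {j = 1} {k = 1}
        (λ _ _ → run-return (cons nil (at 1)))
        (List.replicate (toℕ i) tt) (false ∷ true ∷ []) (encodeℕ-list (toℕ i)) refl
        (≤-trans (≤-reflexive (length-replicate (toℕ i)))
          (≤-trans (<⇒≤ (toℕ<n i)) (≤-trans (n≤1+n n) (≤-trans n<X (≤-reflexive (sym (*-identityʳ X)))))))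

    encodePair : List Bool × List Bool → Tree
    encodePair (w , r) = encodeList encodeBool w ∙ encodeList encodeBool r

    run-or : ∀ x p {ρ} → (encodeBool x ∙ encodePair p ∙ ρ) ⊢ orCode ⇓ encodePair (orStep p x) within 2
    run-or x ([] , r)         = run-branch-nil (hd (hd (at 1))) {k = 1} refl
          (run-return (cons (tl (hd (at 1))) (cons (at 0) (tl (at 1)))))
    run-or x (false ∷ ws , r) = run-branch-nil (hd (hd (at 1))) {k = 1} refl
          (run-return (cons (tl (hd (at 1))) (cons (at 0) (tl (at 1)))))
    run-or x (true ∷ ws , r)  = run-branch-cons (hd (hd (at 1))) {k = 1} refl
          (run-return (cons (tl (hd (at 1))) (cons one (tl (at 1)))))

    run-union : ∀ (i : Fin n) (S : Subset (suc n)) {a ρ} →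
      (encodeSubset S ∙ a ∙ encodeList encodeBool (oneHot (toℕ i)) ∙ ρ) ⊢ unionCode ⇓ encodeSubset
            (⁅ suc i ⁆ ∪ S) within 5
    run-union i S =
      run-let {j = 4} {k = 3}
        (run-foldl-simple encodeBool encodePair orStep {j = 1} {k = 2} (λ x p → run-or x p)
          (toList S) (oneHot (toℕ i) , []) refl refl (length-bits S ≤-refl))
        (run-cast (cong (encodeList encodeBool)
                    (trans (rev-foldl-orStep (toList S) (oneHot (toℕ i)) []) (orList-oneHot i S)))
          (run-foldl-simple encodeBool (encodeList encodeBool) (λ a x → x ∷ a) {j = 1} {k = 1}
            (λ x a → run-return (cons (at 0) (at 1)))
            (proj₂ (foldl orStep (oneHot (toℕ i) , []) (toList S))) [] refl refl
            (≤-trans (≤-reflexive (trans (length-foldl-orStep (toList S) (oneHot (toℕ i)) []) (+-identityʳ _)))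
                     (length-bits S ≤-refl))))

    run-multiplyTerm : ∀ (l : Literal n) S ms {ρ} →
      (encodeSubset S ∙ encodePoly ms ∙ encodeList encodeBool (oneHot (toℕ (index l))) ∙ encodeLiteral l ∙ ρ)
        ⊢ multiplyTermCode ⇓ encodePoly (multiplyTerm l S ++ ms) within 6
    run-multiplyTerm (pos i) S ms =
      run-let {j = 5} {k = 2} (run-union i S)
        (run-branch-cons (hd (at 4)) {k = 1} refl (run-return (cons (at 1) (cons (at 0) (at 2)))))
    run-multiplyTerm (neg i) S ms =
      run-let {j = 5} {k = 2} (run-union i S)
        (run-branch-nil (hd (at 4)) {k = 1} refl (run-return (cons (at 0) (at 2))))

    run-multiply : ∀ (l : Literal n) ms {ρ} → length ms ≤ X ^ 1 →
      (encodeLiteral l ∙ encodePoly ms ∙ ρ) ⊢ multiplyCode ⇓ encodePoly (multiply ms l) within 9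
    run-multiply l ms len =
      run-let {j = 3} {k = 8} (run-literal l)
        (run-foldl-simple encodeSubset encodePoly (λ zs S → multiplyTerm l S ++ zs) {j = 1} {k = 6}
          (λ S zs → run-multiplyTerm l S zs) ms [] refl refl len)
      where
      run-literal : ∀ (l : Literal n) {ρ} →
        (encodeLiteral l ∙ ρ) ⊢ oneHotCode ⇓ encodeList encodeBool (oneHot (toℕ (index l))) within 3
      run-literal (pos i) = run-oneHot i
      run-literal (neg i) = run-oneHot i

    run-clausePoly : ∀ (C : Clause n) (S : Subset (suc n)) {a b u ρ} →
      (encodeVec encodeLiteral C ∙ a ∙ (b ∙ encodeSubset S ∙ u) ∙ ρ)
        ⊢ fold (at 0) (cons (cons one (tl (hd (tl (at 2))))) nil) multiplyCode
        ⇓ encodePoly (clausePoly C S) within 11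
    run-clausePoly C S@(x ∷ S′) =
      -- A positive literal doubles the number of monomials, so every literal still to come counts
      -- as a factor 2. One monomial and three literals start the invariant at 8.
      run-foldl encodeLiteral encodePoly multiply (λ ls ms → length ms * 2 ^ length ls ≤ 8) {j = 1} {k = 9}
        (λ {l} {ls} {ms} J → ≤-trans (*-monoˡ-≤ (2 ^ length ls) (length-multiply ms l))
                             (≤-trans (≤-reflexive (*-assoc (length ms) 2 (2 ^ length ls))) J))
        (λ {l} {ls} {ms} J → run-multiply l ms
           (≤-trans (≤-trans (m≤m*2^ (length ms) (suc (length ls))) J)
                    (constant≤power {k = 1} (≤ᵇ⇒≤ 8 256 _) (s≤s z≤n))))
        (toList C) [ ⁅ zero ⁆ ∪ S ] refl (cong (λ T → encodeSubset (true ∷ T) ∙ nil) (sym (∪-identityˡ S′)))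
        (≤-reflexive (cong (λ k → 1 * 2 ^ k) (length-toList C)))
        (≤-trans (≤-reflexive (length-toList C)) (constant≤power {k = 1} (≤ᵇ⇒≤ 3 256 _) (s≤s z≤n)))

    encodeEquations : List (Equation (suc n)) → Tree
    encodeEquations = encodeList encodeEquation

    module _ (clauses : List (Clause n)) (clauses≤X : length clauses ≤ X ^ 1) where

      run-clauses : ∀ it acc {i t d} →
        (encodeItem it ∙ encodeEquations acc ∙ i ∙ t ∙ d ∙ encodeℕ n ∙ encodeList
              (encodeVec encodeLiteral) clauses)
          ⊢ clausesCode ⇓ encodeEquations (map linearEquation (clausePolys clauses it) ++ acc) within 15
      run-clauses (suc (suc (suc (suc b))) , S , T) acc =
        run-branch-cons (tl (tl (tl (hd (at 0))))) {k = 14} refl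
          (run-cast (cong encodeEquations (map-gather clauses [] acc))
            (run-foldl-simple (encodeVec encodeLiteral) encodeEquations
              (λ a C → linearEquation (clausePoly C S) ∷ a) {j = 1} {k = 12}
              (λ C a → run-let {j = 11} {k = 1} (run-clausePoly C S)
                    (run-return (cons (cons nil (at 0)) (at 2))))
              clauses acc refl refl clauses≤X))
        where
        map-gather : ∀ Cs ys acc → foldl (λ a C → linearEquation (clausePoly C S) ∷ a)
              (map linearEquation ys ++ acc) Cs
                     ≡ map linearEquation (gather (λ C → [ clausePoly C S ]) Cs ys) ++ acc
        map-gather []       ys acc = refl
        map-gather (C ∷ Cs) ys acc = map-gather Cs (clausePoly C S ∷ ys) acc
      run-clauses (0 , S , T) acc = relax (s≤s (s≤s z≤n))
            (run-branch-nil (tl (tl (tl (hd (at 0))))) {k = 1} refl (run-return (at 1)))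
      run-clauses (1 , S , T) acc = relax (s≤s (s≤s z≤n))
            (run-branch-nil (tl (tl (tl (hd (at 0))))) {k = 1} refl (run-return (at 1)))
      run-clauses (2 , S , T) acc = relax (s≤s (s≤s z≤n))
            (run-branch-nil (tl (tl (tl (hd (at 0))))) {k = 1} refl (run-return (at 1)))
      run-clauses (3 , S , T) acc = relax (s≤s (s≤s z≤n))
            (run-branch-nil (tl (tl (tl (hd (at 0))))) {k = 1} refl (run-return (at 1)))

      run-homogeneity : ∀ (it@(b , S , T) : Item (suc n)) acc {ρ} →
        (encodeBool (occupied S) ∙ encodeEquations acc ∙ encodeItem it ∙ ρ)
          ⊢ homogeneityCode ⇓ encodeEquations (map linearEquation (homogeneityPolys clauses it) ++ acc) within 3
      run-homogeneity (suc b , S , T) acc with occupied S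
      run-homogeneity (suc b , (x ∷ S) , T) acc | true =
        run-branch-cons (at 0) {k = 2} refl (run-branch-cons (hd (at 2)) {k = 1} refl
          (run-cast (cong (λ R → encodeEquations (linearEquation ((x ∷ S) ∷ (true ∷ R) ∷ []) ∷ acc))
                (sym (∪-identityˡ S)))
            (run-return (cons (cons nil (cons (hd (tl (at 2))) (cons (cons one (tl (hd (tl (at 2))))) nil)))
                  (at 1)))))
      ... | false = relax (s≤s (s≤s z≤n)) (run-branch-nil (at 0) {k = 1} refl (run-return (at 1)))
      run-homogeneity (zero , S , T) acc with occupied S
      ... | true  = run-branch-cons (at 0) {k = 2} refl (run-branch-nil (hd (at 2)) {k = 1} refl
            (run-return (at 1)))
      ... | false = relax (s≤s (s≤s z≤n)) (run-branch-nil (at 0) {k = 1} refl (run-return (at 1)))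

      run-product : ∀ (it@(b , S , T) : Item (suc n)) acc {a ρ} →
        (encodeEquations acc ∙ encodeBool (occupied S) ∙ a ∙ encodeItem it ∙ ρ)
          ⊢ productCode ⇓ encodeEquations (productEquations clauses it ++ acc) within 6
      run-product it@(b , S , T) acc {a} {ρ} = cases (occupied S) (occupied T) (run-occupied T refl)
        where
        cases : ∀ s t → ((encodeEquations acc ∙ encodeBool s ∙ a ∙ encodeItem it ∙ ρ) ⊢ occupiedCode
              (hd (tl (tl (at 3)))) ⇓ encodeBool t within 4) →
          (encodeEquations acc ∙ encodeBool s ∙ a ∙ encodeItem it ∙ ρ)
            ⊢ productCode ⇓ encodeEquations
                  ((if s then if t then [ [ S , T ] , [ S ∪ T ] ] else [] else []) ++ acc) within 6
        cases false t     r = relax (s≤s (s≤s z≤n)) (run-branch-nil (at 1) {k = 1} refl (run-return (at 0)))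
        cases true  false r =
          run-branch-cons (at 1) {k = 5} refl (run-let {j = 4} {k = 2} r
            (run-branch-nil (at 0) {k = 1} refl (run-return (at 1))))
        cases true  true  r =
          run-branch-cons (at 1) {k = 5} refl (run-let {j = 4} {k = 2} r
            (run-branch-cons (at 0) {k = 1} refl
              (run-return (cons (cons (cons (cons (hd (tl (at 4))) (hd (tl (tl (at 4))))) nil)
                                      (cons (tl (tl (tl (at 4)))) nil)) (at 1)))))

      run-item : ∀ it acc {i t d} →
        (encodeItem it ∙ encodeEquations acc ∙ i ∙ t ∙ d ∙ encodeℕ n ∙ encodeList
              (encodeVec encodeLiteral) clauses)
          ⊢ itemCode ⇓ encodeEquations (itemEquations clauses it ++ acc) within 16
      run-item it@(b , S , T) acc =
        run-cast (cong encodeEquations regroup)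
          (run-let {j = 15} {k = 8} (run-clauses it acc)
            (run-let {j = 4} {k = 7} (run-occupied S refl)
              (run-let {j = 3} {k = 6} (run-homogeneity it (map linearEquation (clausePolys clauses it) ++ acc))
                (run-product it (map linearEquation (homogeneityPolys clauses it) ++ map linearEquation
                      (clausePolys clauses it) ++ acc)))))
        where
        regroup : productEquations clauses it ++ map linearEquation
              (homogeneityPolys clauses it) ++ map linearEquation (clausePolys clauses it) ++ acc
                  ≡ itemEquations clauses it ++ acc
        regroup rewrite map-++ linearEquation (homogeneityPolys clauses it) (clausePolys clauses it)
                      | ++-assoc (productEquations clauses it)
                          (map linearEquation (homogeneityPolys clauses it) ++ map linearEquation
                                (clausePolys clauses it)) acc
                      | ++-assoc (map linearEquation (homogeneityPolys clauses it))
                            (map linearEquation (clausePolys clauses it)) acc = refl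

    run-grow : ∀ {m} (it : Item m) its {ρ} →
      (encodeItem it ∙ encodeList encodeItem its ∙ ρ) ⊢ growItem ⇓ encodeList encodeItem
            (grow it ++ its) within 2
    run-grow (zero  , S , T) its = run-branch-nil (hd (at 0)) {k = 1} refl (run-return _)
    run-grow (suc b , S , T) its = run-branch-cons (hd (at 0)) {k = 1} refl (run-return _)

    run-growAll : ∀ {d m} → length (items d m) ≤ X ^ 4 → ∀ {ρ} →
      (nil ∙ encodeList encodeItem (items d m) ∙ ρ) ⊢ growAll ⇓ encodeList encodeItem (items d (suc m)) within 7
    run-growAll {d} {m} len =
      run-foldl-simple encodeItem (encodeList encodeItem) (λ zs it → grow it ++ zs) {j = 4} {k = 2}
        (λ it its → run-grow it its) (items d m) [] refl refl len

    module _ {d : ℕ} (items≤X : ∀ m → m ≤ suc n → length (items d m) ≤ X ^ 4) where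

      -- The type of the accumulated items changes with the number of coordinates, so the fold with
      -- a fixed accumulator type does not fit. The invariant on trees hides m and ties it to the
      -- number of remaining turns.
      run-enumerate : ∀ {t c} →
        (t ∙ encodeℕ d ∙ encodeℕ n ∙ c) ⊢ enumerate ⇓ encodeList encodeItem (items d (suc n)) within 9
      run-enumerate {t} {c} =
        result (run-fold-invariant (λ _ → nil) I {k = 7} (λ {u} {us} → step {u} {us}) {j = 1}
              (List.replicate (suc n) tt)
          (cong (nil ∙_) (encodeℕ-list n)) (0 , length-replicate (suc n) , refl)
          (≤-trans (≤-reflexive (length-replicate (suc n))) (≤-trans n<X (≤-reflexive (sym (*-identityʳ X))))))
        where
        I : List ⊤ → Tree → Set
        I us v = ∃[ m ] m + length us ≡ suc n × v ≡ encodeList encodeItem (items d m)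
        step : ∀ {u us v} → I (u ∷ us) v →
               ∃[ v′ ] (nil ∙ v ∙ t ∙ encodeℕ d ∙ encodeℕ n ∙ c) ⊢ growAll ⇓ v′ within 7 × I us v′
        step {us = us} (m , m≡ , refl) =
          _ , run-growAll {d} {m} (items≤X m (≤-trans (m≤m+n m _) (≤-reflexive m≡))) ,
          suc m , trans (sym (+-suc m (length us))) m≡ , refl
        result : ∃[ v ] (t ∙ encodeℕ d ∙ encodeℕ n ∙ c) ⊢ enumerate ⇓ v within 9 × I [] v →
                 (t ∙ encodeℕ d ∙ encodeℕ n ∙ c) ⊢ enumerate ⇓ encodeList encodeItem (items d (suc n)) within 9
        result (v , r , m , m≡ , v≡) =
          run-cast (trans v≡ (cong (λ m → encodeList encodeItem (items d m))
                (trans (sym (+-identityʳ m)) m≡))) r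

      run-system : ∀ (clauses : List (Clause n)) → length clauses ≤ X ^ 1 → ∀ {t} →
        (t ∙ encodeℕ d ∙ encodeℕ n ∙ encodeList (encodeVec encodeLiteral) clauses)
          ⊢ systemCode ⇓ encodeEquations (equations clauses d) within 22
      run-system clauses clauses≤X =
        run-let {j = 9} {k = 21} run-enumerate
          (run-foldl-simple encodeItem encodeEquations (λ zs it → itemEquations clauses it ++ zs) {j = 4} {k =
                16}
            (λ it acc → run-item clauses clauses≤X it acc) (items d (suc n)) [] refl refl
                  (items≤X (suc n) ≤-refl))

systemProgram : Program
systemProgram = program mainCode

-- Size of the system

-- The weight bounds the number of items into which a list grows in k steps.
weight : ∀ {m} → ℕ → List (Item m) → ℕ
weight k its = ListAction.sum (map (λ (b , _) → (3 * k + 1) ^ b) its)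

weight-++ : ∀ {m} k (xs ys : List (Item m)) → weight k (xs ++ ys) ≡ weight k xs + weight k ys
weight-++ k xs ys = trans (cong ListAction.sum (map-++ _ xs ys)) (sum-++ (map _ xs) (map _ ys))

-- With p = (3k+1)^b, the child that keeps the budget b + 1 weighs (3k+1)p and the three that lose a
-- unit weigh p each. The sum is (3(k+1)+1)p, which is the recurrence that the base 3k + 1 is chosen
-- to satisfy.
weight-grow : ∀ {m} k (it : Item m) → weight k (grow it) ≤ (3 * suc k + 1) ^ proj₁ it
weight-grow k (zero  , S , T) = ≤-refl
weight-grow k (suc b , S , T) = begin
  (3 * k + 1) * P + (P + (P + (P + 0)))
    ≡⟨ solve 2 (λ k p → (con 3 :* k :+ con 1) :* p :+ (p :+ (p :+ (p :+ con 0))) ⊜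
          (con 3 :* (con 1 :+ k) :+ con 1) :* p) refl k P ⟩
  (3 * suc k + 1) * P
    ≤⟨ *-monoʳ-≤ (3 * suc k + 1) (^-monoˡ-≤ b (+-monoˡ-≤ 1 (*-monoʳ-≤ 3 (n≤1+n k)))) ⟩
  (3 * suc k + 1) * (3 * suc k + 1) ^ b ∎
  where
  open ≤-Reasoning
  P = (3 * k + 1) ^ b

weight-gather : ∀ {m} k (its : List (Item m)) ys →
                weight k (gather grow its ys) ≤ weight (suc k) its + weight k ys
weight-gather k []         ys = ≤-refl
weight-gather k (it ∷ its) ys = begin
  weight k (gather grow its (grow it ++ ys))             ≤⟨ weight-gather k its (grow it ++ ys) ⟩
  weight (suc k) its + weight k (grow it ++ ys)          ≡⟨ cong (weight (suc k) its +_)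
        (weight-++ k (grow it) ys) ⟩
  weight (suc k) its + (weight k (grow it) + weight k ys)
    ≤⟨ +-monoʳ-≤ (weight (suc k) its) (+-monoˡ-≤ (weight k ys) (weight-grow k it)) ⟩
  weight (suc k) its + (w + weight k ys)
    ≡⟨ solve 3 (λ a b c → a :+ (b :+ c) ⊜ b :+ a :+ c) refl (weight (suc k) its) w (weight k ys) ⟩
  w + weight (suc k) its + weight k ys                   ∎
  where
  open ≤-Reasoning
  w = (3 * suc k + 1) ^ proj₁ it

weight-items : ∀ d k m → weight k (items d m) ≤ (3 * (k + m) + 1) ^ d
weight-items d k zero    =
      ≤-reflexive (trans (+-identityʳ _) (cong (λ j → (3 * j + 1) ^ d) (sym (+-identityʳ k))))
weight-items d k (suc m) = begin
  weight k (gather grow (items d m) []) ≤⟨ weight-gather k (items d m) [] ⟩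
  weight (suc k) (items d m) + 0        ≡⟨ +-identityʳ _ ⟩
  weight (suc k) (items d m)            ≤⟨ weight-items d (suc k) m ⟩
  (3 * (suc k + m) + 1) ^ d             ≡⟨ cong (λ j → (3 * j + 1) ^ d) (sym (+-suc k m)) ⟩
  (3 * (k + suc m) + 1) ^ d             ∎
  where open ≤-Reasoning

length-items : ∀ d m → length (items d m) ≤ (3 * m + 1) ^ d
length-items d m = ≤-trans (≤-reflexive (length≡weight (items d m))) (weight-items d 0 m)
  where
  length≡weight : ∀ (its : List (Item m)) → length its ≡ weight 0 its
  length≡weight []               = refl
  length≡weight ((b , _) ∷ its) = cong₂ _+_ (sym (^-zeroˡ b)) (length≡weight its)

-- The number of distinct clauses and the size of the output

lookup-injective : {A : Set} {xs : List A} → Unique xs → ∀ i j → List.lookup xs i ≡ List.lookup xs j → i ≡ j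
lookup-injective (_  ∷ _) zero    zero    eq = refl
lookup-injective (x∉ ∷ _) zero    (suc j) eq = contradiction eq (All.lookup x∉ (∈-lookup j))
lookup-injective (x∉ ∷ _) (suc i) zero    eq = contradiction (sym eq) (All.lookup x∉ (∈-lookup i))
lookup-injective (_  ∷ u) (suc i) (suc j) eq = cong suc (lookup-injective u i j eq)

module _ {n : ℕ} where

  polarity : Literal n → Fin n ⊎ Fin n
  polarity (pos i) = inj₁ i
  polarity (neg i) = inj₂ i

  polarity-injective : ∀ l l′ → polarity l ≡ polarity l′ → l ≡ l′
  polarity-injective (pos i) (pos _) refl = refl
  polarity-injective (neg i) (neg _) refl = refl

  literalCode : Literal n → Fin (n + n)
  literalCode l = join n n (polarity l)

  literalCode-injective : ∀ l l′ → literalCode l ≡ literalCode l′ → l ≡ l′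
  literalCode-injective l l′ eq = polarity-injective l l′
    (trans (sym (splitAt-join n n (polarity l))) (trans (cong (splitAt n) eq) (splitAt-join n n (polarity l′))))

  clauseNumber : Clause n → Fin ((n + n) * ((n + n) * (n + n)))
  clauseNumber (a ∷ b ∷ c ∷ []) = combine (literalCode a) (combine (literalCode b) (literalCode c))

  clauseNumber-injective : ∀ {C D} → clauseNumber C ≡ clauseNumber D → C ≡ D
  clauseNumber-injective {a ∷ b ∷ c ∷ []} {a′ ∷ b′ ∷ c′ ∷ []} eq
    with eqa , eq′ ← combine-injective (literalCode a) _ (literalCode a′) _ eq
    with eqb , eqc ← combine-injective (literalCode b) (literalCode c) (literalCode b′) (literalCode c′) eq′
    with refl ← literalCode-injective a a′ eqa | refl ← literalCode-injective b b′ eqb | refl ← literalCode-injective c c′ eqc = refl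

  length-clauses : ∀ {Cs : List (Clause n)} → Unique Cs → length Cs ≤ (n + n) * ((n + n) * (n + n))
  length-clauses {Cs} unique =
    injective⇒≤ {f = clauseNumber ∘ List.lookup Cs} (λ eq → lookup-injective unique _ _
          (clauseNumber-injective {List.lookup Cs _} {List.lookup Cs _} eq))

size-encodeList : {A : Set} (enc : A → Tree) {M : ℕ} {xs : List A} →
                  All (λ x → size (enc x) ≤ M) xs → size (encodeList enc xs) ≤ 1 + length xs * (1 + M)
size-encodeList enc []                = ≤-refl
size-encodeList enc {M} {x ∷ xs} (s ∷ ss) = s≤s (begin
  size (enc x) + size (encodeList enc xs) ≤⟨ +-mono-≤ s (size-encodeList enc ss) ⟩
  M + (1 + length xs * (1 + M))           ≡⟨ +-suc M _ ⟩
  1 + M + length xs * (1 + M)             ∎)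
  where open ≤-Reasoning

All-gather : {A B : Set} {P : B → Set} (f : A → List B) → (∀ x → All P (f x)) →
             ∀ xs {ys} → All P ys → All P (gather f xs ys)
All-gather f Pf []       Pys = Pys
All-gather f Pf (x ∷ xs) Pys = All-gather f Pf xs (++⁺ (Pf x) Pys)

module Size (X : ℕ) (256≤X : 256 ≤ X) {n : ℕ} (n<X : suc n ≤ X) where
  open Run X 256≤X

  size-subset : ∀ (S : Subset (suc n)) → size (encodeSubset S) ≤ X ^ 2
  size-subset S = begin
    size (encodeSubset S)              ≤⟨ size-encodeList encodeBool {3} (All.universal size-bool (toList S)) ⟩
    1 + length (toList S) * 4          ≡⟨ cong (λ k → 1 + k * 4) (length-toList S) ⟩
    1 + suc n * 4                      ≤⟨ +-mono-≤ (1≤power 1)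
          (*-monoˡ-≤ 4 (≤-trans n<X (≤-reflexive (sym (*-identityʳ X))))) ⟩
    X ^ 1 + X ^ 1 * 4                  ≡⟨ solve 1 (λ x → x :+ x :* con 4 ⊜ con 5 :* x) refl (X ^ 1) ⟩
    5 * X ^ 1                          ≤⟨ power-absorb {5} {1} (≤ᵇ⇒≤ 5 256 _) ⟩
    X ^ 2 ∎
    where
    open ≤-Reasoning
    size-bool : ∀ b → size (encodeBool b) ≤ 3
    size-bool false = s≤s z≤n
    size-bool true  = ≤-refl

  size-poly : ∀ (ms : List (Subset (suc n))) → length ms ≤ 8 → size (encodePoly ms) ≤ X ^ 3
  size-poly ms len = begin
    size (encodePoly ms)         ≤⟨ size-encodeList encodeSubset (All.universal size-subset ms) ⟩
    1 + length ms * (1 + X ^ 2)  ≤⟨ +-mono-≤ (1≤power 2) (*-mono-≤ len (+-monoˡ-≤ (X ^ 2) (1≤power 2))) ⟩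
    X ^ 2 + 8 * (X ^ 2 + X ^ 2)  ≡⟨ solve 1 (λ x → x :+ con 8 :* (x :+ x) ⊜ con 17 :* x) refl (X ^ 2) ⟩
    17 * X ^ 2                   ≤⟨ power-absorb {17} {2} (≤ᵇ⇒≤ 17 256 _) ⟩
    X ^ 3 ∎
    where open ≤-Reasoning

  SmallEquation : Equation (suc n) → Set
  SmallEquation (qs , ms) = length qs ≤ 1 × length ms ≤ 8

  size-equation : ∀ g → SmallEquation g → size (encodeEquation g) ≤ X ^ 4
  size-equation (qs , ms) (qs≤1 , ms≤8) = begin
    1 + (size (encodeList encodePair qs) + size (encodePoly ms))
      ≤⟨ +-mono-≤ (1≤power 3) (+-mono-≤ (≤-trans (size-encodeList encodePair (All.universal size-pair qs))
           (+-mono-≤ (1≤power 3) (*-mono-≤ qs≤1 (+-monoˡ-≤ (X ^ 3) (1≤power 3))))) (size-poly ms ms≤8)) ⟩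
    X ^ 3 + (X ^ 3 + 1 * (X ^ 3 + X ^ 3) + X ^ 3) ≡⟨ solve 1
          (λ x → x :+ (x :+ con 1 :* (x :+ x) :+ x) ⊜ con 5 :* x) refl (X ^ 3) ⟩
    5 * X ^ 3 ≤⟨ power-absorb {5} {3} (≤ᵇ⇒≤ 5 256 _) ⟩
    X ^ 4 ∎
    where
    open ≤-Reasoning
    encodePair : Subset (suc n) × Subset (suc n) → Tree
    encodePair (S , T) = encodeSubset S ∙ encodeSubset T
    size-pair : ∀ p → size (encodePair p) ≤ X ^ 3
    size-pair (S , T) = begin
      1 + (size (encodeSubset S) + size (encodeSubset T)) ≤⟨ +-mono-≤ (1≤power 2)
            (+-mono-≤ (size-subset S) (size-subset T)) ⟩
      X ^ 2 + (X ^ 2 + X ^ 2)                             ≡⟨ solve 1 (λ x → x :+ (x :+ x) ⊜ con 3 :* x) refl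
            (X ^ 2) ⟩
      3 * X ^ 2                                           ≤⟨ power-absorb {3} {2} (≤ᵇ⇒≤ 3 256 _) ⟩
      X ^ 3 ∎

  length-clausePoly : ∀ (C : Clause n) S → length (clausePoly C S) ≤ 8
  length-clausePoly C S =
    subst (λ k → length (clausePoly C S) ≤ 1 * 2 ^ k) (length-toList C) (bound (toList C) [ ⁅ zero ⁆ ∪ S ])
    where
    bound : ∀ ls ms → length (foldl multiply ms ls) ≤ length ms * 2 ^ length ls
    bound []       ms = ≤-reflexive (sym (*-identityʳ _))
    bound (l ∷ ls) ms = ≤-trans (bound ls (multiply ms l))
      (≤-trans (*-monoˡ-≤ (2 ^ length ls) (length-multiply ms l))
            (≤-reflexive (*-assoc (length ms) 2 (2 ^ length ls))))

  module _ (clauses : List (Clause n)) (clauses≤X : length clauses ≤ X ^ 1) where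

    small-clausePolys : ∀ it → All (λ ms → length ms ≤ 8) (clausePolys clauses it)
    small-clausePolys (suc (suc (suc (suc b))) , S , T) =
      All-gather _ (λ C → length-clausePoly C S ∷ []) clauses []
    small-clausePolys (0 , _) = []
    small-clausePolys (1 , _) = []
    small-clausePolys (2 , _) = []
    small-clausePolys (3 , _) = []

    small-homogeneityPolys : ∀ it → All (λ ms → length ms ≤ 8) (homogeneityPolys clauses it)
    small-homogeneityPolys (zero  , S , T) = []
    small-homogeneityPolys (suc b , S , T) with occupied S
    ... | true  = ≤ᵇ⇒≤ 2 8 _ ∷ []
    ... | false = []

    small-productEquations : ∀ it → All SmallEquation (productEquations clauses it)
    small-productEquations (b , S , T) with occupied S | occupied T
    ... | true  | true  = (≤-refl , s≤s z≤n) ∷ []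
    ... | true  | false = []
    ... | false | _     = []

    small-itemEquations : ∀ it → All SmallEquation (itemEquations clauses it)
    small-itemEquations it =
      ++⁺ (small-productEquations it)
          (map⁺ (All.map (z≤n ,_) (++⁺ (small-homogeneityPolys it) (small-clausePolys it))))

    length-itemEquations : ∀ it → length (itemEquations clauses it) ≤ X ^ 2
    length-itemEquations it = begin
      length (productEquations clauses it ++ map linearEquation (itemPolys clauses it))
        ≡⟨ trans (length-++ (productEquations clauses it)) (cong (length (productEquations clauses it) +_)
             (trans (length-map linearEquation (itemPolys clauses it))
                   (length-++ (homogeneityPolys clauses it)))) ⟩
      length (productEquations clauses it) + (length (homogeneityPolys clauses it) + length
            (clausePolys clauses it))
        ≤⟨ +-mono-≤ (≤-trans (products it) (1≤power 1)) (+-mono-≤ (≤-trans (homogeneities it) (1≤power 1))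
              (clausePolys≤ it)) ⟩
      X ^ 1 + (X ^ 1 + X ^ 1) ≡⟨ solve 1 (λ x → x :+ (x :+ x) ⊜ con 3 :* x) refl (X ^ 1) ⟩
      3 * X ^ 1 ≤⟨ power-absorb {3} {1} (≤ᵇ⇒≤ 3 256 _) ⟩
      X ^ 2 ∎
      where
      open ≤-Reasoning
      products : ∀ it → length (productEquations clauses it) ≤ 1
      products (b , S , T) with occupied S | occupied T
      ... | true  | true  = ≤-refl
      ... | true  | false = z≤n
      ... | false | _     = z≤n
      homogeneities : ∀ it → length (homogeneityPolys clauses it) ≤ 1
      homogeneities (zero  , S , T) = z≤n
      homogeneities (suc b , S , T) with occupied S
      ... | true  = ≤-refl
      ... | false = z≤n
      clausePolys≤ : ∀ it → length (clausePolys clauses it) ≤ X ^ 1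
      clausePolys≤ (suc (suc (suc (suc b))) , S , T) = begin
        length (clausePolys clauses (4 + b , S , T)) ≤⟨ length-gather (λ C → [ clausePoly C S ])
              (λ _ → ≤-refl) clauses [] ⟩
        length clauses * 1 + 0                       ≡⟨ trans (+-identityʳ _) (*-identityʳ _) ⟩
        length clauses                               ≤⟨ clauses≤X ⟩
        X ^ 1                                        ∎
      clausePolys≤ (0 , _) = z≤n
      clausePolys≤ (1 , _) = z≤n
      clausePolys≤ (2 , _) = z≤n
      clausePolys≤ (3 , _) = z≤n

    size-equations : ∀ {d} → length (items d (suc n)) ≤ X ^ 4 →
                     size (encodeList encodeEquation (equations clauses d)) ≤ X ^ 11
    size-equations {d} items≤X = begin
      size (encodeList encodeEquation (equations clauses d))
        ≤⟨ size-encodeList encodeEquation (All.map (λ {g} → size-equation g)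
             (All-gather (itemEquations clauses) small-itemEquations (items d (suc n)) [])) ⟩
      1 + length (equations clauses d) * (1 + X ^ 4)
        ≤⟨ +-mono-≤ (1≤power 10) (*-mono-≤ length≤ (+-monoˡ-≤ (X ^ 4) (1≤power 4))) ⟩
      X ^ 10 + X ^ 6 * (X ^ 4 + X ^ 4)
        ≡⟨ cong₂ _+_ (^-distribˡ-+-* X 6 4) refl ⟩
      X ^ 6 * X ^ 4 + X ^ 6 * (X ^ 4 + X ^ 4)
        ≡⟨ solve 2 (λ a b → a :* b :+ a :* (b :+ b) ⊜ con 3 :* (a :* b)) refl (X ^ 6) (X ^ 4) ⟩
      3 * (X ^ 6 * X ^ 4) ≡⟨ cong (3 *_) (sym (^-distribˡ-+-* X 6 4)) ⟩
      3 * X ^ 10          ≤⟨ power-absorb {3} {10} (≤ᵇ⇒≤ 3 256 _) ⟩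
      X ^ 11              ∎
      where
      open ≤-Reasoning
      length≤ : length (equations clauses d) ≤ X ^ 6
      length≤ = begin
        length (equations clauses d)       ≤⟨ length-gather (itemEquations clauses) length-itemEquations
              (items d (suc n)) [] ⟩
        length (items d (suc n)) * X ^ 2 + 0 ≡⟨ +-identityʳ _ ⟩
        length (items d (suc n)) * X ^ 2   ≤⟨ *-monoˡ-≤ (X ^ 2) items≤X ⟩
        X ^ 4 * X ^ 2                      ≡⟨ sym (^-distribˡ-+-* X 4 2) ⟩
        X ^ 6                              ∎

-- The overall time bound

module _ (d n : ℕ) (8≤d : 8 ≤ d) where
  private
    -- From N ≥ 2 and d ≥ 8 follows X ≥ 2^8 = 256, the constant on which the cost calculus rests.
    -- Also X ≥ N^6, which bounds the (2n)³ possible clauses because 2n ≤ N².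
    N = n ⊔ 2
    X = N ^ d

    n≤N : n ≤ N
    n≤N = m≤m⊔n n 2

    2≤N : 2 ≤ N
    2≤N = m≤n⊔m n 2

    instance
      N≢0 : NonZero N
      N≢0 = >-nonZero (≤-trans (s≤s z≤n) 2≤N)

    power≤X : ∀ {k} → k ≤ 8 → N ^ k ≤ X
    power≤X k≤8 = ^-monoʳ-≤ N (≤-trans k≤8 8≤d)

    256≤X : 256 ≤ X
    256≤X = ≤-trans (^-monoˡ-≤ 8 2≤N) (power≤X ≤-refl)

    n<X : suc n ≤ X
    n<X = begin
      suc n             ≤⟨ s≤s n≤N ⟩
      1 + N             ≤⟨ +-monoˡ-≤ N (≤-trans (s≤s z≤n) 2≤N) ⟩
      N + N             ≡⟨ solve 1 (λ x → x :+ x ⊜ con 2 :* x) refl N ⟩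
      2 * N             ≤⟨ *-monoˡ-≤ N 2≤N ⟩
      N * N             ≡⟨ cong (N *_) (sym (*-identityʳ N)) ⟩
      N ^ 2             ≤⟨ power≤X (≤ᵇ⇒≤ 2 8 _) ⟩
      X                 ∎
      where open ≤-Reasoning

    items≤X : ∀ m → m ≤ suc n → length (items d m) ≤ X ^ 4
    items≤X m m≤ = begin
      length (items d m) ≤⟨ length-items d m ⟩
      (3 * m + 1) ^ d    ≤⟨ ^-monoˡ-≤ d base ⟩
      (N ^ 4) ^ d        ≡⟨ trans (^-*-assoc N 4 d) (trans (cong (N ^_) (*-comm 4 d)) (sym (^-*-assoc N d 4))) ⟩
      X ^ 4              ∎
      where
      open ≤-Reasoning
      base : 3 * m + 1 ≤ N ^ 4
      base = begin
        3 * m + 1           ≤⟨ +-monoˡ-≤ 1 (*-monoʳ-≤ 3 (≤-trans m≤ (s≤s n≤N))) ⟩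
        3 * suc N + 1       ≡⟨ solve 1
              (λ x → con 3 :* (con 1 :+ x) :+ con 1 ⊜ con 3 :* x :+ con 2 :* con 2) refl N ⟩
        3 * N + 2 * 2       ≤⟨ +-mono-≤ (*-monoˡ-≤ N (≤ᵇ⇒≤ 3 6 _)) (*-monoʳ-≤ 2 2≤N) ⟩
        6 * N + 2 * N       ≡⟨ solve 1 (λ x → con 6 :* x :+ con 2 :* x ⊜ con 2 :*
              (con 2 :* (con 2 :* (x :* con 1)))) refl N ⟩
        2 * (2 * (2 * (N * 1))) ≤⟨ *-mono-≤ 2≤N (*-mono-≤ 2≤N (*-monoˡ-≤ (N * 1) 2≤N)) ⟩
        N ^ 4               ∎

    clauses≤X : (φ : Formula n) → length (clauses φ) ≤ X ^ 1
    clauses≤X φ = begin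
      length (clauses φ)                 ≤⟨ length-clauses (Formula.unique φ) ⟩
      (n + n) * ((n + n) * (n + n))      ≤⟨ *-mono-≤ 2n≤ (*-mono-≤ 2n≤ 2n≤) ⟩
      (N * N) * ((N * N) * (N * N))      ≡⟨ solve 1 (λ x → (x :* x) :* ((x :* x) :* (x :* x)) ⊜ x :*
            (x :* (x :* (x :* (x :* (x :* con 1)))))) refl N ⟩
      N ^ 6                              ≤⟨ power≤X (≤ᵇ⇒≤ 6 8 _) ⟩
      X                                  ≡⟨ sym (*-identityʳ X) ⟩
      X ^ 1                              ∎
      where
      open ≤-Reasoning
      2n≤ : n + n ≤ N * N
      2n≤ = begin
        n + n ≤⟨ +-mono-≤ n≤N n≤N ⟩
        N + N ≡⟨ solve 1 (λ x → x :+ x ⊜ con 2 :* x) refl N ⟩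
        2 * N ≤⟨ *-monoˡ-≤ N 2≤N ⟩
        N * N ∎

  open Run X 256≤X

  system-computable : ∀ t (φ : Formula n) →
    systemProgram Maps encodeInstance t d n φ To encodeList encodeEquation (equations (clauses φ) d)
      InTime ((n ⊔ 2) ^ (23 * d))
  system-computable t φ =
    let m , run , m≤ = _⊢_⇓_within_.run
          (Correctness.run-system X 256≤X n<X {d} items≤X (clauses φ) (clauses≤X φ) {encodeℕ t}) nil
    in _ , _ , seq run assign , refl , bound m≤
    where
    open ≤-Reasoning
    w = size (encodeList encodeEquation (equations (clauses φ) d))
    -- The run, the final assignment and the written answer each fit into X^22, and one more factor
    -- X absorbs their sum. This is the origin of the constant 23 in the exponent.
    bound : ∀ {m} → m ≤ X ^ 22 → m + 3 + w ≤ N ^ (23 * d)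
    bound {m} m≤ = begin
      m + 3 + w ≤⟨ +-mono-≤ (+-mono-≤ m≤ (constant≤power {3} {22} (≤ᵇ⇒≤ 3 256 _) (s≤s z≤n)))
                     (≤-trans (Size.size-equations X 256≤X n<X (clauses φ) (clauses≤X φ)
                           (items≤X (suc n) ≤-refl)) (power-mono (≤ᵇ⇒≤ 11 22 _))) ⟩
      X ^ 22 + X ^ 22 + X ^ 22 ≡⟨ solve 1 (λ x → x :+ x :+ x ⊜ con 3 :* x) refl (X ^ 22) ⟩
      3 * X ^ 22               ≤⟨ power-absorb {3} {22} (≤ᵇ⇒≤ 3 256 _) ⟩
      X ^ 23                   ≡⟨ trans (^-*-assoc N d 23) (cong (N ^_) (*-comm d 23)) ⟩
      N ^ (23 * d)             ∎

-- Linear functionals and their cofactors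

xor-cancel : ∀ x y → x xor (y xor x) ≡ y
xor-cancel false false = refl
xor-cancel false true  = refl
xor-cancel true  false = refl
xor-cancel true  true  = refl

-- A linear functional on multilinear polynomials, given by its values at the
-- monomials.
Functional : ℕ → Set
Functional m = Subset m → 𝔽₂

-- The functional q ↦ F (q · [xᵢ = b]).
fix : ∀ {m} → Fin m → Bool → Functional m → Functional m
fix i true  F S = F (⁅ i ⁆ ∪ S)
fix i false F S = F S xor F (⁅ i ⁆ ∪ S)

∪-swap : ∀ {m} (A B S : Subset m) → A ∪ (B ∪ S) ≡ B ∪ (A ∪ S)
∪-swap A B S = trans (sym (∪-assoc A B S)) (trans (cong (_∪ S) (∪-comm A B)) (∪-assoc B A S))

∪-absorb : ∀ {m} (A S : Subset m) → A ∪ (A ∪ S) ≡ A ∪ S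
∪-absorb A S = trans (sym (∪-assoc A A S)) (cong (_∪ S) (∪-idem A))

fix-cong : ∀ {m} i b {F G : Functional m} → F ≗ G → fix i b F ≗ fix i b G
fix-cong i true  eq S = eq _
fix-cong i false eq S = cong₂ _xor_ (eq _) (eq _)

fix-comm : ∀ {m} i b j c (F : Functional m) → fix i b (fix j c F) ≗ fix j c (fix i b F)
fix-comm i true  j true  F S = cong F (∪-swap ⁅ j ⁆ ⁅ i ⁆ S)
fix-comm i true  j false F S = cong (λ R → F (⁅ i ⁆ ∪ S) xor F R) (∪-swap ⁅ j ⁆ ⁅ i ⁆ S)
fix-comm i false j true  F S = cong (λ R → F (⁅ j ⁆ ∪ S) xor F R) (∪-swap ⁅ j ⁆ ⁅ i ⁆ S)
fix-comm i false j false F S =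
  trans (cong (λ R → (F S xor F (⁅ j ⁆ ∪ S)) xor (F (⁅ i ⁆ ∪ S) xor F R)) (∪-swap ⁅ j ⁆ ⁅ i ⁆ S))
        (𝔽₂-xor.interchange (F S) (F (⁅ j ⁆ ∪ S)) (F (⁅ i ⁆ ∪ S)) (F (⁅ i ⁆ ∪ (⁅ j ⁆ ∪ S))))

fix-idem : ∀ {m} i b (F : Functional m) → fix i b (fix i b F) ≗ fix i b F
fix-idem i true  F S = cong F (∪-absorb ⁅ i ⁆ S)
fix-idem i false F S =
  trans (cong (λ R → (F S xor F (⁅ i ⁆ ∪ S)) xor (F (⁅ i ⁆ ∪ S) xor F R)) (∪-absorb ⁅ i ⁆ S))
        (trans (cong ((F S xor F (⁅ i ⁆ ∪ S)) xor_) (xor-same (F (⁅ i ⁆ ∪ S)))) (xor-identityʳ _))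

fix-conflict : ∀ {m} i b (F : Functional m) S → fix i b (fix i (not b) F) S ≡ 𝟘
fix-conflict i true  F S = trans (cong (λ R → F (⁅ i ⁆ ∪ S) xor F R) (∪-absorb ⁅ i ⁆ S))
      (xor-same (F (⁅ i ⁆ ∪ S)))
fix-conflict i false F S = trans (cong (λ R → F (⁅ i ⁆ ∪ S) xor F R) (∪-absorb ⁅ i ⁆ S))
      (xor-same (F (⁅ i ⁆ ∪ S)))

fix-partition : ∀ {m} i b (F : Functional m) S → fix i b F S xor fix i (not b) F S ≡ F S
fix-partition i true  F S = xor-cancel (F (⁅ i ⁆ ∪ S)) (F S)
fix-partition i false F S = trans (xor-comm (F S xor F (⁅ i ⁆ ∪ S)) _) (xor-cancel (F (⁅ i ⁆ ∪ S)) (F S))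

fix-zero : ∀ {m} i b {F : Functional m} {S} → F S ≡ 𝟘 → F (⁅ i ⁆ ∪ S) ≡ 𝟘 → fix i b F S ≡ 𝟘
fix-zero i true  FS FiS = FiS
fix-zero i false FS FiS = cong₂ _xor_ FS FiS

Path : ℕ → Set
Path m = List (Fin m × Bool)

restrict : ∀ {m} → Path m → Functional m → Functional m
restrict []            F = F
restrict ((i , b) ∷ p) F = restrict p (fix i b F)

restrict-cong : ∀ {m} p {F G : Functional m} → F ≗ G → restrict p F ≗ restrict p G
restrict-cong []            eq = eq
restrict-cong ((i , b) ∷ p) eq = restrict-cong p (fix-cong i b eq)

fix-restrict : ∀ {m} i b p (F : Functional m) → fix i b (restrict p F) ≗ restrict p (fix i b F)
fix-restrict i b []            F S = refl
fix-restrict i b ((j , c) ∷ p) F S =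
  trans (fix-restrict i b p (fix j c F) S) (restrict-cong p (fix-comm i b j c F) S)

restrict-idem : ∀ {m} p (F : Functional m) → restrict p (restrict p F) ≗ restrict p F
restrict-idem []            F S = refl
restrict-idem ((i , b) ∷ p) F S =
  trans (restrict-cong p (fix-restrict i b p (fix i b F)) S)
        (trans (restrict-idem p (fix i b (fix i b F)) S) (restrict-cong p (fix-idem i b F) S))

restrict-zero : ∀ {m} p {F : Functional m} → (∀ S → F S ≡ 𝟘) → ∀ S → restrict p F S ≡ 𝟘
restrict-zero []            z = z
restrict-zero ((i , b) ∷ p) {F} z = restrict-zero p (λ S → fix-zero i b {F} {S} (z _) (z _))

-- Falsified clauses and splitting

falsify : ∀ {n} → Literal n → Functional (suc n) → Functional (suc n)
falsify (pos i) = fix (suc i) false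
falsify (neg i) = fix (suc i) true

falsifyAll : ∀ {n} → List (Literal n) → Functional (suc n) → Functional (suc n)
falsifyAll []       F = F
falsifyAll (l ∷ ls) F = falsify l (falsifyAll ls F)

falsifyAll-fix : ∀ {n} (ls : List (Literal n)) i b F → falsifyAll ls (fix i b F) ≗ fix i b (falsifyAll ls F)
falsifyAll-fix []           i b F S = refl
falsifyAll-fix (pos j ∷ ls) i b F S = trans (fix-cong (suc j) false (falsifyAll-fix ls i b F) S)
      (fix-comm (suc j) false i b (falsifyAll ls F) S)
falsifyAll-fix (neg j ∷ ls) i b F S = trans (fix-cong (suc j) true  (falsifyAll-fix ls i b F) S)
      (fix-comm (suc j) true  i b (falsifyAll ls F) S)

∣⁅i⁆∪S∣≤ : ∀ {m} (i : Fin m) S → ∣ ⁅ i ⁆ ∪ S ∣ ≤ suc ∣ S ∣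
∣⁅i⁆∪S∣≤ zero    (true  ∷ S) rewrite ∪-identityˡ S = n≤1+n _
∣⁅i⁆∪S∣≤ zero    (false ∷ S) rewrite ∪-identityˡ S = ≤-refl
∣⁅i⁆∪S∣≤ (suc i) (true  ∷ S) = s≤s (∣⁅i⁆∪S∣≤ i S)
∣⁅i⁆∪S∣≤ (suc i) (false ∷ S) = ∣⁅i⁆∪S∣≤ i S

∣S∪T∣≤ : ∀ {m} (S T : Subset m) → ∣ S ∪ T ∣ ≤ ∣ S ∣ + ∣ T ∣
∣S∪T∣≤ []          []          = z≤n
∣S∪T∣≤ (true  ∷ S) (true  ∷ T) = s≤s (≤-trans (∣S∪T∣≤ S T) (+-monoʳ-≤ ∣ S ∣ (n≤1+n _)))
∣S∪T∣≤ (true  ∷ S) (false ∷ T) = s≤s (∣S∪T∣≤ S T)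
∣S∪T∣≤ (false ∷ S) (true  ∷ T) = ≤-trans (s≤s (∣S∪T∣≤ S T)) (≤-reflexive (sym (+-suc ∣ S ∣ ∣ T ∣)))
∣S∪T∣≤ (false ∷ S) (false ∷ T) = ∣S∪T∣≤ S T

pick : ∀ {m} (S : Subset m) → 1 ≤ ∣ S ∣ →
      Σ[ i ∈ Fin m ] Σ[ R ∈ Subset m ] S ≡ ⁅ i ⁆ ∪ R × ∣ S ∣ ≡ suc ∣ R ∣ × lookup R i ≡ false
pick (true  ∷ S) _ = zero , false ∷ S , cong (true ∷_) (sym (∪-identityˡ S)) , refl , refl
pick (false ∷ S) s with i , R , eq , size , i∉R ← pick S s = suc i , false ∷ R , cong (false ∷_) eq , size , i∉R

∣S∣≡0 : ∀ {m} (S : Subset m) → ∣ S ∣ ≡ 0 → S ≡ ⊥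
∣S∣≡0 []          _  = refl
∣S∣≡0 (false ∷ S) eq = cong (false ∷_) (∣S∣≡0 S eq)

NonzeroAt : ∀ {m} → ℕ → Functional m → Set
NonzeroAt {m} ℓ F = Σ[ S ∈ Subset m ] ∣ S ∣ ≤ ℓ × F S ≡ 𝟙

nonzeroAt? : ∀ {m} ℓ (F : Functional m) → Dec (NonzeroAt ℓ F)
nonzeroAt? ℓ F = anySubset? (λ S → (∣ S ∣ ≤? ℓ) ×-dec (F S ≟ᵇ 𝟙))

≢𝟙⇒≡𝟘 : ∀ {x : 𝔽₂} → x ≢ 𝟙 → x ≡ 𝟘
≢𝟙⇒≡𝟘 {𝟘} _ = refl
≢𝟙⇒≡𝟘 {𝟙} n = contradiction refl n

vanishes : ∀ {m ℓ} {F : Functional m} → ¬ NonzeroAt ℓ F → ∀ S → ∣ S ∣ ≤ ℓ → F S ≡ 𝟘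
vanishes nz S S≤ = ≢𝟙⇒≡𝟘 (λ eq → nz (S , S≤ , eq))

-- The summand 3 reserves degree for the literals, so D bounds the degree of the whole product of
-- x^S with the clause indicator. Taking a cofactor involves S and S with one more element, which
-- costs one unit of D.
Annihilates : ∀ {n} → Formula n → ℕ → Functional (suc n) → Set
Annihilates {n} φ D F = ∀ {C} → C ∈ clauses φ → ∀ S → ∣ S ∣ + 3 ≤ D → falsifyAll (toList C) F S ≡ 𝟘

fix-annihilates : ∀ {n} {φ : Formula n} {D} i b F → Annihilates φ (suc D) F → Annihilates φ D (fix i b F)
fix-annihilates i b F ann {C} C∈ S S≤ =
  trans (falsifyAll-fix (toList C) i b F S)
        (fix-zero i b {falsifyAll (toList C) F} (ann C∈ S (≤-trans S≤ (n≤1+n _)))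
                      (ann C∈ (⁅ i ⁆ ∪ S) (≤-trans (+-monoˡ-≤ 3 (∣⁅i⁆∪S∣≤ i S)) (s≤s S≤))))

falsified : ∀ {n} (φ : Formula n) → ¬ Satisfiable φ → (a : Vec Bool n) →
            ∃[ C ] C ∈ clauses φ × All (λ l → literalValue a l ≡ false) (toList C)
falsified {n} φ unsat a
  with C , C∈ , ¬C ← find (¬All⇒Any¬ (VecAny.any? (λ l → literalValue a l ≟ᵇ true)) (clauses φ)
        (λ sat → unsat (a , sat))) =
  C , C∈ , allFalse C ¬C
  where
  allFalse : ∀ {k} (C : Vec (Literal n) k) → ¬ VecAny.Any (λ l → literalValue a l ≡ true) C →
             All (λ l → literalValue a l ≡ false) (toList C)
  allFalse []      _ = []
  allFalse (l ∷ C) n = ≢𝟙⇒≡𝟘 (λ eq → n (VecAny.here eq)) ∷ allFalse C (λ any → n (VecAny.there any))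

module _ {n : ℕ} (φ : Formula n) (unsat : ¬ Satisfiable φ) where

  -- If the cofactor xᵢ = not (bᵢ) vanishes for every i, then F is evaluation at b
  -- in low degree, and b falsifies a clause.
  splittable : ∀ {ℓ D} (F : Functional (suc n)) → 2 ≤ ℓ → 3 ≤ D → Annihilates φ D F → NonzeroAt (suc ℓ) F →
               (b : Fin (suc n) → Bool) → ¬ (∀ i S → ∣ S ∣ ≤ ℓ → fix i (not (b i)) F S ≡ 𝟘)
  splittable {ℓ} F 2≤ℓ 3≤D ann (S₀ , S₀≤ , FS₀) b vanish =
    contradiction (trans (sym (descend _ S₀ refl S₀≤ FS₀))
                    (trans (sym (agreeAll (toList C) allFalse ⊥ small))
                           (ann C∈ ⊥ (≤-trans (≤-reflexive (cong (_+ 3) (∣⊥∣≡0 (suc n)))) 3≤D)))) (λ ())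
    where
    agree : ∀ i S → ∣ S ∣ ≤ ℓ → fix i (b i) F S ≡ F S
    agree i S S≤ =
      trans (sym (xor-identityʳ _)) (trans (cong (fix i (b i) F S xor_) (sym (vanish i S S≤)))
            (fix-partition i (b i) F S))

    -- Agreement with the cofactor at bᵢ means F(xᵢ x^R) = bᵢ F(x^R) for |R| ≤ ℓ. A value 1 is
    -- therefore inherited by subsets, down to F(1) = 1. The clause falsified by b forces F(1) = 0.
    descend : ∀ k S → ∣ S ∣ ≡ k → ∣ S ∣ ≤ suc ℓ → F S ≡ 𝟙 → F ⊥ ≡ 𝟙
    descend zero    S size S≤ FS = subst (λ R → F R ≡ 𝟙) (∣S∣≡0 S size) FS
    descend (suc k) S size S≤ FS
      with i , R , S≡ , sizeR , _ ← pick S (≤-trans (s≤s z≤n) (≤-reflexive (sym size))) =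
      descend k R (suc-injective (trans (sym sizeR) size)) (≤-trans R≤ (n≤1+n ℓ))
              (remove (b i) (agree i R R≤) (trans (cong F (sym S≡)) FS))
      where
      R≤ : ∣ R ∣ ≤ ℓ
      R≤ = s≤s⁻¹ (≤-trans (≤-reflexive (sym sizeR)) S≤)
      remove : ∀ c → fix i c F R ≡ F R → F (⁅ i ⁆ ∪ R) ≡ 𝟙 → F R ≡ 𝟙
      remove true  eq FiR = trans (sym eq) FiR
      remove false eq FiR with F R | F (⁅ i ⁆ ∪ R)
      remove false ()  refl | 𝟘 | 𝟙
      remove false eq FiR | 𝟙 | _ = refl

    a : Vec Bool n
    a = tabulate (b ∘ suc)

    fix-agree : ∀ i c {F′ : Functional (suc n)} S → b i ≡ c → ∣ S ∣ ≤ ℓ → F′ S ≡ F S → F′ (⁅ i ⁆ ∪ S) ≡ F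
          (⁅ i ⁆ ∪ S) →
                fix i c F′ S ≡ F S
    fix-agree i c {F′} S refl S≤ eq eqᵢ = trans (local (b i)) (agree i S S≤)
      where
      local : ∀ c → fix i c F′ S ≡ fix i c F S
      local true  = eqᵢ
      local false = cong₂ _xor_ eq eqᵢ

    agreeAll : ∀ ls → All (λ l → literalValue a l ≡ false) ls → ∀ S → ∣ S ∣ + length ls ≤ suc ℓ →
          falsifyAll ls F S ≡ F S
    agreeAll []       []       S S≤ = refl
    agreeAll (l ∷ ls) (v ∷ vs) S S≤ = agreeLiteral l v
      where
      S≤′ : suc (∣ S ∣ + length ls) ≤ suc ℓ
      S≤′ = ≤-trans (≤-reflexive (sym (+-suc ∣ S ∣ (length ls)))) S≤
      fixed : ∀ i c → b i ≡ c → fix i c (falsifyAll ls F) S ≡ F S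
      fixed i c bi = fix-agree i c S bi (≤-trans (m≤m+n ∣ S ∣ (length ls)) (s≤s⁻¹ S≤′))
        (agreeAll ls vs S (≤-trans (n≤1+n _) S≤′))
        (agreeAll ls vs (⁅ i ⁆ ∪ S) (≤-trans (+-monoˡ-≤ (length ls) (∣⁅i⁆∪S∣≤ i S)) S≤′))
      agreeLiteral : ∀ l → literalValue a l ≡ false → falsify l (falsifyAll ls F) S ≡ F S
      agreeLiteral (pos i) v = fixed (suc i) false (trans (sym (lookup∘tabulate (b ∘ suc) i)) v)
      agreeLiteral (neg i) v = fixed (suc i) true  (trans (sym (lookup∘tabulate (b ∘ suc) i)) (not-injective v))

    clause = falsified φ unsat a
    C = proj₁ clause
    C∈ = proj₁ (proj₂ clause)
    allFalse = proj₂ (proj₂ clause)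

    -- Here ℓ ≥ 2 enters: the indicator of a clause has degree up to 3, and F is known to be
    -- evaluation at b only up to degree ℓ + 1.
    small : ∣ ⊥ {suc n} ∣ + length (toList C) ≤ suc ℓ
    small = ≤-trans (≤-reflexive (cong₂ _+_ (∣⊥∣≡0 (suc n)) (length-toList C))) (s≤s 2≤ℓ)

  -- If no coordinate splits, each i has a value bᵢ whose opposite cofactor vanishes in degree ℓ,
  -- and `splittable` refutes this. Finite search over coordinates and subsets makes the case
  -- distinction constructive.
  split : ∀ {ℓ D} (F : Functional (suc n)) → 2 ≤ ℓ → 3 ≤ D → Annihilates φ D F → NonzeroAt (suc ℓ) F →
          ∃[ i ] ∀ b → NonzeroAt ℓ (fix i b F)
  split {ℓ} F 2≤ℓ 3≤D ann nz
    with any? (λ i → nonzeroAt? ℓ (fix i true F) ×-dec nonzeroAt? ℓ (fix i false F))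
  ... | yes (i , nz₁ , nz₀) = i , λ { true → nz₁ ; false → nz₀ }
  ... | no none = ⊥-elim (splittable F 2≤ℓ 3≤D ann nz (λ i → proj₁ (cofactor i))
        (λ i → vanishes (proj₂ (cofactor i))))
    where
    cofactor : ∀ i → ∃[ b ] ¬ NonzeroAt ℓ (fix i (not b) F)
    cofactor i with nonzeroAt? ℓ (fix i true F)
    ... | yes nz₁ = true , λ nz₀ → none (i , nz₁ , nz₀)
    ... | no ¬nz₁ = false , ¬nz₁

  -- The leaves of a binary tree of depth k of restrictions.
  record Leaves (k ℓ : ℕ) (F : Functional (suc n)) : Set where
    field
      path      : Vec Bool k → Path (suc n)
      monomial  : Vec Bool k → Subset (suc n)
      depth     : ∀ w → length (path w) ≡ k
      degree    : ∀ w → ∣ monomial w ∣ ≤ ℓ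
      nonzero   : ∀ w → restrict (path w) F (monomial w) ≡ 𝟙
      disjoint  : ∀ {w v} → w ≢ v → ∀ G S → restrict (path w) (restrict (path v) G) S ≡ 𝟘

  open Leaves

  -- Each level spends one degree of the annihilation and one of the nonzero monomial. Different
  -- words part at some node, so their paths contain opposite values of its coordinate; restrictions
  -- commute, and bringing the two together kills every functional, not only F.
  leaves : ∀ k {ℓ} F → 2 ≤ ℓ → Annihilates φ (k + 3) F → NonzeroAt (k + ℓ) F → Leaves k ℓ F
  leaves zero F 2≤ℓ ann (S , S≤ , FS) = record
    { path = λ _ → [] ; monomial = λ _ → S ; depth = λ _ → refl ; degree = λ _ → S≤ ; nonzero = λ _ → FS
    ; disjoint = λ { {[]} {[]} w≢v → contradiction refl w≢v } }
  leaves (suc k) {ℓ} F 2≤ℓ ann nz = record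
    { path     = λ { (b ∷ w) → (i , b) ∷ path (sub b) w }
    ; monomial = λ { (b ∷ w) → monomial (sub b) w }
    ; depth    = λ { (b ∷ w) → cong suc (depth (sub b) w) }
    ; degree   = λ { (b ∷ w) → degree (sub b) w }
    ; nonzero  = λ { (b ∷ w) → nonzero (sub b) w }
    ; disjoint = λ { {b ∷ w} {c ∷ v} w≢v G S → disjoint′ b c w v w≢v G S } }
    where
    branching : ∃[ i ] ∀ b → NonzeroAt (k + ℓ) (fix i b F)
    branching = split F (≤-trans 2≤ℓ (m≤n+m ℓ k)) (≤-trans (m≤n+m 3 k) (n≤1+n _)) ann nz
    i = proj₁ branching
    sub : ∀ b → Leaves k ℓ (fix i b F)
    sub b = leaves k (fix i b F) 2≤ℓ (fix-annihilates {φ = φ} i b F ann) (proj₂ branching b)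
    commute : ∀ b c w v G S → restrict (path (sub b) w) (fix i b (restrict (path (sub c) v) (fix i c G))) S
              ≡ restrict (path (sub b) w) (restrict (path (sub c) v) (fix i b (fix i c G))) S
    commute b c w v G S = restrict-cong (path (sub b) w) (fix-restrict i b (path (sub c) v) (fix i c G)) S
    conflicting : ∀ b w v G S → restrict (path (sub b) w)
          (restrict (path (sub (not b)) v) (fix i b (fix i (not b) G))) S ≡ 𝟘
    conflicting b w v G =
      restrict-zero (path (sub b) w) (restrict-zero (path (sub (not b)) v) (fix-conflict i b G))
    disjoint′ : ∀ b c w v → (b ∷ w) ≢ (c ∷ v) → ∀ G S →
      restrict (path (sub b) w) (fix i b (restrict (path (sub c) v) (fix i c G))) S ≡ 𝟘
    disjoint′ true  false w v _   G S = trans (commute true false w v G S) (conflicting true w v G S)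
    disjoint′ false true  w v _   G S = trans (commute false true w v G S) (conflicting false w v G S)
    disjoint′ true  true  w v w≢v G S = trans (commute true true w v G S)  
          (disjoint (sub true)  (λ eq → w≢v (cong (true ∷_) eq)) _ S)
    disjoint′ false false w v w≢v G S = trans (commute false false w v G S)
          (disjoint (sub false) (λ eq → w≢v (cong (false ∷_) eq)) _ S)

-- Superposition

sum-cong : ∀ {t} {f g : Fin t → 𝔽₂} → f ≗ g → sum f ≡ sum g
sum-cong = 𝔽₂-sum.sum-cong-≗

sum-zero : ∀ {t} {f : Fin t → 𝔽₂} → (∀ i → f i ≡ 𝟘) → sum f ≡ 𝟘
sum-zero {t} z = trans (sum-cong z) (𝔽₂-sum.sum-replicate-zero t)

sum-single : ∀ {t} {f : Fin t → 𝔽₂} (j : Fin t) → (∀ i → i ≢ j → f i ≡ 𝟘) → sum f ≡ f j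
sum-single {f = f} zero    z = trans (cong (f zero xor_) (sum-zero (λ i → z (suc i) (λ ())))) (xor-identityʳ _)
sum-single {f = f} (suc j) z =
  cong₂ _xor_ (z zero (λ ())) (sum-single j (λ i i≢j → z (suc i) (λ { refl → i≢j refl })))

module _ {r : ℕ} where
  open Inverse 2↔Bool using (to; from; strictlyInverseˡ; strictlyInverseʳ)

  number : (Fin r → Bool) → Fin (2 ^ r)
  number f = funToFin (from ∘ f)

  digits : Fin (2 ^ r) → Fin r → Bool
  digits x i = to (finToFun x i)

  digits-number : ∀ f → digits (number f) ≗ f
  digits-number f i = trans (cong to (finToFun-funToFin (from ∘ f) i)) (strictlyInverseˡ (f i))

  digits-injective : ∀ {x y} → digits x ≗ digits y → x ≡ y
  digits-injective {x} {y} eq =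
    trans (sym (funToFin-finToFin {r} {2} x))
          (trans (funToFin-cong (λ i → trans (sym (strictlyInverseʳ _))
                (trans (cong from (eq i)) (strictlyInverseʳ _))))
                 (funToFin-finToFin {r} {2} y))
    where
    funToFin-cong : ∀ {m n} {f g : Fin m → Fin n} → f ≗ g → funToFin f ≡ funToFin g
    funToFin-cong {zero}  eq = refl
    funToFin-cong {suc m} eq = cong₂ combine (eq zero) (funToFin-cong (eq ∘ suc))

word : ∀ k → Fin (2 ^ k) → Vec Bool k
word k x = tabulate (digits x)

word-injective : ∀ k {x y} → word k x ≡ word k y → x ≡ y
word-injective k {x} {y} eq = digits-injective λ i →
  trans (sym (lookup∘tabulate (digits x) i)) (trans (cong (λ w → lookup w i) eq) (lookup∘tabulate (digits y) i))

-- The r vectors u are linearly independent, so they have 2^r distinct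
-- combinations in 𝔽₂^t.
biorthogonal⇒≤ : ∀ {r t} (u v : Fin r → Fin t → 𝔽₂) →
  (∀ a → sum (λ i → u a i ∧ v a i) ≡ 𝟙) → (∀ {a b} → a ≢ b → sum (λ i → u a i ∧ v b i) ≡ 𝟘) → r ≤ t
biorthogonal⇒≤ {r} {t} u v diagonal offDiagonal =
  ≮⇒≥ (λ t<r → <⇒≱ (^-monoʳ-< 2 (s≤s (s≤s z≤n)) t<r)
        (injective⇒≤ {f = number ∘ combination ∘ digits} injective))
  where
  combination : (Fin r → 𝔽₂) → Fin t → 𝔽₂
  combination c i = sum (λ a → c a ∧ u a i)
  -- Pairing with the dual vector v_b reads off the coefficient of u_b, so a combination determines
  -- its coefficients.
  coefficient : ∀ c b → sum (λ i → combination c i ∧ v b i) ≡ c b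
  coefficient c b = begin
    sum (λ i → combination c i ∧ v b i)
      ≡⟨ sum-cong (λ i → 𝔽₂-product.*-distribʳ-sum (v b i) (λ a → c a ∧ u a i)) ⟩
    sum (λ i → sum (λ a → (c a ∧ u a i) ∧ v b i))   ≡⟨ 𝔽₂-sum.∑-comm (λ i a → (c a ∧ u a i) ∧ v b i) ⟩
    sum (λ a → sum (λ i → (c a ∧ u a i) ∧ v b i))   ≡⟨ sum-cong
          (λ a → sum-cong (λ i → ∧-assoc (c a) (u a i) (v b i))) ⟩
    sum (λ a → sum (λ i → c a ∧ (u a i ∧ v b i)))
      ≡⟨ sum-cong (λ a → sym (𝔽₂-product.*-distribˡ-sum (c a) (λ i → u a i ∧ v b i))) ⟩
    sum (λ a → c a ∧ sum (λ i → u a i ∧ v b i))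
      ≡⟨ sum-single b (λ a a≢b → trans (cong (c a ∧_) (offDiagonal a≢b)) (∧-zeroʳ (c a))) ⟩
    c b ∧ sum (λ i → u b i ∧ v b i)                 ≡⟨ cong (c b ∧_) (diagonal b) ⟩
    c b ∧ 𝟙                                         ≡⟨ ∧-identityʳ (c b) ⟩
    c b                                             ∎
    where open ≡-Reasoning
  injective : ∀ {x y} → number (combination (digits x)) ≡ number (combination (digits y)) → x ≡ y
  injective {x} {y} eq = digits-injective λ b →
    trans (sym (coefficient (digits x) b))
      (trans (sum-cong (λ i → cong (_∧ v b i)
               (trans (sym (digits-number (combination (digits x)) i))
                 (trans (cong (λ z → digits z i) eq) (digits-number (combination (digits y)) i)))))
             (coefficient (digits y) b))

word-biorthogonal⇒≤ : ∀ k {t} (u v : Vec Bool k → Fin t → 𝔽₂) →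
  (∀ w → sum (λ i → u w i ∧ v w i) ≡ 𝟙) → (∀ {w x} → w ≢ x → sum (λ i → u w i ∧ v x i) ≡ 𝟘) → 2 ^ k ≤ t
word-biorthogonal⇒≤ k u v diagonal offDiagonal =
  biorthogonal⇒≤ (u ∘ word k) (v ∘ word k) (diagonal ∘ word k) (λ a≢b → offDiagonal (a≢b ∘ word-injective k))

module _ {m t : ℕ} where

  -- Two families are allowed because the two arguments of a product will be restricted along
  -- different paths. Degree is measured by |A| + |B|, not |A ∪ B|, so that the cost of enlarging
  -- either argument is additive. Only nonempty sets are variables, hence the lower bounds.
  Factors : ℕ → (θ η : Fin t → Functional m) → Functional m → Set
  Factors D θ η G = ∀ A B → 1 ≤ ∣ A ∣ → 1 ≤ ∣ B ∣ → ∣ A ∣ + ∣ B ∣ ≤ D → sum (λ i → θ i A ∧ η i B) ≡ G (A ∪ B)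

  Factors-sym : ∀ {D θ η G} → Factors D θ η G → Factors D η θ G
  Factors-sym {D} {θ} {η} {G} f A B 1≤A 1≤B ≤D =
    trans (sum-cong (λ i → ∧-comm (η i A) (θ i B)))
      (trans (f B A 1≤B 1≤A (≤-trans (≤-reflexive (+-comm ∣ B ∣ ∣ A ∣)) ≤D)) (cong G (∪-comm B A)))

  -- By bilinearity the indicator of x_j = b may be multiplied into the left argument alone, and
  -- associativity of union carries it over to G. The enlarged argument costs one degree.
  Factors-fix : ∀ {D θ η G} j b → Factors (suc D) θ η G → Factors D (fix j b ∘ θ) η (fix j b G)
  Factors-fix {D} {θ} {η} {G} j b f A B 1≤A 1≤B ≤D = cases b
    where
    enlarged : sum (λ i → θ i (⁅ j ⁆ ∪ A) ∧ η i B) ≡ G (⁅ j ⁆ ∪ (A ∪ B))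
    enlarged = trans
      (f (⁅ j ⁆ ∪ A) B (≤-trans (≤-reflexive (sym (∣⁅x⁆∣≡1 j))) (∣p∣≤∣p∪q∣ ⁅ j ⁆ A)) 1≤B
         (≤-trans (+-monoˡ-≤ ∣ B ∣ (∣⁅i⁆∪S∣≤ j A)) (s≤s ≤D)))
      (cong G (∪-assoc ⁅ j ⁆ A B))
    cases : ∀ b → sum (λ i → fix j b (θ i) A ∧ η i B) ≡ fix j b G (A ∪ B)
    cases true  = enlarged
    cases false = trans (sum-cong (λ i → ∧-distribʳ-xor (η i B) (θ i A) (θ i (⁅ j ⁆ ∪ A))))
      (trans (𝔽₂-sum.∑-distrib-+ (λ i → θ i A ∧ η i B) (λ i → θ i (⁅ j ⁆ ∪ A) ∧ η i B))
             (cong₂ _xor_ (f A B 1≤A 1≤B (≤-trans ≤D (n≤1+n D))) enlarged))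

  Factors-restrict : ∀ {D θ η G} p → Factors (length p + D) θ η G → Factors D (restrict p ∘ θ) η (restrict p G)
  Factors-restrict []            f = f
  Factors-restrict {D} {θ} {η} {G} ((j , b) ∷ p) f = Factors-restrict p (Factors-fix {θ = θ} {η} {G} j b f)

-- S contains k disjoint pairs; left and right split S, and the word w decides
-- which element of each pair goes to the left.
record Splits {m} (k : ℕ) (S : Subset m) : Set where
  field
    left right    : Vec Bool k → Subset m
    cover         : ∀ w → left w ∪ right w ≡ S
    cross         : ∀ {w v} → w ≢ v → ∣ left w ∪ right v ∣ < ∣ S ∣
    inside        : ∀ w v → ∣ left w ∪ right v ∣ ≤ ∣ S ∣
    left-inhabited  : 1 ≤ k → ∀ w → 1 ≤ ∣ left w ∣
    right-inhabited : 1 ≤ k → ∀ w → 1 ≤ ∣ right w ∣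

open Splits

-- Where two words differ at a pair, left w and right v contain the same element of it and both miss
-- the other, so their union is a proper subset of S. The elements outside the pairs all go to the
-- right.
splits : ∀ {m} k (S : Subset m) → 2 * k ≤ ∣ S ∣ → Splits k S
splits zero S _ = record
  { left = λ _ → ⊥ ; right = λ _ → S ; cover = λ _ → ∪-identityˡ S
  ; cross = λ { {[]} {[]} w≢v → contradiction refl w≢v }
  ; inside = λ _ _ → ≤-reflexive (cong ∣_∣ (∪-identityˡ S))
  ; left-inhabited = λ () ; right-inhabited = λ () }
splits {m} (suc k) S 2k≤ = result
  (pick S (≤-trans (s≤s z≤n) 2k≤))
  where
  result : Σ[ i ∈ Fin m ] Σ[ R ∈ Subset m ] S ≡ ⁅ i ⁆ ∪ R × ∣ S ∣ ≡ suc ∣ R ∣ × lookup R i ≡ false →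
        Splits (suc k) S
  result (p , R , S≡ , sizeS , _) with pick R
        (s≤s⁻¹ (≤-trans (s≤s (≤-trans (s≤s z≤n) (m≤n+m (suc (k + 0)) k))) (≤-trans 2k≤ (≤-reflexive sizeS))))
  ... | q , R′ , R≡ , sizeR , _ = record
    { left   = λ { (b ∷ w) → single b ∪ left sub w }
    ; right  = λ { (b ∷ w) → single (not b) ∪ right sub w }
    ; cover  = λ { (true  ∷ w) → trans (exchange p q w w)
          (trans (cong (λ T → ⁅ p ⁆ ∪ (⁅ q ⁆ ∪ T)) (cover sub w)) (sym S≡′))
                 ; (false ∷ w) → trans (exchange q p w w)
                       (trans (∪-swap ⁅ q ⁆ ⁅ p ⁆ _) (trans (cong (λ T → ⁅ p ⁆ ∪ (⁅ q ⁆ ∪ T)) (cover sub w))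
                       (sym S≡′))) }
    ; cross  = λ { {true  ∷ w} {true  ∷ v} w≢v → different p q w v (cross sub (w≢v ∘ cong (true ∷_)))
                 ; {false ∷ w} {false ∷ v} w≢v → different q p w v (cross sub (w≢v ∘ cong (false ∷_)))
                 ; {true  ∷ w} {false ∷ v} _   → same p w v
                 ; {false ∷ w} {true  ∷ v} _   → same q w v }
    ; inside = λ { (true  ∷ w) (true  ∷ v) → both p q w v
                 ; (false ∷ w) (false ∷ v) → both q p w v
                 ; (true  ∷ w) (false ∷ v) → <⇒≤ (same p w v)
                 ; (false ∷ w) (true  ∷ v) → <⇒≤ (same q w v) }
    ; left-inhabited  = λ { _ (b ∷ w) → inhabited (single b) (single≡1 b) }
    ; right-inhabited = λ { _ (b ∷ w) → inhabited (single (not b)) (single≡1 (not b)) } }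
    where
    S≡′ : S ≡ ⁅ p ⁆ ∪ (⁅ q ⁆ ∪ R′)
    S≡′ = trans S≡ (cong (⁅ p ⁆ ∪_) R≡)
    sizeS′ : ∣ S ∣ ≡ suc (suc ∣ R′ ∣)
    sizeS′ = trans sizeS (cong suc sizeR)
    sub : Splits k R′
    sub = splits k R′ (s≤s⁻¹ (s≤s⁻¹
          (≤-trans (≤-reflexive (solve 1 (λ k → con 2 :+ con 2 :* k ⊜ con 2 :* (con 1 :+ k)) refl k))
                                             (≤-trans 2k≤ (≤-reflexive sizeS′)))))
    single : Bool → Subset m
    single true  = ⁅ p ⁆
    single false = ⁅ q ⁆
    single≡1 : ∀ b → ∣ single b ∣ ≡ 1
    single≡1 true  = ∣⁅x⁆∣≡1 p
    single≡1 false = ∣⁅x⁆∣≡1 q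
    inhabited : ∀ A {B : Subset m} → ∣ A ∣ ≡ 1 → 1 ≤ ∣ A ∪ B ∣
    inhabited A {B} eq = ≤-trans (≤-reflexive (sym eq)) (∣p∣≤∣p∪q∣ A B)
    exchange : ∀ x y w v → (⁅ x ⁆ ∪ left sub w) ∪ (⁅ y ⁆ ∪ right sub v) ≡ ⁅ x ⁆ ∪ (⁅ y ⁆ ∪ (left sub w ∪ right sub v))
    exchange x y w v = trans (∪-assoc ⁅ x ⁆ (left sub w) _)
          (cong (⁅ x ⁆ ∪_) (∪-swap (left sub w) ⁅ y ⁆ (right sub v)))
    both : ∀ x y w v → ∣ (⁅ x ⁆ ∪ left sub w) ∪ (⁅ y ⁆ ∪ right sub v) ∣ ≤ ∣ S ∣
    both x y w v = ≤-trans (≤-reflexive (cong ∣_∣ (exchange x y w v)))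
      (≤-trans (∣⁅i⁆∪S∣≤ x _) (≤-trans (s≤s (≤-trans (∣⁅i⁆∪S∣≤ y _) (s≤s (inside sub w v))))
            (≤-reflexive (sym sizeS′))))
    different : ∀ x y w v → ∣ left sub w ∪ right sub v ∣ < ∣ R′ ∣ →
          ∣ (⁅ x ⁆ ∪ left sub w) ∪ (⁅ y ⁆ ∪ right sub v) ∣ < ∣ S ∣
    different x y w v lt = ≤-trans (s≤s (≤-reflexive (cong ∣_∣ (exchange x y w v))))
      (≤-trans (s≤s (∣⁅i⁆∪S∣≤ x _)) (≤-trans (s≤s (s≤s (≤-trans (∣⁅i⁆∪S∣≤ y _) lt)))
            (≤-reflexive (sym sizeS′))))
    same : ∀ x w v → ∣ (⁅ x ⁆ ∪ left sub w) ∪ (⁅ x ⁆ ∪ right sub v) ∣ < ∣ S ∣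
    same x w v = ≤-trans (s≤s (≤-reflexive (cong ∣_∣ (trans (exchange x x w v) (∪-absorb ⁅ x ⁆ _)))))
      (≤-trans (s≤s (≤-trans (∣⁅i⁆∪S∣≤ x _) (s≤s (inside sub w v)))) (≤-reflexive (sym sizeS′)))

module _ {n k t : ℕ} (2≤k : 2 ≤ k) (φ : Formula n) (unsat : ¬ Satisfiable φ)
  (θ : Fin t → Functional (suc n)) (F : Functional (suc n))
  (homogeneous : ∀ S → 1 ≤ ∣ S ∣ → ∣ S ∣ < 4 * k → F S ≡ F (⁅ zero ⁆ ∪ S))
  (annihilated : ∀ {C} → C ∈ clauses φ → ∀ S → ∣ S ∣ + 4 ≤ 4 * k → falsifyAll (toList C) F (⁅ zero ⁆ ∪ S) ≡ 𝟘)
  (factors : ∀ A B → 1 ≤ ∣ A ∣ → 1 ≤ ∣ B ∣ → ∣ A ∪ B ∣ ≤ 4 * k → sum (λ i → θ i A ∧ θ i B) ≡ F (A ∪ B))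
  where
  private
    leavesOf : NonzeroAt (k + k) (fix zero true F) → Leaves φ unsat k k (fix zero true F)
    leavesOf = leaves φ unsat k (fix zero true F) 2≤k
      (λ {C} C∈ S S≤ → trans (falsifyAll-fix (toList C) zero true F S) (annihilated C∈ S (bound S S≤)))
      where
      bound : ∀ S → ∣ S ∣ + 3 ≤ k + 3 → ∣ S ∣ + 4 ≤ 4 * k
      bound S S≤ = begin
        ∣ S ∣ + 4       ≡⟨ +-suc ∣ S ∣ 3 ⟩
        suc (∣ S ∣ + 3) ≤⟨ s≤s S≤ ⟩
        suc (k + 3)     ≡⟨ sym (+-suc k 3) ⟩
        k + 2 * 2       ≤⟨ +-monoʳ-≤ k (*-monoʳ-≤ 2 2≤k) ⟩
        k + 2 * k       ≤⟨ m≤m+n (k + 2 * k) k ⟩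
        k + 2 * k + k   ≡⟨ solve 1 (λ k → k :+ con 2 :* k :+ k ⊜ con 4 :* k) refl k ⟩
        4 * k           ∎
        where open ≤-Reasoning

  -- For a leaf w with indicator I_w and monomial M_w, take u_w = x₀ I_w and v_w = x₀ I_w M_w.
  -- Indicators are idempotent, so the diagonal pairing is the nonzero value at the leaf; indicators
  -- of different leaves multiply to zero. The factor x₀ keeps both arguments of the product
  -- constraint nonempty and replaces F by x₀F.
  low-degree : NonzeroAt (k + k) (fix zero true F) → 2 ^ k ≤ t
  low-degree nz = word-biorthogonal⇒≤ k
    (λ w i → restrict (path w) (θ i) ⁅ zero ⁆) (λ w i → restrict (path w) (θ i) (⁅ zero ⁆ ∪ monomial w))
    (λ w → trans (pairing w w) (trans (restrict-idem (path w) F _)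
             (trans (fix-restrict zero true (path w) F (monomial w)) (nonzero w))))
    (λ {w} {v} w≢v → trans (pairing w v) (disjoint (w≢v ∘ sym) F _))
    where
    open Leaves (leavesOf nz)
    pairing : ∀ w v → sum (λ i → restrict (path w) (θ i) ⁅ zero ⁆ ∧ restrict (path v) (θ i)
          (⁅ zero ⁆ ∪ monomial v))
              ≡ restrict (path v) (restrict (path w) F) (⁅ zero ⁆ ∪ monomial v)
    pairing w v = trans (restricted ⁅ zero ⁆ (⁅ zero ⁆ ∪ monomial v)
        (≤-reflexive (sym (∣⁅x⁆∣≡1 {suc n} zero)))
        (≤-trans (≤-reflexive (sym (∣⁅x⁆∣≡1 {suc n} zero))) (∣p∣≤∣p∪q∣ ⁅ zero ⁆ (monomial v)))
        (+-mono-≤ (≤-reflexive (∣⁅x⁆∣≡1 {suc n} zero)) (≤-trans (∣⁅i⁆∪S∣≤ zero (monomial v)) (s≤s (degree v)))))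
      (cong (restrict (path v) (restrict (path w) F)) (∪-absorb ⁅ zero ⁆ (monomial v)))
      where
      bound : length (path w) + (length (path v) + (2 + k)) ≤ 4 * k
      bound = begin
        length (path w) + (length (path v) + (2 + k)) ≡⟨ cong₂ (λ a b → a + (b + (2 + k))) (depth w) (depth v) ⟩
        k + (k + (2 + k))                             ≤⟨ +-monoʳ-≤ k (+-monoʳ-≤ k (+-monoˡ-≤ k 2≤k)) ⟩
        k + (k + (k + k))                             ≡⟨ solve 1
              (λ k → k :+ (k :+ (k :+ k)) ⊜ con 4 :* k) refl k ⟩
        4 * k                                         ∎
        where open ≤-Reasoning
      base : Factors (length (path w) + (length (path v) + (2 + k))) θ θ F
      base A B 1≤A 1≤B ≤D = factors A B 1≤A 1≤B (≤-trans (∣S∪T∣≤ A B) (≤-trans ≤D bound))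
      restricted : Factors (2 + k) (restrict (path w) ∘ θ) (restrict (path v) ∘ θ)
            (restrict (path v) (restrict (path w) F))
      restricted = Factors-sym {θ = restrict (path v) ∘ θ} {restrict (path w) ∘ θ} {restrict (path v)
            (restrict (path w) F)}
        (Factors-restrict {θ = θ} {restrict (path w) ∘ θ} {restrict (path w) F} (path v)
          (Factors-sym {θ = restrict (path w) ∘ θ} {θ} {restrict (path w) F}
            (Factors-restrict {θ = θ} {θ} {F} (path w) base)))

  high-degree : ∀ S → 2 * k ≤ ∣ S ∣ → ∣ S ∣ ≤ 4 * k → F S ≡ 𝟙 →
                (∀ R → 1 ≤ ∣ R ∣ → ∣ R ∣ < ∣ S ∣ → F R ≡ 𝟘) → 2 ^ k ≤ t
  high-degree S 2k≤ S≤ FS smaller = word-biorthogonal⇒≤ k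
    (λ w i → θ i (left sp w)) (λ w i → θ i (right sp w))
    (λ w → trans (pairing w w) (trans (cong F (cover sp w)) FS))
    (λ {w} {v} w≢v → trans (pairing w v)
      (smaller _ (≤-trans (left-inhabited sp 1≤k w) (∣p∣≤∣p∪q∣ (left sp w) (right sp v))) (cross sp w≢v)))
    where
    sp = splits k S 2k≤
    1≤k : 1 ≤ k
    1≤k = ≤-trans (s≤s z≤n) 2≤k
    pairing : ∀ w v → sum (λ i → θ i (left sp w) ∧ θ i (right sp v)) ≡ F (left sp w ∪ right sp v)
    pairing w v = factors _ _ (left-inhabited sp 1≤k w) (right-inhabited sp 1≤k v) (≤-trans (inside sp w v) S≤)

  vanishing : t < 2 ^ k → ∀ S → 1 ≤ ∣ S ∣ → ∣ S ∣ ≤ 4 * k → F S ≡ 𝟘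
  -- Strong induction on the size supplies the minimality of S: all smaller nonempty sets are
  -- already known to have value 0.
  vanishing t<2^k S = <-rec P step ∣ S ∣ S refl
    where
    P : ℕ → Set
    P s = ∀ S → ∣ S ∣ ≡ s → 1 ≤ ∣ S ∣ → ∣ S ∣ ≤ 4 * k → F S ≡ 𝟘
    step : ∀ s → (∀ {r} → r < s → P r) → P s
    step s ih S refl 1≤S S≤ = ≢𝟙⇒≡𝟘 λ FS → <⇒≱ t<2^k (dimension FS)
      where
      dimension : F S ≡ 𝟙 → 2 ^ k ≤ t
      dimension FS with 2 * k ≤? ∣ S ∣
      ... | yes 2k≤S = high-degree S 2k≤S S≤ FS (λ R 1≤R R<S → ih R<S R refl 1≤R (≤-trans (<⇒≤ R<S) S≤))
      -- Homogeneity moves the value 1 from F to x₀F; it applies because S is nonempty and of size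
      -- below d.
      ... | no  2k≰S = low-degree (S , S≤k+k , trans (sym (homogeneous S 1≤S S<4k)) FS)
        where
        S<2k : ∣ S ∣ < 2 * k
        S<2k = ≰⇒> 2k≰S
        S<4k : ∣ S ∣ < 4 * k
        S<4k = ≤-trans S<2k (*-monoˡ-≤ k (≤ᵇ⇒≤ 2 4 _))
        S≤k+k : ∣ S ∣ ≤ k + k
        S≤k+k = ≤-trans (<⇒≤ S<2k) (≤-reflexive (cong (k +_) (+-identityʳ k)))

-- Evaluation at points

sumOver-cong : ∀ {A : Set} {f g : A → 𝔽₂} (xs : List A) → (∀ x → f x ≡ g x) → sumOver xs f ≡ sumOver xs g
sumOver-cong []       eq = refl
sumOver-cong (x ∷ xs) eq = cong₂ _xor_ (eq x) (sumOver-cong xs eq)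

sumOver-++ : ∀ {A : Set} (f : A → 𝔽₂) (xs ys : List A) → sumOver (xs ++ ys) f ≡ sumOver xs f xor sumOver ys f
sumOver-++ f []       ys = refl
sumOver-++ f (x ∷ xs) ys = trans (cong (f x xor_) (sumOver-++ f xs ys)) (sym (xor-assoc (f x) _ _))

sumOver-map : ∀ {A B : Set} (g : A → B) (f : B → 𝔽₂) xs → sumOver (map g xs) f ≡ sumOver xs (f ∘ g)
sumOver-map g f []       = refl
sumOver-map g f (x ∷ xs) = cong (f (g x) xor_) (sumOver-map g f xs)

sumOver-map-All : ∀ {A B : Set} {P : A → Set} {f : B → 𝔽₂} {h : A → 𝔽₂} (g : A → B) →
      (∀ {x} → P x → f (g x) ≡ h x) →
                  ∀ {xs} → All P xs → sumOver (map g xs) f ≡ sumOver xs h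
sumOver-map-All g eq []       = refl
sumOver-map-All g eq (p ∷ ps) = cong₂ _xor_ (eq p) (sumOver-map-All g eq ps)

sumOver-zero : ∀ {A : Set} (xs : List A) → sumOver xs (λ _ → 𝟘) ≡ 𝟘
sumOver-zero []       = refl
sumOver-zero (x ∷ xs) = sumOver-zero xs

sumOver-xor : ∀ {A : Set} (f g : A → 𝔽₂) xs → sumOver xs (λ x → f x xor g x) ≡ sumOver xs f xor sumOver xs g
sumOver-xor f g []       = refl
sumOver-xor f g (x ∷ xs) =
  trans (cong ((f x xor g x) xor_) (sumOver-xor f g xs)) (𝔽₂-xor.interchange (f x) (g x) _ _)

sumOver-gather : ∀ {A B : Set} (f : A → List B) (F : B → 𝔽₂) xs ys →
                 sumOver (gather f xs ys) F ≡ sumOver xs (λ x → sumOver (f x) F) xor sumOver ys F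
sumOver-gather f F []       ys = refl
sumOver-gather f F (x ∷ xs) ys = begin
  sumOver (gather f xs (f x ++ ys)) F               ≡⟨ sumOver-gather f F xs (f x ++ ys) ⟩
  X xor sumOver (f x ++ ys) F                       ≡⟨ cong (X xor_) (sumOver-++ F (f x) ys) ⟩
  X xor (sumOver (f x) F xor sumOver ys F)          ≡⟨ sym (xor-assoc X _ _) ⟩
  (X xor sumOver (f x) F) xor sumOver ys F          ≡⟨ cong (_xor sumOver ys F) (𝔽₂-ring.+-comm X _) ⟩
  (sumOver (f x) F xor X) xor sumOver ys F          ∎
  where
  open ≡-Reasoning
  X = sumOver xs (λ x → sumOver (f x) F)

sumOver-multiply : ∀ {n} (F : Functional (suc n)) ms l → sumOver (multiply ms l) F ≡ sumOver ms (falsify l F)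
sumOver-multiply F ms l = trans (sumOver-gather (multiplyTerm l) F ms [])
  (trans (xor-identityʳ _) (sumOver-cong ms (term l)))
  where
  term : ∀ l S → sumOver (multiplyTerm l S) F ≡ falsify l F S
  term (pos i) S = cong (F S xor_) (xor-identityʳ _)
  term (neg i) S = xor-identityʳ _

-- Multiplying a polynomial by the indicator of a false literal is dual to taking that cofactor of
-- the functional. Duality reverses the order of the factors, so a left fold on polynomials meets
-- the right-nested `falsifyAll`.
sumOver-clausePoly : ∀ {n} (C : Clause n) S (F : Functional (suc n)) →
                     sumOver (clausePoly C S) F ≡ falsifyAll (toList C) F (⁅ zero ⁆ ∪ S)
sumOver-clausePoly C S F = trans (products (toList C) [ ⁅ zero ⁆ ∪ S ]) (xor-identityʳ _)
  where
  products : ∀ ls ms → sumOver (foldl multiply ms ls) F ≡ sumOver ms (falsifyAll ls F)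
  products []       ms = refl
  products (l ∷ ls) ms = trans (products ls (multiply ms l)) (sumOver-multiply (falsifyAll ls F) ms l)

-- The operation _^^_ of the definitions, for vectors of any length.
power : ∀ {m} → Vec 𝔽₂ m → Functional m
power a S = foldr′ _∧_ 𝟙 (zipWith (λ aᵢ i∈S → if i∈S then aᵢ else 𝟙) a S)

power-∪ : ∀ {m} (a : Vec 𝔽₂ m) S T → power a (S ∪ T) ≡ power a S ∧ power a T
power-∪ []      []          []          = refl
power-∪ (x ∷ a) (true  ∷ S) (true  ∷ T) = begin
  x ∧ power a (S ∪ T)               ≡⟨ cong₂ _∧_ (sym (∧-idem x)) (power-∪ a S T) ⟩
  (x ∧ x) ∧ (power a S ∧ power a T) ≡⟨ 𝔽₂-and.interchange x x (power a S) (power a T) ⟩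
  (x ∧ power a S) ∧ (x ∧ power a T) ∎
  where open ≡-Reasoning
power-∪ (x ∷ a) (true  ∷ S) (false ∷ T) = trans (cong (x ∧_) (power-∪ a S T)) (sym (∧-assoc x _ _))
power-∪ (x ∷ a) (false ∷ S) (true  ∷ T) = begin
  x ∧ power a (S ∪ T)         ≡⟨ cong (x ∧_) (power-∪ a S T) ⟩
  x ∧ (power a S ∧ power a T) ≡⟨ sym (∧-assoc x _ _) ⟩
  (x ∧ power a S) ∧ power a T ≡⟨ cong (_∧ power a T) (∧-comm x _) ⟩
  (power a S ∧ x) ∧ power a T ≡⟨ ∧-assoc (power a S) x _ ⟩
  power a S ∧ (x ∧ power a T) ∎
  where open ≡-Reasoning
power-∪ (x ∷ a) (false ∷ S) (false ∷ T) = power-∪ a S T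

power-⊥ : ∀ {m} (a : Vec 𝔽₂ m) → power a ⊥ ≡ 𝟙
power-⊥ []      = refl
power-⊥ (x ∷ a) = power-⊥ a

power-⁅⁆ : ∀ {m} (a : Vec 𝔽₂ m) i → power a ⁅ i ⁆ ≡ lookup a i
power-⁅⁆ (x ∷ a) zero    = trans (cong (x ∧_) (power-⊥ a)) (trans (∧-comm x 𝟙) refl)
power-⁅⁆ (x ∷ a) (suc i) = power-⁅⁆ a i

power-⁅⁆∪ : ∀ {m} (a : Vec 𝔽₂ m) i S → power a (⁅ i ⁆ ∪ S) ≡ lookup a i ∧ power a S
power-⁅⁆∪ a i S = trans (power-∪ a ⁅ i ⁆ S) (cong (_∧ power a S) (power-⁅⁆ a i))

falsifies : ∀ {n} → Vec Bool n → List (Literal n) → 𝔽₂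
falsifies a []       = 𝟙
falsifies a (l ∷ ls) = not (literalValue a l) ∧ falsifies a ls

-- Evaluation at a point is multiplicative, so the cofactor only scales it by the value of the
-- indicator at that point.
falsifyAll-power : ∀ {n} a₀ (a : Vec 𝔽₂ n) ls S →
                   falsifyAll ls (power (a₀ ∷ a)) S ≡ falsifies a ls ∧ power (a₀ ∷ a) S
falsifyAll-power a₀ a []       S = refl
falsifyAll-power a₀ a (l ∷ ls) S =
  trans (literal l) (sym (∧-assoc (not (literalValue a l)) (falsifies a ls) _))
  where
  open ≡-Reasoning
  f = falsifies a ls
  p = power (a₀ ∷ a)
  G = falsifyAll ls p
  enlarged : ∀ i → G (⁅ suc i ⁆ ∪ S) ≡ lookup a i ∧ (f ∧ p S)
  enlarged i = begin
    G (⁅ suc i ⁆ ∪ S)              ≡⟨ falsifyAll-power a₀ a ls (⁅ suc i ⁆ ∪ S) ⟩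
    f ∧ p (⁅ suc i ⁆ ∪ S)          ≡⟨ cong (f ∧_) (power-⁅⁆∪ (a₀ ∷ a) (suc i) S) ⟩
    f ∧ (lookup a i ∧ p S)         ≡⟨ sym (∧-assoc f _ _) ⟩
    (f ∧ lookup a i) ∧ p S         ≡⟨ cong (_∧ p S) (∧-comm f _) ⟩
    (lookup a i ∧ f) ∧ p S         ≡⟨ ∧-assoc (lookup a i) f _ ⟩
    lookup a i ∧ (f ∧ p S)         ∎
  complement : ∀ x y → y xor (x ∧ y) ≡ not x ∧ y
  complement false y = xor-identityʳ y
  complement true  false = refl
  complement true  true  = refl
  literal : ∀ l → falsify l G S ≡ not (literalValue a l) ∧ (f ∧ p S)
  literal (pos i) = trans (cong₂ _xor_ (falsifyAll-power a₀ a ls S) (enlarged i))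
        (complement (lookup a i) (f ∧ p S))
  literal (neg i) = trans (enlarged i) (cong (_∧ (f ∧ p S)) (sym (not-involutive (lookup a i))))

-- Minimum distance of Reed-Muller codes by slicing along the first coordinate

tails : ∀ {m} → Bool → List (Vec Bool (suc m)) → List (Vec Bool m)
tails b     []                = []
tails true  ((true  ∷ v) ∷ L) = v ∷ tails true L
tails true  ((false ∷ v) ∷ L) = tails true L
tails false ((true  ∷ v) ∷ L) = tails false L
tails false ((false ∷ v) ∷ L) = v ∷ tails false L

length-tails : ∀ {m} (L : List (Vec Bool (suc m))) → length L ≡ length (tails true L) + length (tails false L)
length-tails []                = refl
length-tails ((true  ∷ v) ∷ L) = cong suc (length-tails L)
length-tails ((false ∷ v) ∷ L) = trans (cong suc (length-tails L)) (sym (+-suc _ _))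

sumOver-tails : ∀ {m} (f : Vec Bool (suc m) → 𝔽₂) L →
  sumOver L f ≡ sumOver (tails true L) (f ∘ (true ∷_)) xor sumOver (tails false L) (f ∘ (false ∷_))
sumOver-tails f []                = refl
sumOver-tails f ((true  ∷ v) ∷ L) = trans (cong (f (true ∷ v) xor_) (sumOver-tails f L))
      (sym (xor-assoc (f (true ∷ v)) _ _))
sumOver-tails f ((false ∷ v) ∷ L) = begin
  f (false ∷ v) xor sumOver L f ≡⟨ cong (f (false ∷ v) xor_) (sumOver-tails f L) ⟩
  f (false ∷ v) xor (X xor Y)   ≡⟨ sym (xor-assoc (f (false ∷ v)) X Y) ⟩
  (f (false ∷ v) xor X) xor Y   ≡⟨ cong (_xor Y) (𝔽₂-ring.+-comm (f (false ∷ v)) X) ⟩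
  (X xor f (false ∷ v)) xor Y   ≡⟨ xor-assoc X (f (false ∷ v)) Y ⟩
  X xor (f (false ∷ v) xor Y)   ∎
  where
  open ≡-Reasoning
  X = sumOver (tails true L) (f ∘ (true ∷_))
  Y = sumOver (tails false L) (f ∘ (false ∷_))

Unique-tails : ∀ {m} b {L : List (Vec Bool (suc m))} → Unique L → Unique (tails b L)
Unique-tails b     {[]}              []      = []
Unique-tails true  {(true  ∷ v) ∷ L} (n ∷ u) = distinct L n ∷ Unique-tails true u
  where
  distinct : ∀ L → All ((true ∷ v) ≢_) L → All (v ≢_) (tails true L)
  distinct []                []       = []
  distinct ((true  ∷ w) ∷ L) (n ∷ ns) = (n ∘ cong (true ∷_)) ∷ distinct L ns
  distinct ((false ∷ w) ∷ L) (n ∷ ns) = distinct L ns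
Unique-tails true  {(false ∷ v) ∷ L} (n ∷ u) = Unique-tails true u
Unique-tails false {(true  ∷ v) ∷ L} (n ∷ u) = Unique-tails false u
Unique-tails false {(false ∷ v) ∷ L} (n ∷ u) = distinct L n ∷ Unique-tails false u
  where
  distinct : ∀ L → All ((false ∷ v) ≢_) L → All (v ≢_) (tails false L)
  distinct []                []       = []
  distinct ((true  ∷ w) ∷ L) (n ∷ ns) = distinct L ns
  distinct ((false ∷ w) ∷ L) (n ∷ ns) = (n ∘ cong (false ∷_)) ∷ distinct L ns

xor≡𝟘ʳ : ∀ {x y} → x xor y ≡ 𝟘 → x ≡ 𝟘 → y ≡ 𝟘
xor≡𝟘ʳ eq refl = eq

-- The minimum distance of the code dual to the polynomials of degree less than k.
distance : ∀ {m} k (L : List (Vec Bool m)) → Unique L → (∀ S → ∣ S ∣ < k → sumOver L (λ a → power a S) ≡ 𝟘) →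
           1 ≤ length L → 2 ^ k ≤ length L
distance         zero    L             u  orthogonal 1≤L = 1≤L
distance {zero}  (suc k) ([] ∷ [])     u  orthogonal 1≤L = contradiction (orthogonal [] (s≤s z≤n)) λ ()
distance {zero}  (suc k) ([] ∷ [] ∷ L) ((n ∷ _) ∷ _) orthogonal 1≤L = contradiction refl n
distance {suc m} (suc k) L             u  orthogonal 1≤L =
  cases (tails true L) (tails false L) (Unique-tails true u) (Unique-tails false u) (length-tails L)
    (λ S S< → trans (sym (trans (sumOver-tails (λ a → power a (true ∷ S)) L)
                                (trans (cong (sumOver (tails true L) (λ a → power a S) xor_)
                                      (sumOver-zero (tails false L)))
                                       (xor-identityʳ _))))
                    (orthogonal (true ∷ S) (s≤s S<)))
    (λ S S< → trans (sym (sumOver-tails (λ a → power a (false ∷ S)) L)) (orthogonal (false ∷ S) S<))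
  where
  cases : ∀ L₁ L₀ → Unique L₁ → Unique L₀ → length L ≡ length L₁ + length L₀ →
    (∀ S → ∣ S ∣ < k → sumOver L₁ (λ a → power a S) ≡ 𝟘) →
    (∀ S → ∣ S ∣ < suc k → sumOver L₁ (λ a → power a S) xor sumOver L₀ (λ a → power a S) ≡ 𝟘) →
    2 ^ suc k ≤ length L
  cases []          L₀          u₁ u₀ len o₁ o =
    subst (2 ^ suc k ≤_) (sym len) (distance (suc k) L₀ u₀ o (subst (1 ≤_) len 1≤L))
  cases L₁@(_ ∷ _) []          u₁ u₀ len o₁ o =
    subst (2 ^ suc k ≤_) (trans (sym (+-identityʳ _)) (sym len))
      (distance (suc k) L₁ u₁ (λ S S< → trans (sym (xor-identityʳ _)) (o S S<)) (s≤s z≤n))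
  -- The slice with first coordinate 1 is orthogonal to degree below k, by testing against monomials
  -- that contain this coordinate. Both slices together are orthogonal as well, hence so is the
  -- other slice, and each contributes 2^k points. When one slice is empty, the other inherits the
  -- full bound k + 1 in one dimension less.
  cases L₁@(_ ∷ _) L₀@(_ ∷ _) u₁ u₀ len o₁ o =
    subst (2 ^ suc k ≤_) (sym len)
      (+-mono-≤ (distance k L₁ u₁ o₁ (s≤s z≤n))
        (≤-trans (≤-reflexive (+-identityʳ _))
          (distance k L₀ u₀ (λ S S< → xor≡𝟘ʳ (o S (≤-trans S< (n≤1+n k))) (o₁ S S<)) (s≤s z≤n))))

sumOver-filter : ∀ {A : Set} (w f : A → 𝔽₂) xs → sumOver (filter (λ x → w x ≟ᵇ 𝟙) xs) f ≡ sumOver xs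
      (λ x → w x ∧ f x)
sumOver-filter w f []       = refl
sumOver-filter w f (x ∷ xs) with w x
... | true  = cong (f x xor_) (sumOver-filter w f xs)
... | false = sumOver-filter w f xs

-- Over 𝔽₂ a weight is the indicator of a subset. Filtering turns the weighted sums into plain ones,
-- and the bound for the filtered list bounds the whole.
weighted-distance : ∀ {m} k (w : Vec Bool m → 𝔽₂) {L} → Unique L →
  (∀ S → ∣ S ∣ < k → sumOver L (λ a → w a ∧ power a S) ≡ 𝟘) → ∀ {a} → a ∈ L → w a ≡ 𝟙 → 2 ^ k ≤ length L
weighted-distance k w {L} u orthogonal {a} a∈L wa =
  ≤-trans (distance k L′ (filter⁺ (λ x → w x ≟ᵇ 𝟙) u)
             (λ S S< → trans (sumOver-filter w (λ a → power a S) L) (orthogonal S S<))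
                   (inhabited (∈-filter⁺ (λ x → w x ≟ᵇ 𝟙) a∈L wa)))
          (length-filter (λ x → w x ≟ᵇ 𝟙) L)
  where
  L′ = filter (λ x → w x ≟ᵇ 𝟙) L
  inhabited : ∀ {L′} → a ∈ L′ → 1 ≤ length L′
  inhabited (here _)  = s≤s z≤n
  inhabited (there _) = s≤s z≤n

-- The system as a set of equations

∈-gather⁺ : ∀ {A B : Set} {f : A → List B} {xs ys x y} → x ∈ xs → y ∈ f x → y ∈ gather f xs ys
∈-gather⁺ {f = f} {xs} x∈ y∈ = from-element xs x∈ y∈
  where
  from-start : ∀ xs {ys y} → y ∈ ys → y ∈ gather f xs ys
  from-start []       y∈ = y∈
  from-start (x ∷ xs) y∈ = from-start xs (∈-++⁺ʳ (f x) y∈)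
  from-element : ∀ xs {ys x y} → x ∈ xs → y ∈ f x → y ∈ gather f xs ys
  from-element (x ∷ xs) (here refl) y∈ = from-start xs (∈-++⁺ˡ y∈)
  from-element (x ∷ xs) (there x∈)  y∈ = from-element xs x∈ y∈

∈-gather⁻ : ∀ {A B : Set} (f : A → List B) xs {ys y} → y ∈ gather f xs ys → (∃[ x ] x ∈ xs × y ∈ f x) ⊎ y ∈ ys
∈-gather⁻ f []       y∈ = inj₂ y∈
∈-gather⁻ f (x ∷ xs) y∈ with ∈-gather⁻ f xs y∈
... | inj₁ (x′ , x′∈ , y∈′) = inj₁ (x′ , there x′∈ , y∈′)
... | inj₂ y∈′ with ∈-++⁻ (f x) y∈′
...   | inj₁ y∈f = inj₁ (x , here refl , y∈f)
...   | inj₂ y∈″ = inj₂ y∈″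

∈-gather-[]⁻ : ∀ {A B : Set} (f : A → List B) xs {y} → y ∈ gather f xs [] → ∃[ x ] x ∈ xs × y ∈ f x
∈-gather-[]⁻ f xs y∈ with inj₁ found ← ∈-gather⁻ f xs y∈ = found

Balanced : ∀ {m} → ℕ → Item m → Set
Balanced d (b , S , T) = ∣ S ∪ T ∣ + b ≡ d

items-sound : ∀ d m {it} → it ∈ items d m → Balanced d it
items-sound d zero    (here refl) = refl
items-sound d (suc m) it∈ with it′ , it′∈ , grown ← ∈-gather-[]⁻ grow (items d m) it∈ = grow-sound it′ grown
      (items-sound d m it′∈)
  where
  grow-sound : ∀ (it : Item m) {it′} → it′ ∈ grow it → Balanced d it → Balanced d it′
  grow-sound (zero  , S , T) (here refl)                         eq = eq
  grow-sound (suc b , S , T) (here refl)                         eq = eq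
  grow-sound (suc b , S , T) (there (here refl))                 eq = trans (sym (+-suc _ b)) eq
  grow-sound (suc b , S , T) (there (there (here refl)))         eq = trans (sym (+-suc _ b)) eq
  grow-sound (suc b , S , T) (there (there (there (here refl)))) eq = trans (sym (+-suc _ b)) eq

items-complete : ∀ d m (it : Item m) → Balanced d it → it ∈ items d m
items-complete d zero    (b , [] , []) refl = here refl
items-complete d (suc m) (zero  , false ∷ S , false ∷ T) eq = ∈-gather⁺ (items-complete d m (zero , S , T) eq)
      (here refl)
items-complete d (suc m) (suc b , false ∷ S , false ∷ T) eq = ∈-gather⁺ (items-complete d m (suc b , S , T) eq)
      (here refl)
items-complete d (suc m) (b , true  ∷ S , false ∷ T) eq =
  ∈-gather⁺ (items-complete d m (suc b , S , T) (trans (+-suc _ b) eq)) (there (here refl))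
items-complete d (suc m) (b , false ∷ S , true  ∷ T) eq =
  ∈-gather⁺ (items-complete d m (suc b , S , T) (trans (+-suc _ b) eq)) (there (there (here refl)))
items-complete d (suc m) (b , true  ∷ S , true  ∷ T) eq =
  ∈-gather⁺ (items-complete d m (suc b , S , T) (trans (+-suc _ b) eq)) (there (there (there (here refl))))

occupied-sound : ∀ {m} (S : Subset m) → occupied S ≡ true → 1 ≤ ∣ S ∣
occupied-sound (true  ∷ S) eq = s≤s z≤n
occupied-sound (false ∷ S) eq = occupied-sound S eq

occupied-complete : ∀ {m} (S : Subset m) → 1 ≤ ∣ S ∣ → occupied S ≡ true
occupied-complete (true  ∷ S) _ = stays (toList S)
  where
  stays : ∀ bs → foldl (λ a x → x ∨ a) true bs ≡ true
  stays []           = refl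
  stays (true  ∷ bs) = stays bs
  stays (false ∷ bs) = stays bs
occupied-complete (false ∷ S) h = occupied-complete S h

module System {n d : ℕ} (8≤d : 8 ≤ d) (φ : Formula n) where

  private
    1≤d : 1 ≤ d
    1≤d = ≤-trans (s≤s z≤n) 8≤d

  Admissible : Subset (suc n) → Set
  Admissible S = 1 ≤ ∣ S ∣ × ∣ S ∣ ≤ d

  -- Inadmissible sets go to {0}; none occurs in the system.
  clamp : Subset (suc n) → 𝒰 n d
  clamp S with 1 ≤? ∣ S ∣ | ∣ S ∣ ≤? d
  ... | yes 1≤S | yes S≤d = mk𝒰 S 1≤S S≤d
  ... | _       | _       = ｛0｝ 1≤d

  set-clamp : ∀ {S} → Admissible S → set (clamp S) ≡ S
  set-clamp {S} (1≤S , S≤d) with 1 ≤? ∣ S ∣ | ∣ S ∣ ≤? d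
  ... | yes _  | yes _  = refl
  ... | no ¬p  | _      = contradiction 1≤S ¬p
  ... | yes _  | no ¬q  = contradiction S≤d ¬q

  𝒰-≡ : ∀ {U V : 𝒰 n d} → set U ≡ set V → U ≡ V
  𝒰-≡ {mk𝒰 S _ _} {mk𝒰 .S _ _} refl = refl

  admissible : ∀ (U : 𝒰 n d) → Admissible (set U)
  admissible (mk𝒰 S 1≤S S≤d) = recompute (1 ≤? ∣ S ∣) 1≤S , recompute (∣ S ∣ ≤? d) S≤d

  clamp-set : ∀ U → clamp (set U) ≡ U
  clamp-set U = 𝒰-≡ (set-clamp (admissible U))

  -- The equations as the algebra uses them, free of budgets and of the enumeration. Soundness and
  -- completeness of the enumeration are proved against this description, and the arguments about
  -- solutions see only this side.
  data SystemPoly : List (Subset (suc n)) → Set where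
    homogeneity  : ∀ T → 1 ≤ ∣ T ∣ → ∣ T ∣ < d → SystemPoly (T ∷ (⁅ zero ⁆ ∪ T) ∷ [])
    falsification : ∀ {C} S → C ∈ clauses φ → ∣ S ∣ + 4 ≤ d → SystemPoly (clausePoly C S)

  data SystemEquation : Equation (suc n) → Set where
    polynomial  : ∀ {ms} → SystemPoly ms → SystemEquation (linearEquation ms)
    product : ∀ S T → 1 ≤ ∣ S ∣ → 1 ≤ ∣ T ∣ → ∣ S ∪ T ∣ ≤ d → SystemEquation ([ S , T ] , [ S ∪ T ])

  polys : List (List (Subset (suc n)))
  polys = gather (itemPolys (clauses φ)) (items d (suc n)) []

  itemPolys-sound : ∀ it → Balanced d it → ∀ {ms} → ms ∈ itemPolys (clauses φ) it → SystemPoly ms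
  itemPolys-sound it@(b , S , T) balanced ms∈ with ∈-++⁻ (homogeneityPolys (clauses φ) it) ms∈
  ... | inj₁ ms∈h = homogeneous it balanced ms∈h
    where
    homogeneous : ∀ it → Balanced d it → ∀ {ms} → ms ∈ homogeneityPolys (clauses φ) it → SystemPoly ms
    homogeneous (suc b , S , T) balanced ms∈ with occupied S in eq
    homogeneous (suc b , S , T) balanced (here refl) | true = homogeneity S (occupied-sound S eq)
      (≤-trans (s≤s (≤-trans (∣p∣≤∣p∪q∣ S T) (m≤m+n _ b))) (≤-reflexive (trans (sym (+-suc _ b)) balanced)))
  ... | inj₂ ms∈c = falsifying it balanced ms∈c
    where
    falsifying : ∀ it → Balanced d it → ∀ {ms} → ms ∈ clausePolys (clauses φ) it → SystemPoly ms
    falsifying (suc (suc (suc (suc b))) , S , T) balanced ms∈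
      with C , C∈ , here refl ← ∈-gather-[]⁻ (λ C → [ clausePoly C S ]) (clauses φ) ms∈ =
      falsification S C∈ (≤-trans (+-mono-≤ (∣p∣≤∣p∪q∣ S T) (m≤m+n 4 b)) (≤-reflexive balanced))

  itemPolys-complete : ∀ {ms} → SystemPoly ms → ∃[ it ] it ∈ items d (suc n) × ms ∈ itemPolys (clauses φ) it
  itemPolys-complete (homogeneity S 1≤S S<d) =
    it , items-complete d (suc n) it balanced , ∈-++⁺ˡ member
    where
    r = d ∸ suc ∣ S ∣
    it : Item (suc n)
    -- With T empty the budget is d - |S|, which is positive because |S| < d.
    it = suc r , S , ⊥
    balanced : Balanced d it
    balanced = trans (cong (λ U → ∣ U ∣ + suc r) (∪-identityʳ S)) (trans (+-suc ∣ S ∣ r) (m+[n∸m]≡n S<d))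
    member : (S ∷ (⁅ zero ⁆ ∪ S) ∷ []) ∈ homogeneityPolys (clauses φ) it
    member rewrite occupied-complete S 1≤S = here refl
  itemPolys-complete (falsification {C} S C∈ S≤) =
    it , items-complete d (suc n) it balanced ,
    ∈-++⁺ʳ (homogeneityPolys (clauses φ) it) (∈-gather⁺ C∈ (here refl))
    where
    r = d ∸ (∣ S ∣ + 4)
    it : Item (suc n)
    it = 4 + r , S , ⊥
    balanced : Balanced d it
    balanced = trans (cong (λ U → ∣ U ∣ + (4 + r)) (∪-identityʳ S))
          (trans (sym (+-assoc ∣ S ∣ 4 r)) (m+[n∸m]≡n S≤))

  polys-sound : ∀ {ms} → ms ∈ polys → SystemPoly ms
  polys-sound ms∈ with it , it∈ , ms∈it ← ∈-gather-[]⁻ (itemPolys (clauses φ)) (items d (suc n)) ms∈ =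
    itemPolys-sound it (items-sound d (suc n) it∈) ms∈it

  polys-complete : ∀ {ms} → SystemPoly ms → ms ∈ polys
  polys-complete p with it , it∈ , ms∈ ← itemPolys-complete p = ∈-gather⁺ it∈ ms∈

  equations-sound : ∀ {g} → g ∈ equations (clauses φ) d → SystemEquation g
  equations-sound g∈ with ∈-gather-[]⁻ (itemEquations (clauses φ)) (items d (suc n)) g∈
  ... | it , it∈ , g∈it with ∈-++⁻ (productEquations (clauses φ) it) g∈it
  ...   | inj₁ g∈p = products it (items-sound d (suc n) it∈) g∈p
    where
    products : ∀ it → Balanced d it → ∀ {g} → g ∈ productEquations (clauses φ) it → SystemEquation g
    products (b , S , T) balanced g∈ with occupied S in eqS | occupied T in eqT
    products (b , S , T) balanced (here refl) | true | true =
      product S T (occupied-sound S eqS) (occupied-sound T eqT) (≤-trans (m≤m+n _ b) (≤-reflexive balanced))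
  ...   | inj₂ g∈l with ms , ms∈ , refl ← ∈-map⁻ linearEquation g∈l =
        polynomial (itemPolys-sound it (items-sound d (suc n) it∈) ms∈)

  equations-complete : ∀ {g} → SystemEquation g → g ∈ equations (clauses φ) d
  equations-complete (polynomial p) with it , it∈ , ms∈ ← itemPolys-complete p =
    ∈-gather⁺ it∈ (∈-++⁺ʳ (productEquations (clauses φ) it) (∈-map⁺ linearEquation ms∈))
  equations-complete (product S T 1≤S 1≤T ≤d) =
    ∈-gather⁺ (items-complete d (suc n) it (m+[n∸m]≡n ≤d)) (∈-++⁺ˡ member)
    where
    it : Item (suc n)
    it = d ∸ ∣ S ∪ T ∣ , S , T
    member : ([ S , T ] , [ S ∪ T ]) ∈ productEquations (clauses φ) it
    member rewrite occupied-complete S 1≤S | occupied-complete T 1≤T = here refl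

  ∣0∪S∣ : ∀ (S : Subset (suc n)) → 1 ≤ ∣ ⁅ zero ⁆ ∪ S ∣
  ∣0∪S∣ S = ≤-trans (≤-reflexive (sym (∣⁅x⁆∣≡1 {suc n} zero))) (∣p∣≤∣p∪q∣ ⁅ zero ⁆ S)

  poly-admissible : ∀ {ms} → SystemPoly ms → All Admissible ms
  poly-admissible (homogeneity T 1≤T T<d) =
    (1≤T , <⇒≤ T<d) ∷ (∣0∪S∣ T , ≤-trans (∣⁅i⁆∪S∣≤ zero T) T<d) ∷ []
  poly-admissible (falsification {C} S C∈ S≤) =
    products (toList C) [ ⁅ zero ⁆ ∪ S ]
      ((∣0∪S∣ S , ≤-trans (+-mono-≤ (∣⁅i⁆∪S∣≤ zero S) (≤-reflexive (length-toList C)))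
                          (≤-trans (≤-reflexive (sym (+-suc ∣ S ∣ 3))) S≤)) ∷ [])
    where
    -- The number j reserves degree for the literals still to be multiplied in; each multiplication
    -- may use up one unit.
    Room : ℕ → Subset (suc n) → Set
    Room j R = 1 ≤ ∣ R ∣ × ∣ R ∣ + j ≤ d
    term : ∀ l {j R} → Room (suc j) R → All (Room j) (multiplyTerm l R)
    term l {j} {R} (1≤R , R≤) = literal l
      where
      kept : Room j R
      kept = 1≤R , ≤-trans (+-monoʳ-≤ ∣ R ∣ (n≤1+n j)) R≤
      enlarged : ∀ i → Room j (⁅ i ⁆ ∪ R)
      enlarged i = ≤-trans 1≤R (∣q∣≤∣p∪q∣ ⁅ i ⁆ R) ,
        ≤-trans (+-monoˡ-≤ j (∣⁅i⁆∪S∣≤ i R)) (≤-trans (≤-reflexive (sym (+-suc ∣ R ∣ j))) R≤)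
      literal : ∀ l → All (Room j) (multiplyTerm l R)
      literal (pos i) = kept ∷ enlarged (suc i) ∷ []
      literal (neg i) = enlarged (suc i) ∷ []
    gathered : ∀ l {j} ms {ns} → All (Room (suc j)) ms → All (Room j) ns →
          All (Room j) (gather (multiplyTerm l) ms ns)
    gathered l []       []       ns = ns
    gathered l (m ∷ ms) (r ∷ rs) ns = gathered l ms rs (++⁺ (term l r) ns)
    products : ∀ ls ms → All (Room (length ls)) ms → All Admissible (foldl multiply ms ls)
    products []       ms rs = All.map (λ (1≤R , R≤) → 1≤R , ≤-trans (≤-reflexive (sym (+-identityʳ _))) R≤) rs
    products (l ∷ ls) ms rs = products ls (multiply ms l) (gathered l ms rs [])

  toPoly : List (Subset (suc n)) → Poly n d
  toPoly ms = mkPoly 𝟘 (map clamp ms)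

  toQuad : Equation (suc n) → QuadPoly n d
  toQuad (qs , ms) = mkQuad (map (λ (S , T) → clamp S , clamp T) qs) (map clamp ms)

  B : List (Poly n d)
  B = map toPoly polys

  Q : List (QuadPoly n d)
  Q = map toQuad (equations (clauses φ) d)

  union-admissible : ∀ {S T} → 1 ≤ ∣ S ∣ → 1 ≤ ∣ T ∣ → ∣ S ∪ T ∣ ≤ d → Admissible S × Admissible T × Admissible
        (S ∪ T)
  union-admissible {S} {T} 1≤S 1≤T ≤d =
    (1≤S , ≤-trans (∣p∣≤∣p∪q∣ S T) ≤d) , (1≤T , ≤-trans (∣q∣≤∣p∪q∣ S T) ≤d) , (≤-trans 1≤S (∣p∣≤∣p∪q∣ S T) , ≤d)

  encodes : encodeSystem Q ≡ encodeList encodeEquation (equations (clauses φ) d)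
  encodes = system (equations (clauses φ) d) (All.tabulate equations-sound)
    where
    poly : ∀ {ms} → All Admissible ms → encodeList encode𝒰 (map clamp ms) ≡ encodePoly ms
    poly []       = refl
    poly (a ∷ as) = cong₂ _∙_ (cong encodeSubset (set-clamp a)) (poly as)
    equation : ∀ {g} → SystemEquation g → encodeQuad (toQuad g) ≡ encodeEquation g
    equation (polynomial p) = cong (nil ∙_) (poly (poly-admissible p))
    equation (product S T 1≤S 1≤T ≤d) with aS , aT , aU ← union-admissible {S} {T} 1≤S 1≤T ≤d =
      cong₂ _∙_ (cong (_∙ nil) (cong₂ _∙_ (cong encodeSubset (set-clamp aS))
            (cong encodeSubset (set-clamp aT)))) (poly (aU ∷ []))
    system : ∀ gs → All SystemEquation gs → encodeSystem (map toQuad gs) ≡ encodeList encodeEquation gs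
    system []       []       = refl
    system (g ∷ gs) (e ∷ es) = cong₂ _∙_ (equation e) (system gs es)

  quadratization : Q IsQuadratizationOf B
  quadratization g = mk⇔ sound complete
    where
    Described : Set
    Described = (∃[ p ] p ∈ B × g ≡ linearize p)
              ⊎ (Σ[ S ∈ 𝒰 n d ] Σ[ T ∈ 𝒰 n d ] Σ[ h ∈ ∣ set S ∪ set T ∣ ≤ d ] g ≡ productConstraint S T h)
    described : ∀ {e} → SystemEquation e → g ≡ toQuad e → Described
    described (polynomial p) eq = inj₁ (_ , ∈-map⁺ toPoly (polys-complete p) , eq)
    described (product S T 1≤S 1≤T ≤d) eq with aS , aT , aU ← union-admissible {S} {T} 1≤S 1≤T ≤d =
      inj₂ (clamp S , clamp T , h ,
            trans eq (cong (λ U → mkQuad [ clamp S , clamp T ] [ U ])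
                  (𝒰-≡ (trans (set-clamp aU) (sym (trans (set-union (clamp S) (clamp T) h) union≡))))))
      where
      union≡ : set (clamp S) ∪ set (clamp T) ≡ S ∪ T
      union≡ = cong₂ _∪_ (set-clamp aS) (set-clamp aT)
      h : ∣ set (clamp S) ∪ set (clamp T) ∣ ≤ d
      h = ≤-trans (≤-reflexive (cong ∣_∣ union≡)) ≤d
      set-union : ∀ (U V : 𝒰 n d) .(h : ∣ set U ∪ set V ∣ ≤ d) → set (union U V h) ≡ set U ∪ set V
      set-union (mk𝒰 _ _ _) (mk𝒰 _ _ _) h = refl
    sound : g ∈ Q → Described
    sound g∈ with e , e∈ , eq ← ∈-map⁻ toQuad g∈ = described (equations-sound e∈) eq
    complete : Described → g ∈ Q
    complete (inj₁ (p , p∈ , refl)) with ms , ms∈ , refl ← ∈-map⁻ toPoly p∈ =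
      ∈-map⁺ toQuad (equations-complete (polynomial (polys-sound ms∈)))
    complete (inj₂ (U@(mk𝒰 S _ _) , V@(mk𝒰 T _ _) , h , refl)) =
      subst (_∈ Q) (cong₂ (λ UV W → mkQuad [ UV ] [ W ]) (cong₂ _,_ (clamp-set U) (clamp-set V))
            (clamp-set (union U V h)))
        (∈-map⁺ toQuad (equations-complete (product S T (proj₁ (admissible U)) (proj₁ (admissible V)) h)))

  constantFree : All ConstantFree B
  constantFree = All.tabulate λ p∈ → free (∈-map⁻ toPoly p∈)
    where
    free : ∀ {p} → ∃[ ms ] ms ∈ polys × p ≡ toPoly ms → ConstantFree p
    free (_ , _ , refl) = refl

-- Completeness and soundness of the system

xor≡𝟘⇒≡ : ∀ x y → x xor y ≡ 𝟘 → x ≡ y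
xor≡𝟘⇒≡ false false _ = refl
xor≡𝟘⇒≡ true  true  _ = refl

sum-sumOver : ∀ {A : Set} {t} (f : Fin t → A → 𝔽₂) xs →
              sum (λ i → sumOver xs (f i)) ≡ sumOver xs (λ x → sum (λ i → f i x))
sum-sumOver {t = t} f []       = 𝔽₂-sum.sum-replicate-zero t
sum-sumOver         f (x ∷ xs) =
  trans (𝔽₂-sum.∑-distrib-+ (λ i → f i x) (λ i → sumOver xs (f i)))
        (cong (sum (λ i → f i x) xor_) (sum-sumOver f xs))

falsifies-satisfied : ∀ {n k} (a : Vec Bool n) (C : Vec (Literal n) k) →
                      VecAny.Any (λ l → literalValue a l ≡ true) C → falsifies a (toList C) ≡ 𝟘
falsifies-satisfied a (l ∷ C) (VecAny.here eq) rewrite eq = refl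
falsifies-satisfied a (l ∷ C) (VecAny.there any) with literalValue a l
... | true  = refl
... | false = falsifies-satisfied a C any

falsifies-all : ∀ {n} (a : Vec Bool n) {ls} → All (λ l → literalValue a l ≡ false) ls → falsifies a ls ≡ 𝟙
falsifies-all a []       = refl
falsifies-all a (v ∷ vs) rewrite v = falsifies-all a vs

zero-or-support : ∀ {m} (a : Vec 𝔽₂ m) → a ≡ Vec.replicate m 𝟘 ⊎ ∃[ i ] lookup a i ≡ 𝟙
zero-or-support []          = inj₁ refl
zero-or-support (true  ∷ a) = inj₂ (zero , refl)
zero-or-support (false ∷ a) with zero-or-support a
... | inj₁ a≡        = inj₁ (cong (false ∷_) a≡)
... | inj₂ (i , aᵢ≡) = inj₂ (suc i , aᵢ≡)

All-or : ∀ {A : Set} {P : A → Set} {R : Set} (xs : List A) → (∀ {x} → x ∈ xs → P x ⊎ R) → All P xs ⊎ R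
All-or []       f = inj₁ []
All-or (x ∷ xs) f with f (here refl) | All-or xs (f ∘ there)
... | inj₂ r | _       = inj₂ r
... | inj₁ p | inj₁ ps = inj₁ (p ∷ ps)
... | inj₁ p | inj₂ r  = inj₂ r

module Soundness {n d : ℕ} (8≤d : 8 ≤ d) (φ : Formula n) where
  open System 8≤d φ

  evalPoly-toPoly : ∀ {ms} → SystemPoly ms → ∀ a → evalPoly (toPoly ms) a ≡ sumOver ms (power a)
  evalPoly-toPoly p a = sumOver-map-All clamp (λ ok → cong (power a) (set-clamp ok)) (poly-admissible p)

  vanishes-at-solution : ∀ {a} → a ⊨ φ → ∀ {ms} → SystemPoly ms → sumOver ms (power (𝟙 ∷ a)) ≡ 𝟘
  vanishes-at-solution {a} sat (homogeneity T _ _) = begin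
    x xor (power (𝟙 ∷ a) (⁅ zero ⁆ ∪ T) xor 𝟘) ≡⟨ cong (x xor_)
          (trans (xor-identityʳ _) (power-⁅⁆∪ (𝟙 ∷ a) zero T)) ⟩
    x xor x                                     ≡⟨ xor-same x ⟩
    𝟘                                           ∎
    where
    open ≡-Reasoning
    x = power (𝟙 ∷ a) T
  vanishes-at-solution {a} sat (falsification {C} S C∈ _) = begin
    sumOver (clausePoly C S) (power (𝟙 ∷ a))                      ≡⟨ sumOver-clausePoly C S (power (𝟙 ∷ a)) ⟩
    falsifyAll (toList C) (power (𝟙 ∷ a)) (⁅ zero ⁆ ∪ S)          ≡⟨ falsifyAll-power 𝟙 a (toList C)
          (⁅ zero ⁆ ∪ S) ⟩
    falsifies a (toList C) ∧ power (𝟙 ∷ a) (⁅ zero ⁆ ∪ S)         ≡⟨ cong (_∧ power (𝟙 ∷ a) (⁅ zero ⁆ ∪ S))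
          (falsifies-satisfied a C (All.lookup sat C∈)) ⟩
    𝟘                                                             ∎
    where open ≡-Reasoning

  solution : Satisfiable φ → Σ[ a ∈ Point n ] (a SolvesPoly B) × (lookup a zero ≡ 𝟙)
  solution (a , sat) = 𝟙 ∷ a , All.tabulate (λ p∈ → solves (∈-map⁻ toPoly p∈)) , refl
    where
    solves : ∀ {p} → ∃[ ms ] ms ∈ polys × p ≡ toPoly ms → evalPoly p (𝟙 ∷ a) ≡ 𝟘
    solves (ms , ms∈ , refl) = trans (evalPoly-toPoly (polys-sound ms∈) (𝟙 ∷ a))
          (vanishes-at-solution sat (polys-sound ms∈))

  quadraticSolution : ∀ .(1≤d : 1 ≤ d) → Satisfiable φ → Σ[ y ∈ Assignment n d ] (y Solves Q) ×
        (y (｛0｝ 1≤d) ≡ 𝟙)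
  quadraticSolution 1≤d (a , sat) =
    y , All.tabulate (λ g∈ → solves (∈-map⁻ toQuad g∈)) , power-⁅⁆ (𝟙 ∷ a) zero
    where
    y : Assignment n d
    y U = power (𝟙 ∷ a) (set U)
    solvesEquation : ∀ {e} → SystemEquation e → evalQuad (toQuad e) y ≡ 𝟘
    solvesEquation (polynomial p) = trans (evalPoly-toPoly p (𝟙 ∷ a)) (vanishes-at-solution sat p)
    solvesEquation (product S T 1≤S 1≤T ≤d) with aS , aT , aU ← union-admissible {S} {T} 1≤S 1≤T ≤d = begin
      ((y (clamp S) ∧ y (clamp T)) xor 𝟘) xor (y (clamp (S ∪ T)) xor 𝟘)
        ≡⟨ cong₂ _xor_ (trans (xor-identityʳ (y (clamp S) ∧ y (clamp T)))
              (cong₂ _∧_ (cong (power (𝟙 ∷ a)) (set-clamp {S} aS)) (cong (power (𝟙 ∷ a)) (set-clamp {T} aT))))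
                       (trans (xor-identityʳ (y (clamp (S ∪ T))))
                             (trans (cong (power (𝟙 ∷ a)) (set-clamp {S ∪ T} aU)) (power-∪ (𝟙 ∷ a) S T))) ⟩
      x xor x ≡⟨ xor-same x ⟩
      𝟘 ∎
      where
      open ≡-Reasoning
      x = power (𝟙 ∷ a) S ∧ power (𝟙 ∷ a) T
    solves : ∀ {g} → ∃[ e ] e ∈ equations (clauses φ) d × g ≡ toQuad e → evalQuad g y ≡ 𝟘
    solves (e , e∈ , refl) = solvesEquation (equations-sound e∈)

  far : ¬ Satisfiable φ → (σ : Assignment n d) → σ SatisfiesMonomially B →
        (β : PointSet n) → β Represents σ → (points β ≡ [ origin ]) ⊎ (2 ^ (d ∸ 3) ≤ card β)
  far unsat σ satisfies β represents with All-or (points β) (λ {a} → dichotomy a)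
    where
    orthogonal : ∀ {ms} → SystemPoly ms → sumOver (points β) (λ a → sumOver ms (power a)) ≡ 𝟘
    orthogonal {ms} p =
      trans (sumOver-cong (points β) (λ a → sym (evalPoly-toPoly p a)))
        (trans (sym (represents (toPoly ms))) (All.lookup satisfies (∈-map⁺ toPoly (polys-complete p))))

    small⇒ : ∀ {s} → s < d ∸ 3 → s + 4 ≤ d
    small⇒ {s} s< = ≤-trans (≤-reflexive (+-suc s 3))
          (≤-trans (+-monoˡ-≤ 3 s<) (≤-reflexive (m∸n+n≡m (≤-trans (≤ᵇ⇒≤ 3 8 _) 8≤d))))

    dichotomy : ∀ a → a ∈ points β → a ≡ origin ⊎ 2 ^ (d ∸ 3) ≤ card β
    dichotomy (true ∷ a) a∈ with C , C∈ , allFalse ← falsified φ unsat a =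
      -- The falsification polynomial for C and S is w times x^S, where w selects the points with x₀
      -- = 1 that falsify C. It is available for |S| ≤ d - 4, hence the exponent d - 3.
      inj₂ (weighted-distance (d ∸ 3) w (PointSet.unique β) (λ S S< →
              trans (sumOver-cong (points β) (λ { (a₀ ∷ a) → sym (pointwise a₀ a S) }))
                    (orthogonal (falsification S C∈ (small⇒ S<))))
            a∈ (trans (∧-identityʳ _) (falsifies-all a allFalse)))
      where
      w : Point n → 𝔽₂
      w (a₀ ∷ a) = falsifies a (toList C) ∧ a₀
      pointwise : ∀ a₀ a S → sumOver (clausePoly C S) (power (a₀ ∷ a)) ≡ w (a₀ ∷ a) ∧ power (a₀ ∷ a) S
      pointwise a₀ a S = trans (sumOver-clausePoly C S (power (a₀ ∷ a)))
        (trans (falsifyAll-power a₀ a (toList C) (⁅ zero ⁆ ∪ S))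
          (trans (cong (falsifies a (toList C) ∧_) (power-⁅⁆∪ (a₀ ∷ a) zero S))
                (sym (∧-assoc (falsifies a (toList C)) a₀ _))))
    dichotomy (false ∷ a) a∈ with zero-or-support a
    ... | inj₁ a≡         = inj₁ (cong (false ∷_) a≡)
    ... | inj₂ (i , aᵢ≡𝟙) =
      -- The homogeneity polynomial of T = {i} ∪ S factors as (1 + x₀) xᵢ x^S, that is, w times x^S.
      -- Including i keeps T nonempty even for empty S.
      inj₂ (weighted-distance (d ∸ 3) w (PointSet.unique β) (λ S S< →
              trans (sumOver-cong (points β) (λ { (a₀ ∷ a) → sym (pointwise a₀ a S) }))
                    (orthogonal (homogeneity (⁅ suc i ⁆ ∪ S)
                      (≤-trans (≤-reflexive (sym (∣⁅x⁆∣≡1 (suc i)))) (∣p∣≤∣p∪q∣ ⁅ suc i ⁆ S))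
                      (≤-trans (s≤s (∣⁅i⁆∪S∣≤ (suc i) S))
                            (≤-trans (≤-trans (≤-reflexive (+-comm 2 ∣ S ∣)) (+-monoʳ-≤ ∣ S ∣ (≤ᵇ⇒≤ 2 4 _)))
                            (small⇒ S<))))))
            a∈ aᵢ≡𝟙)
      where
      w : Point n → 𝔽₂
      w (a₀ ∷ a) = not a₀ ∧ lookup a i
      complement : ∀ x y → y xor ((x ∧ y) xor 𝟘) ≡ not x ∧ y
      complement false y = xor-identityʳ y
      complement true  false = refl
      complement true  true  = refl
      pointwise : ∀ a₀ a S → sumOver ((⁅ suc i ⁆ ∪ S) ∷ (⁅ zero ⁆ ∪ (⁅ suc i ⁆ ∪ S)) ∷ []) (power (a₀ ∷ a)) ≡ w
            (a₀ ∷ a) ∧ power (a₀ ∷ a) S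
      pointwise a₀ a S = trans (cong (λ z → x xor (z xor 𝟘)) (power-⁅⁆∪ (a₀ ∷ a) zero (⁅ suc i ⁆ ∪ S)))
        (trans (complement a₀ x) (trans (cong (not a₀ ∧_) (power-⁅⁆∪ (a₀ ∷ a) (suc i) S))
              (sym (∧-assoc (not a₀) (lookup a i) _))))
        where x = power (a₀ ∷ a) (⁅ suc i ⁆ ∪ S)
  ... | inj₂ large = inj₂ large
  -- Representing the constant polynomial 1 makes the number of points odd, so β is not empty;
  -- without repetitions only a single origin remains.
  ... | inj₁ zeros = inj₁ (singleton (points β) zeros (PointSet.unique β) (represents (mkPoly 𝟙 [])))
    where
    singleton : ∀ xs → All (_≡ origin) xs → Unique xs → 𝟙 ≡ sumOver xs (evalPoly (mkPoly {d = d} 𝟙 [])) →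
          xs ≡ [ origin ]
    singleton (x ∷ [])     (refl ∷ [])       _             _ = refl
    singleton (x ∷ y ∷ xs) (refl ∷ refl ∷ _) ((n ∷ _) ∷ _) _ = contradiction refl n

  superposition : ∀ {t} → (t + 1) ^ 4 ≤ 2 ^ d → 4 ∣ d → ¬ Satisfiable φ →
    (τ : Fin t → Assignment n d) → τ SolveInSuperposition Q → ∀ S → aggregate τ S ≡ 𝟘
  superposition {t} t-small (divides k d≡) unsat τ solves U =
    trans (cong (aggregate τ) (sym (clamp-set U)))
      (vanishing 2≤k φ unsat θ F homogeneous annihilated factors t<2^k (set U)
        (proj₁ (admissible U)) (≤-trans (proj₂ (admissible U)) (≤-reflexive d≡4k)))
    where
    θ : Fin t → Functional (suc n)
    θ i = τ i ∘ clamp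
    -- At the empty set `clamp` makes this the value at {0}. None of the hypotheses of `vanishing`
    -- involves that value.
    F : Functional (suc n)
    F = aggregate τ ∘ clamp
    d≡4k : d ≡ 4 * k
    d≡4k = trans d≡ (*-comm k 4)
    2≤k : 2 ≤ k
    2≤k = *-cancelˡ-≤ 4 (≤-trans 8≤d (≤-reflexive d≡4k))
    -- The origin of c = 4: with d = 4k the hypothesis reads (t + 1)^4 ≤ (2^k)^4, and fourth roots
    -- give t + 1 ≤ 2^k.
    t<2^k : t < 2 ^ k
    t<2^k = ≤-trans (≤-reflexive (+-comm 1 t)) (≮⇒≥ λ 2^k< → <⇒≱ (^-monoˡ-< 4 2^k<)
      (≤-trans t-small (≤-reflexive (trans (cong (2 ^_) d≡) (sym (^-*-assoc 2 k 4))))))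
    -- Linear equations commute with the sum over i, so the aggregate satisfies them outright. A
    -- product constraint does not commute with it, and yields an inner product over i instead.
    linear-vanishes : ∀ {ms} → SystemPoly ms → sumOver ms F ≡ 𝟘
    linear-vanishes {ms} p = begin
      sumOver ms F                                 ≡⟨ sym (sum-sumOver θ ms) ⟩
      sum (λ i → sumOver ms (θ i))                 ≡⟨ sum-cong (λ i → sym (sumOver-map clamp (τ i) ms)) ⟩
      sum (λ i → sumOver (map clamp ms) (τ i))     ≡⟨ All.lookup solves
            (∈-map⁺ toQuad (equations-complete (polynomial p))) ⟩
      𝟘                                            ∎
      where open ≡-Reasoning
    homogeneous : ∀ S → 1 ≤ ∣ S ∣ → ∣ S ∣ < 4 * k → F S ≡ F (⁅ zero ⁆ ∪ S)
    homogeneous S 1≤S S< = xor≡𝟘⇒≡ _ _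
      (trans (cong (F S xor_) (sym (xor-identityʳ _)))
            (linear-vanishes (homogeneity S 1≤S (≤-trans S< (≤-reflexive (sym d≡4k))))))
    annihilated : ∀ {C} → C ∈ clauses φ → ∀ S → ∣ S ∣ + 4 ≤ 4 * k → falsifyAll (toList C) F (⁅ zero ⁆ ∪ S) ≡ 𝟘
    annihilated {C} C∈ S S≤ =
      trans (sym (sumOver-clausePoly C S F))
            (linear-vanishes (falsification S C∈ (≤-trans S≤ (≤-reflexive (sym d≡4k)))))
    factors : ∀ A B → 1 ≤ ∣ A ∣ → 1 ≤ ∣ B ∣ → ∣ A ∪ B ∣ ≤ 4 * k → sum (λ i → θ i A ∧ θ i B) ≡ F (A ∪ B)
    factors A B 1≤A 1≤B ≤4k = xor≡𝟘⇒≡ _ _ (begin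
      sum (λ i → θ i A ∧ θ i B) xor F (A ∪ B)
        ≡⟨ sym (𝔽₂-sum.∑-distrib-+ (λ i → θ i A ∧ θ i B) (λ i → θ i (A ∪ B))) ⟩
      sum (λ i → (θ i A ∧ θ i B) xor θ i (A ∪ B))
        ≡⟨ sum-cong (λ i → sym (cong₂ _xor_ (xor-identityʳ (θ i A ∧ θ i B)) (xor-identityʳ (θ i (A ∪ B))))) ⟩
      sum (λ i → evalQuad (toQuad ([ A , B ] , [ A ∪ B ])) (τ i))
        ≡⟨ All.lookup solves (∈-map⁺ toQuad
              (equations-complete (product A B 1≤A 1≤B (≤-trans ≤4k (≤-reflexive (sym d≡4k)))))) ⟩
      𝟘 ∎)
      where open ≡-Reasoning

theorem3p7 : Σ[ c ∈ ℕ ] (1 ≤ c) × (Σ[ C ∈ ℕ ] Σ[ P ∈ Program ]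
    ((t d : ℕ) → 1 ≤ t → 4 ∣ d → (8≤d : 8 ≤ d) → d ≥ c ·log₂ (t + 1) →
    (n : ℕ) (φ : Formula n) →
    Σ[ Q ∈ List (QuadPoly n d) ]
    (P Maps encodeInstance t d n φ To encodeSystem Q InTime ((n ⊔ 2) ^ (C * d)))
    × (Satisfiable φ →
    Σ[ y ∈ Assignment n d ] (y Solves Q) × (y (｛0｝ (≤-trans (s≤s z≤n) 8≤d)) ≡ 𝟙))
    × (¬ Satisfiable φ →
    (τ : Fin t → Assignment n d) → τ SolveInSuperposition Q →
    ∀ S → aggregate τ S ≡ 𝟘)
    × (Σ[ B ∈ List (Poly n d) ]
    All ConstantFree B
    × (Satisfiable φ →
    Σ[ a ∈ Point n ] (a SolvesPoly B) × (lookup a zero ≡ 𝟙))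
    × (¬ Satisfiable φ →
    (σ : Assignment n d) → σ SatisfiesMonomially B →
    (β : PointSet n) → β IsMinimalFor σ →
    (points β ≡ [ origin ]) ⊎ (2 ^ (d ∸ 3) ≤ card β))
    × (Q IsQuadratizationOf B))))
theorem3p7 = 4 , s≤s z≤n , 23 , systemProgram , λ t d _ 4∣d 8≤d t-small n φ →
  let open System 8≤d φ
      open Soundness 8≤d φ
  in Q
   , subst (λ w → systemProgram Maps encodeInstance t d n φ To w InTime ((n ⊔ 2) ^ (23 * d)))
           (sym encodes) (system-computable d n 8≤d t φ)
   , quadraticSolution (≤-trans (s≤s z≤n) 8≤d)
   , superposition t-small 4∣d
   , B , constantFree , solution
   , (λ unsat σ satisfies β minimal → far unsat σ satisfies β (proj₁ minimal))
   , quadratization
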